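{- Among all non cycle balanced unicyclic sidigraphs on $n$ vertices ($n\ge 2$), the negative cycle $\mathbf{C}_n$ has the largest energy, i.e. $E(S)\le E(\mathbf{C}_n)$ for every such sidigraph $S$. Moreover, the energy of negative cycles increases monotonically with respect to the order: $E(\mathbf{C}_m)<E(\mathbf{C}_n)$ whenever $2\le m<n$. Minimal energy is attained by $\mathbf{C}_2$, the negative cycle of order $2$.
   Context: A sidigraph (signed digraph) is a pair $S=(D,\sigma)$, where $D=(V,\mathscr{A})$ is a digraph (without loops) and $\sigma:\mathscr{A}\to\{ -1,1\}$. Its adjacency matrix $A(S)=(a_{ij})$ has $a_{ij}=\sigma(v_i,v_j)$ if there is an arc from $v_i$ to $v_j$ and $0$ otherwise. The energy of $S$ is $E(S)=\sum_{j=1}^n|\Re z_j|$, where $z_1,\dots,z_n$ are the eigenvalues of $A(S)$ with multiplicity. Cycles are directed cycles (of length at least $2$); a sidigraph is unicyclic if it has exactly one directed cycle. The sign of a cycle is the product of the signs of its arcs. A sidigraph is cycle balanced if each of its cycles is positive, and non cycle balanced otherwise. $\mathbf{C}_n$ denotes a negative directed cycle on $n$ vertices (the sidigraph consisting of a directed cycle of length $n$ with an odd number of negative arcs). -}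

module Defs where

open import Level using () renaming (_⊔_ to _⊔ˡ_; suc to lsuc)
open import Algebra.Apartness.Bundles using (HeytingField)
open import Algebra.Bundles.Raw using (RawRing)
open import Algebra.Core using (Op₁; Op₂)
import Algebra.Definitions.RawMonoid as RawMonoidOps
import Algebra.Definitions.RawSemiring as RawSemiringOps
open import Data.Fin.Base using (Fin; zero; suc; toℕ; punchIn)
open import Data.Fin.Properties using () renaming (_≟_ to _≟ᶠ_)
open import Data.Maybe.Base using (Maybe; just; nothing)
open import Data.Nat.Base as ℕ using (ℕ; zero; suc)
open import Data.Nat.DivMod using (_mod_)
open import Data.Product.Base using (Σ-syntax; ∃-syntax; _×_)
import Data.Sign.Base as Sign
open Sign using (Sign)
open import Data.Sum.Base using (_⊎_)
open import Data.Vec.Functional using (foldr)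
open import Function.Bundles using (_⇔_)
open import Function.Definitions using (Injective)
open import Relation.Binary.Core using (Rel)
open import Relation.Binary.Lattice.Definitions using (Supremum)
open import Relation.Binary.PropositionalEquality.Core using (_≡_)
open import Relation.Binary.Structures using (IsStrictPartialOrder)
open import Relation.Nullary.Decidable.Core using (does)
open import Relation.Nullary.Negation.Core using (¬_)
open import Data.Bool.Base using (if_then_else_)

------------------------------------------------------------------------
-- Sidigraphs

record Sidigraph (n : ℕ) : Set where
  field
    -- 'just s' is an arc of sign s, 'nothing' is the absence of an arc.
    arc      : Fin n → Fin n → Maybe Sign
    loopless : ∀ v → arc v v ≡ nothing

next : ∀ {k} → Fin (suc k) → Fin (suc k)
next {k} i = suc (toℕ i) mod suc k

record Cycle {n : ℕ} (S : Sidigraph n) : Set where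
  open Sidigraph S
  field
    {length-2} : ℕ

  length : ℕ
  length = suc (suc length-2)

  field
    vertex     : Fin length → Fin n
    vertex-inj : Injective _≡_ _≡_ vertex
    arcSign    : Fin length → Sign
    isArc      : ∀ i → arc (vertex i) (vertex (next i)) ≡ just (arcSign i)

  Traverses : Fin n → Fin n → Set
  Traverses u w = ∃[ i ] vertex i ≡ u × vertex (next i) ≡ w

  sign : Sign
  sign = foldr Sign._*_ Sign.+ arcSign

-- A 'Cycle' carries a choice of initial vertex; two of them are the same
-- directed cycle when they have the same set of arcs.
SameCycle : ∀ {n} {S : Sidigraph n} → Cycle S → Cycle S → Set
SameCycle c d = ∀ u w → Cycle.Traverses c u w ⇔ Cycle.Traverses d u w

Unicyclic : ∀ {n} → Sidigraph n → Set
Unicyclic S = Σ[ c ∈ Cycle S ] (∀ d → SameCycle c d)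

CycleBalanced : ∀ {n} → Sidigraph n → Set
CycleBalanced S = (c : Cycle S) → Cycle.sign c ≡ Sign.+

NonCycleBalanced : ∀ {n} → Sidigraph n → Set
NonCycleBalanced S = ¬ CycleBalanced S

-- S is a negative cycle 𝐂ₙ: all its n vertices lie on one negative directed
-- cycle, which uses all the arcs of S.
record IsNegativeCycle {n : ℕ} (S : Sidigraph n) : Set where
  open Sidigraph S
  field
    cycle    : Cycle S
    spanning : Cycle.length cycle ≡ n
    allArcs  : ∀ {u w s} → arc u w ≡ just s → Cycle.Traverses cycle u w
    negative : Cycle.sign cycle ≡ Sign.-

------------------------------------------------------------------------
-- Matrices

module Matrix {c ℓ} (R : RawRing c ℓ) where
  open RawRing R
  open RawMonoidOps +-rawMonoid public using (sum)
  open RawMonoidOps *-rawMonoid public using () renaming (sum to product)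
  open RawSemiringOps rawSemiring using (_^_)

  Mat : ℕ → Set c
  Mat n = Fin n → Fin n → Carrier

  -- Laplace expansion along the first row.
  det : ∀ {n} → Mat n → Carrier
  det {zero}  M = 1#
  det {suc n} M = sum λ j →
    ((- 1#) ^ toℕ j) * (M zero j * det (λ i k → M (suc i) (punchIn j k)))

  -- det (x I − M)
  charPoly : ∀ {n} → Mat n → Carrier → Carrier
  charPoly M x = det λ i j → (if does (i ≟ᶠ j) then x else 0#) + (- M i j)

  entry : Maybe Sign → Carrier
  entry nothing       = 0#
  entry (just Sign.+) = 1#
  entry (just Sign.-) = - 1#

  adjacency : ∀ {n} → Sidigraph n → Mat n
  adjacency S i j = entry (Sidigraph.arc S i j)

------------------------------------------------------------------------
-- The real numbers, axiomatised as a Cauchy complete Archimedean ordered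
-- field.  Classically this characterises ℝ up to isomorphism.  The axioms
-- are the constructive ones (neither a decidable nor a total order is
-- asked for), so that Bishop's regular sequences of rationals are a model.

record RealField c ℓ₁ ℓ₂ : Set (lsuc (c ⊔ˡ ℓ₁ ⊔ˡ ℓ₂)) where
  infix 4 _<_ _≤_
  infixl 6 _⊔_
  field
    heytingField : HeytingField c ℓ₁ ℓ₂

  open HeytingField heytingField public

  field
    _<_                  : Rel Carrier ℓ₂
    isStrictPartialOrder : IsStrictPartialOrder _≈_ _<_
    #⇔<                  : ∀ x y → x # y ⇔ (x < y ⊎ y < x)
    +-monoˡ-<            : ∀ z {x y} → x < y → x + z < y + z
    *-pos                : ∀ {x y} → 0# < x → 0# < y → 0# < x * y

  _≤_ : Rel Carrier ℓ₂
  x ≤ y = ¬ (y < x)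

  -- Binary maxima are derivable from completeness; they are included so
  -- that the absolute value can be defined directly.
  field
    _⊔_        : Op₂ Carrier
    ⊔-supremum : Supremum _≤_ _⊔_

  ∣_∣ : Op₁ Carrier
  ∣ x ∣ = x ⊔ (- x)

  rawRing : RawRing c ℓ₁
  rawRing = record
    { _≈_ = _≈_ ; _+_ = _+_ ; _*_ = _*_ ; -_ = -_ ; 0# = 0# ; 1# = 1# }

  open RawMonoidOps (RawRing.+-rawMonoid rawRing) public
    using () renaming (_×_ to _·_)

  -- x is within 1/k of y.
  Within1/ : ℕ → Rel Carrier ℓ₂
  Within1/ k x y = k · ∣ x - y ∣ < 1#

  IsCauchy : (ℕ → Carrier) → Set ℓ₂
  IsCauchy f = ∀ k → ∃[ N ] (∀ m n → N ℕ.≤ m → N ℕ.≤ n → Within1/ k (f m) (f n))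

  _ConvergesTo_ : (ℕ → Carrier) → Carrier → Set ℓ₂
  f ConvergesTo l = ∀ k → ∃[ N ] (∀ n → N ℕ.≤ n → Within1/ k (f n) l)

  field
    archimedean : ∀ x → ∃[ n ] x < n · 1#
    complete    : ∀ f → IsCauchy f → ∃[ l ] f ConvergesTo l

------------------------------------------------------------------------
-- Energy

module Energy {c ℓ₁ ℓ₂} (ℝ : RealField c ℓ₁ ℓ₂) where
  open RealField ℝ

  record ℂ : Set c where
    constructor _+i_
    field
      re im : Carrier

  open ℂ public

  ℂ-rawRing : RawRing c ℓ₁
  ℂ-rawRing = record
    { Carrier = ℂ
    ; _≈_     = λ z w → re z ≈ re w × im z ≈ im w
    ; _+_     = λ z w → (re z + re w) +i (im z + im w)
    ; _*_     = λ z w → (re z * re w - im z * im w) +i (re z * im w + im z * re w)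
    ; -_      = λ z → (- re z) +i (- im z)
    ; 0#      = 0# +i 0#
    ; 1#      = 1# +i 0#
    }

  module C = RawRing ℂ-rawRing
  module ℂMat = Matrix ℂ-rawRing
  open Matrix rawRing using (sum)

  -- The eigenvalues z₁, …, zₙ of A(S) listed with multiplicity:
  -- det (x I − A(S)) = (x − z₁) ⋯ (x − zₙ).  Since ℂ is an infinite field,
  -- equality for every x is equality of polynomials.
  record Spectrum {n : ℕ} (S : Sidigraph n) : Set (c ⊔ˡ ℓ₁) where
    field
      eigenvalue : Fin n → ℂ
      splits     : ∀ x → ℂMat.charPoly (ℂMat.adjacency S) x C.≈
                         ℂMat.product (λ j → x C.+ (C.- eigenvalue j))

  -- A spectrum is unique up to reordering, so this depends on S only.
  energy : ∀ {n} {S : Sidigraph n} → Spectrum S → Carrier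
  energy s = sum λ j → ∣ re (Spectrum.eigenvalue s j) ∣

{-# OPTIONS --safe #-}

-- Only power sums of the eigenvalues are needed, neither angles nor π.  If the
-- cycle of S is negative of length m, then the characteristic polynomial is
-- xⁿ + xⁿ⁻ᵐ: in the Leibniz formula only the identity and the cycle itself
-- survive.  By Newton's identities the power sums of exponent k vanish for
-- 0 < k < m, so the squares Y of the imaginary parts of the eigenvalues have
-- the moments ∑ Yᵏ = m wₖ of m points spread uniformly over the unit circle,
-- where wₖ = (2k choose k) / 4ᵏ; this holds for 2k < m, and for k < m if m is
-- odd.  A nonzero eigenvalue has modulus 1 and real part ±√(1 − Y), for which
-- the Taylor polynomials of √(1 − Y) are upper bounds, and 1 − Y times those of
-- 1/√(1 − Y) are lower bounds.  Summing gives 2k wₖ² m ≤ E ≤ (2k + 1) wₖ² m.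
-- With the largest admissible k, these bounds separate consecutive orders,
-- apart from 2 and 4, where the real parts are known exactly.  Two sidigraphs
-- with cycles of the same length m have the same power sums, hence the same
-- sums of Taylor polynomials of every degree and the same energy.

module Submission where

open import Defs
open import Algebra.Bundles using (CommutativeMonoid; CommutativeRing)
import Algebra.Apartness.Properties.HeytingCommutativeRing as HeytingProperties
import Algebra.Properties.CommutativeMonoid.Sum as CommutativeMonoidSum
import Algebra.Properties.Monoid.Mult as MonoidMult
import Algebra.Properties.Ring as RingProperties
import Algebra.Properties.Semiring.Exp as Exp
import Algebra.Properties.Semiring.Mult as SemiringMult
import Algebra.Properties.Semiring.Mult.TCOptimised as Mult
import Algebra.Properties.Semiring.Sum as SemiringSum
import Algebra.Solver.Ring
open import Algebra.Solver.Ring.AlmostCommutativeRing using (_-Raw-AlmostCommutative⟶_; fromCommutativeRing)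
open import Data.Bool.Base using (if_then_else_)
open import Data.Fin.Base as Fin using (Fin; zero; suc; toℕ; fromℕ; inject₁; punchIn; punchOut)
open import Data.Fin.Induction using (<-weakInduction; >-weakInduction)
open import Data.Fin.Properties
  using (_≟_; all?; any?; ¬∀⟶∃¬; pigeonhole; injective⇒≤; suc-injective;
         toℕ-injective; toℕ-fromℕ; toℕ-fromℕ<; toℕ-inject₁; toℕ<n;
         punchIn-injective; punchInᵢ≢i; punchIn-punchOut; punchOut-injective)
open import Data.Integer.Base as ℤ using (ℤ)
import Data.Integer.Properties as ℤ
open import Data.Maybe.Base as Maybe using (Maybe; just; nothing)
open import Data.Maybe.Properties using (just-injective)
open import Data.Nat.Base as ℕ using (ℕ; zero; suc; _∸_; s≤s)
open import Data.Nat.DivMod using (_%_; m<n⇒m%n≡m; n%n≡0)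
open import Data.Nat.GeneralisedArithmetic using (fold)
open import Data.Nat.Induction using (<-rec)
import Data.Nat.Properties as ℕ
open import Data.Product.Base using (∃-syntax; _×_; _,_; proj₁; proj₂)
open import Data.Sign.Base as Sign using (Sign)
import Data.Sign.Properties as Sign
open import Data.Sum.Base using (_⊎_; inj₁; inj₂; [_,_]′)
open import Data.Vec.Functional using (foldr; removeAt)
open import Function.Base using (id; _∘_; case_of_)
open import Function.Bundles using (Equivalence; mk⇔)
open import Function.Definitions using (Injective)
import Level
open import Relation.Binary.Definitions using (tri<; tri≈; tri>)
open import Relation.Binary.PropositionalEquality.Core as ≡ using (_≡_; _≢_; _≗_)
import Relation.Binary.Reasoning.Setoid as SetoidReasoning
open import Relation.Binary.Structures using (IsStrictPartialOrder)
open import Relation.Nullary.Decidable using (dec-true; dec-false)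
open import Relation.Nullary.Decidable.Core using (Dec; yes; no; does; dec⇒maybe; _⊎-dec_)
open import Relation.Nullary.Negation.Core using (¬_; contradiction)
open import Relation.Unary using (Decidable)

-- The order is not decidable, so it cannot be decided which eigenvalues vanish, nor can two spectra
-- be matched term by term. Only symmetric functions of the eigenvalues are compared, and case
-- distinctions are confined to goals `a ≤ b` and `a ≈ b`, which are stable under double negation.
-- The moments come from u = -iz/2 and v = -iz̄/2, for which u - v is the imaginary part of z and uv
-- = -|z|²/4. The operator u∂ᵤ - v∂ᵥ replaces the binomial expansion of (u - v)²ᵏ and yields the
-- recurrence that also defines wₖ. The longer range of k for odd m matters. Since wₖ² ~ 1/(πk), the
-- energy grows by about 2/π per order, while the bounds deviate from 2m/π by about 1/π when k is
-- near m/2 and by about 1/(2π) when k is near m. Two neighbouring orders with k near m/2 would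
-- leave no margin asymptotically; taking k near m at odd orders leaves 1/(2π). The range doubles
-- there because an even exponent between m and 2m differs from m, and its power sum is minus one of
-- exponent below m.

-- A ring solver with integer coefficients.

module IntegerCoefficients {c ℓ} (R : CommutativeRing c ℓ) where
  open CommutativeRing R
  open RingProperties ring
  open Mult semiring using (×-homo-+; ×1-homo-*; 1+×) renaming (_×_ to _⋆_)
  open SetoidReasoning setoid

  -- The optimised multiple makes the constants 0 and 1 of the solver reduce to `0#` and `1#`
  -- themselves, so solved equations match the goals by `refl`.
  ⟦_⟧ℤ : ℤ → Carrier
  ⟦ ℤ.+ n ⟧ℤ      = n ⋆ 1#
  ⟦ ℤ.-[1+ n ] ⟧ℤ = - (suc n ⋆ 1#)

  cancelˡ : ∀ x y z → (z + x) - (z + y) ≈ x - y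
  cancelˡ x y z = begin
    (z + x) - (z + y)      ≈⟨ +-congˡ (-‿anti-homo-+ z y) ⟩
    (z + x) + (- y + - z)  ≈⟨ +-congʳ (+-comm z x) ⟩
    (x + z) + (- y + - z)  ≈⟨ +-congˡ (+-comm (- y) (- z)) ⟩
    (x + z) + (- z + - y)  ≈⟨ +-assoc x z _ ⟩
    x + (z + (- z + - y))  ≈⟨ +-congˡ (+-assoc z (- z) (- y)) ⟨
    x + ((z - z) + - y)    ≈⟨ +-congˡ (+-congʳ (-‿inverseʳ z)) ⟩
    x + (0# + - y)         ≈⟨ +-congˡ (+-identityˡ (- y)) ⟩
    x - y                  ∎

  ⊖-homo : ∀ m n → ⟦ m ℤ.⊖ n ⟧ℤ ≈ m ⋆ 1# - n ⋆ 1#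
  ⊖-homo m       zero    = sym (trans (+-congˡ -0#≈0#) (+-identityʳ _))
  ⊖-homo zero    (suc n) = sym (+-identityˡ _)
  ⊖-homo (suc m) (suc n) = begin
    ⟦ suc m ℤ.⊖ suc n ⟧ℤ               ≡⟨ ≡.cong ⟦_⟧ℤ (ℤ.[1+m]⊖[1+n]≡m⊖n m n) ⟩
    ⟦ m ℤ.⊖ n ⟧ℤ                       ≈⟨ ⊖-homo m n ⟩
    m ⋆ 1# - n ⋆ 1#                    ≈⟨ cancelˡ _ _ 1# ⟨
    (1# + m ⋆ 1#) - (1# + n ⋆ 1#)      ≈⟨ +-cong (1+× m 1#) (-‿cong (1+× n 1#)) ⟨
    suc m ⋆ 1# - suc n ⋆ 1#            ∎

  +-homo : ∀ i j → ⟦ i ℤ.+ j ⟧ℤ ≈ ⟦ i ⟧ℤ + ⟦ j ⟧ℤ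
  +-homo (ℤ.+ m)      (ℤ.+ n)      = ×-homo-+ 1# m n
  +-homo (ℤ.+ m)      (ℤ.-[1+ n ]) = ⊖-homo m (suc n)
  +-homo (ℤ.-[1+ m ]) (ℤ.+ n)      = trans (⊖-homo n (suc m)) (+-comm _ _)
  +-homo (ℤ.-[1+ m ]) (ℤ.-[1+ n ]) = begin
    - (suc (suc (m ℕ.+ n)) ⋆ 1#)       ≡⟨ ≡.cong (λ k → - (suc k ⋆ 1#)) (ℕ.+-suc m n) ⟨
    - ((suc m ℕ.+ suc n) ⋆ 1#)         ≈⟨ -‿cong (×-homo-+ 1# (suc m) (suc n)) ⟩
    - (suc m ⋆ 1# + suc n ⋆ 1#)         ≈⟨ -‿anti-homo-+ _ _ ⟩
    - (suc n ⋆ 1#) + - (suc m ⋆ 1#)    ≈⟨ +-comm _ _ ⟩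
    - (suc m ⋆ 1#) + - (suc n ⋆ 1#)    ∎

  -‿homo : ∀ i → ⟦ ℤ.- i ⟧ℤ ≈ - ⟦ i ⟧ℤ
  -‿homo (ℤ.+ zero)   = sym -0#≈0#
  -‿homo (ℤ.+ suc n)  = refl
  -‿homo (ℤ.-[1+ n ]) = sym (-‿involutive _)

  pos-homo : ∀ m j → ⟦ ℤ.+ m ℤ.* j ⟧ℤ ≈ (m ⋆ 1#) * ⟦ j ⟧ℤ
  pos-homo m (ℤ.+ n)      = trans (reflexive (≡.cong ⟦_⟧ℤ (≡.sym (ℤ.pos-* m n)))) (×1-homo-* m n)
  pos-homo m (ℤ.-[1+ n ]) = begin
    ⟦ ℤ.+ m ℤ.* ℤ.-[1+ n ] ⟧ℤ          ≡⟨ ≡.cong ⟦_⟧ℤ (ℤ.neg-distribʳ-* (ℤ.+ m) (ℤ.+ suc n)) ⟨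
    ⟦ ℤ.- (ℤ.+ m ℤ.* ℤ.+ suc n) ⟧ℤ     ≈⟨ -‿homo (ℤ.+ m ℤ.* ℤ.+ suc n) ⟩
    - ⟦ ℤ.+ m ℤ.* ℤ.+ suc n ⟧ℤ         ≈⟨ -‿cong (pos-homo m (ℤ.+ suc n)) ⟩
    - ((m ⋆ 1#) * (suc n ⋆ 1#))    ≈⟨ -‿distribʳ-* _ _ ⟩
    (m ⋆ 1#) * - (suc n ⋆ 1#)      ∎

  *-homo : ∀ i j → ⟦ i ℤ.* j ⟧ℤ ≈ ⟦ i ⟧ℤ * ⟦ j ⟧ℤ
  *-homo (ℤ.+ m)      j = pos-homo m j
  *-homo (ℤ.-[1+ m ]) j = begin
    ⟦ ℤ.-[1+ m ] ℤ.* j ⟧ℤ            ≡⟨ ≡.cong ⟦_⟧ℤ (ℤ.neg-distribˡ-* (ℤ.+ suc m) j) ⟨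
    ⟦ ℤ.- (ℤ.+ suc m ℤ.* j) ⟧ℤ       ≈⟨ -‿homo (ℤ.+ suc m ℤ.* j) ⟩
    - ⟦ ℤ.+ suc m ℤ.* j ⟧ℤ           ≈⟨ -‿cong (pos-homo (suc m) j) ⟩
    - ((suc m ⋆ 1#) * ⟦ j ⟧ℤ)      ≈⟨ -‿distribˡ-* _ _ ⟩
    - (suc m ⋆ 1#) * ⟦ j ⟧ℤ        ∎

  homomorphism : ℤ.+-*-rawRing -Raw-AlmostCommutative⟶ fromCommutativeRing R
  homomorphism = record
    { ⟦_⟧    = ⟦_⟧ℤ
    ; +-homo = +-homo
    ; *-homo = *-homo
    ; -‿homo = -‿homo
    ; 0-homo = refl
    ; 1-homo = refl
    }

  _coeff≟_ : ∀ i j → Maybe (⟦ i ⟧ℤ ≈ ⟦ j ⟧ℤ)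
  i coeff≟ j = Maybe.map (λ eq → reflexive (≡.cong ⟦_⟧ℤ eq)) (dec⇒maybe (i ℤ.≟ j))

  open Algebra.Solver.Ring ℤ.+-*-rawRing (fromCommutativeRing R) homomorphism _coeff≟_
    public using (Polynomial; solve; _:=_; con; _:+_; _:*_; _:-_; :-_)

-- Permutations in the form produced by Laplace expansion.

punchIn-inject₁-self : ∀ {n} (j : Fin n) → punchIn (inject₁ j) j ≡ suc j
punchIn-inject₁-self zero    = ≡.refl
punchIn-inject₁-self (suc j) = ≡.cong suc (punchIn-inject₁-self j)

punchIn-suc-self : ∀ {n} (j : Fin n) → punchIn (suc j) j ≡ inject₁ j
punchIn-suc-self zero    = ≡.refl
punchIn-suc-self (suc j) = ≡.cong suc (punchIn-suc-self j)

punchIn-inject₁-suc : ∀ {n} (j k : Fin n) → k ≢ j → punchIn (inject₁ j) k ≡ punchIn (suc j) k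
punchIn-inject₁-suc zero    zero    k≢j = contradiction ≡.refl k≢j
punchIn-inject₁-suc zero    (suc k) k≢j = ≡.refl
punchIn-inject₁-suc (suc j) zero    k≢j = ≡.refl
punchIn-inject₁-suc (suc j) (suc k) k≢j = ≡.cong suc (punchIn-inject₁-suc j k (k≢j ∘ ≡.cong suc))

-- Row zero takes column `j`, and the remaining rows follow `π` inside the minor that omits column
-- `j`. Iterating this yields exactly the terms of the expanded determinant.
insertImage : ∀ {n} → Fin (suc n) → (Fin n → Fin n) → Fin (suc n) → Fin (suc n)
insertImage j π zero    = j
insertImage j π (suc i) = punchIn j (π i)

insertImage-injective : ∀ {n} (j : Fin (suc n)) {π : Fin n → Fin n} →
  Injective _≡_ _≡_ π → Injective _≡_ _≡_ (insertImage j π)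
insertImage-injective j inj {zero}  {zero}  eq = ≡.refl
insertImage-injective j inj {zero}  {suc y} eq = contradiction (≡.sym eq) (punchInᵢ≢i j _)
insertImage-injective j inj {suc x} {zero}  eq = contradiction eq (punchInᵢ≢i j _)
insertImage-injective j inj {suc x} {suc y} eq = ≡.cong suc (inj (punchIn-injective j _ _ eq))

zero-image-distinct : ∀ {n} (f : Fin (suc n) → Fin (suc n)) → Injective _≡_ _≡_ f →
  ∀ i → f zero ≢ f (suc i)
zero-image-distinct f inj i eq with () ← inj eq

deleteImage : ∀ {n} (f : Fin (suc n) → Fin (suc n)) → Injective _≡_ _≡_ f → Fin n → Fin n
deleteImage f inj i = punchOut (zero-image-distinct f inj i)

deleteImage-injective : ∀ {n} (f : Fin (suc n) → Fin (suc n)) (inj : Injective _≡_ _≡_ f) →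
  Injective _≡_ _≡_ (deleteImage f inj)
deleteImage-injective f inj {x} {y} eq = suc-injective
  (inj (punchOut-injective (zero-image-distinct f inj x) (zero-image-distinct f inj y) eq))

insertImage-deleteImage : ∀ {n} (f : Fin (suc n) → Fin (suc n)) (inj : Injective _≡_ _≡_ f) →
  insertImage (f zero) (deleteImage f inj) ≗ f
insertImage-deleteImage f inj zero    = ≡.refl
insertImage-deleteImage f inj (suc i) = punchIn-punchOut _

insertImage-≗ : ∀ {n} (f : Fin (suc n) → Fin (suc n)) (inj : Injective _≡_ _≡_ f) {π : Fin n → Fin n} →
  insertImage (f zero) π ≗ f → π ≗ deleteImage f inj
insertImage-≗ f inj eq i = punchIn-injective (f zero) _ _ (≡.trans (eq (suc i)) (≡.sym (punchIn-punchOut _)))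

-- Determinants and the Leibniz formula.

module Determinant {c ℓ} (R : CommutativeRing c ℓ) where
  open CommutativeRing R hiding (zero)
  open Matrix rawRing using (Mat; det; product)
  open Exp semiring using (_^_)
  open SemiringSum semiring using (sum; sum-cong-≋; sum-remove; ∑-distrib-+; *-distribˡ-sum; *-distribʳ-sum; sum-replicate-zero)
  module Product = CommutativeMonoidSum *-commutativeMonoid
  open RingProperties ring
  open SetoidReasoning setoid
  open IntegerCoefficients R using (solve; _:=_; con; _:+_; _:*_; _:-_; :-_)

  sum-zero : ∀ {n} (t : Fin n → Carrier) → (∀ i → t i ≈ 0#) → sum t ≈ 0#
  sum-zero {n} t t≈0 = trans (sum-cong-≋ t≈0) (sum-replicate-zero n)

  sum-single : ∀ {n} (t : Fin n → Carrier) (j : Fin n) → (∀ i → i ≢ j → t i ≈ 0#) → sum t ≈ t j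
  sum-single {suc n} t j t≈0 = begin
    sum t                     ≈⟨ sum-remove {i = j} t ⟩
    t j + sum (removeAt t j)  ≈⟨ +-congˡ (sum-zero (removeAt t j) λ i → t≈0 _ (punchInᵢ≢i j i)) ⟩
    t j + 0#                  ≈⟨ +-identityʳ _ ⟩
    t j                       ∎

  minor : ∀ {n} → Mat (suc n) → Fin (suc n) → Mat n
  minor M j i k = M (suc i) (punchIn j k)

  det-cong : ∀ {n} {A B : Mat n} → (∀ i j → A i j ≈ B i j) → det A ≈ det B
  det-cong {zero}  A≈B = refl
  det-cong {suc n} A≈B = sum-cong-≋ λ j →
    *-congˡ {(- 1#) ^ toℕ j} (*-cong (A≈B zero j) (det-cong λ i k → A≈B (suc i) (punchIn j k)))

  det-additive-column : ∀ {n} (j : Fin n) (A B C : Mat n) →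
    (∀ i → C i j ≈ A i j + B i j) →
    (∀ i k → k ≢ j → C i k ≈ A i k) →
    (∀ i k → k ≢ j → C i k ≈ B i k) →
    det C ≈ det A + det B
  det-additive-column {suc n} j A B C at-j A-off B-off =
    trans (sum-cong-≋ term) (∑-distrib-+
      (λ k → s k * (A zero k * det (minor A k))) (λ k → s k * (B zero k * det (minor B k))))
    where
    s : Fin (suc n) → Carrier
    s k = (- 1#) ^ toℕ k
    term : ∀ k → s k * (C zero k * det (minor C k)) ≈
                 s k * (A zero k * det (minor A k)) + s k * (B zero k * det (minor B k))
    term k with k ≟ j
    ... | yes ≡.refl = begin
      s k * (C zero k * det (minor C k))
        ≈⟨ *-congˡ (*-congʳ (at-j zero)) ⟩
      s k * ((A zero k + B zero k) * det (minor C k))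
        ≈⟨ solve 4 (λ s a b d → s :* ((a :+ b) :* d) := s :* (a :* d) :+ s :* (b :* d)) refl _ _ _ _ ⟩
      s k * (A zero k * det (minor C k)) + s k * (B zero k * det (minor C k))
        ≈⟨ +-cong (*-congˡ (*-congˡ (det-cong λ i l → A-off (suc i) _ (punchInᵢ≢i k l))))
                  (*-congˡ (*-congˡ (det-cong λ i l → B-off (suc i) _ (punchInᵢ≢i k l)))) ⟩
      s k * (A zero k * det (minor A k)) + s k * (B zero k * det (minor B k)) ∎
    ... | no k≢j = begin
      s k * (C zero k * det (minor C k))
        ≈⟨ *-congˡ (*-congˡ (det-additive-column (punchOut k≢j) (minor A k) (minor B k) (minor C k)
             (λ i → ≡.subst (λ l → C (suc i) l ≈ A (suc i) l + B (suc i) l) (≡.sym (punchIn-punchOut k≢j)) (at-j (suc i)))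
             (λ i l l≢ → A-off (suc i) _ (off l l≢))
             (λ i l l≢ → B-off (suc i) _ (off l l≢)))) ⟩
      s k * (C zero k * (det (minor A k) + det (minor B k)))
        ≈⟨ solve 4 (λ s c a b → s :* (c :* (a :+ b)) := s :* (c :* a) :+ s :* (c :* b)) refl _ _ _ _ ⟩
      s k * (C zero k * det (minor A k)) + s k * (C zero k * det (minor B k))
        ≈⟨ +-cong (*-congˡ (*-congʳ (A-off zero k k≢j))) (*-congˡ (*-congʳ (B-off zero k k≢j))) ⟩
      s k * (A zero k * det (minor A k)) + s k * (B zero k * det (minor B k)) ∎
      where
      off : ∀ l → l ≢ punchOut k≢j → punchIn k l ≢ j
      off l l≢ eq = l≢ (punchIn-injective k _ _ (≡.trans eq (≡.sym (punchIn-punchOut k≢j))))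

  sum-bump : ∀ {n} (t u : Fin n → Carrier) (j : Fin n) (a : Carrier) →
    u j ≈ a + t j → (∀ k → k ≢ j → u k ≈ t k) → sum u ≈ a + sum t
  sum-bump {suc n} t u j a at-j off = begin
    sum u                           ≈⟨ sum-remove {i = j} u ⟩
    u j + sum (removeAt u j)        ≈⟨ +-cong at-j (sum-cong-≋ λ k → off _ (punchInᵢ≢i j k)) ⟩
    (a + t j) + sum (removeAt t j)  ≈⟨ +-assoc _ _ _ ⟩
    a + (t j + sum (removeAt t j))  ≈⟨ +-congˡ (sum-remove {i = j} t) ⟨
    a + sum t                       ∎

  -- The minors D₀, D₁, … along the first row satisfy Dⱼ + Dⱼ₊₁ = 0: adding
  -- them merges columns j and j + 1, which again gives zero row sums.
  det-zero-row-sums : ∀ {n} (M : Mat (suc n)) → (∀ i → sum (M i) ≈ 0#) → det M ≈ 0#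
  det-zero-row-sums {zero} M rows = begin
    1# * (M zero zero * 1#) + 0#  ≈⟨ solve 1 (λ a → con (ℤ.+ 1) :* (a :* con (ℤ.+ 1)) :+ con (ℤ.+ 0) := a :+ con (ℤ.+ 0)) refl _ ⟩
    M zero zero + 0#              ≈⟨ rows zero ⟩
    0#                            ∎
  det-zero-row-sums {suc n} M rows = begin
    sum (λ j → s j * (M zero j * D j))  ≈⟨ sum-cong-≋ (λ j → trans
                                            (solve 3 (λ s a d → s :* (a :* d) := a :* (s :* d)) refl (s j) _ _)
                                            (*-congˡ {M zero j} (alternate j))) ⟩
    sum (λ j → M zero j * D zero)       ≈⟨ *-distribʳ-sum (D zero) (M zero) ⟨
    sum (M zero) * D zero               ≈⟨ *-congʳ (rows zero) ⟩
    0# * D zero                         ≈⟨ zeroˡ _ ⟩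
    0#                                  ∎
    where
    s D : Fin (suc (suc n)) → Carrier
    s j = (- 1#) ^ toℕ j
    D j = det (minor M j)

    merged : Fin (suc n) → Mat (suc n)
    merged j i k with k ≟ j
    ... | yes _ = M (suc i) (inject₁ j) + M (suc i) (suc j)
    ... | no  _ = M (suc i) (punchIn (inject₁ j) k)

    merged-at : ∀ j i → merged j i j ≈ M (suc i) (inject₁ j) + M (suc i) (suc j)
    merged-at j i with j ≟ j
    ... | yes _  = refl
    ... | no j≢j = contradiction ≡.refl j≢j

    merged-off : ∀ j i k → k ≢ j → merged j i k ≈ minor M (inject₁ j) i k
    merged-off j i k k≢j with k ≟ j
    ... | yes k≡j = contradiction k≡j k≢j
    ... | no  _   = refl

    merged-rows : ∀ j i → sum (merged j i) ≈ 0#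
    merged-rows j i = begin
      sum (merged j i)
        ≈⟨ sum-bump (minor M (inject₁ j) i) (merged j i) j (M (suc i) (inject₁ j))
             (trans (merged-at j i) (+-congˡ (reflexive (≡.cong (M (suc i)) (≡.sym (punchIn-inject₁-self j))))))
             (merged-off j i) ⟩
      M (suc i) (inject₁ j) + sum (removeAt (M (suc i)) (inject₁ j))
        ≈⟨ sum-remove {i = inject₁ j} (M (suc i)) ⟨
      sum (M (suc i))
        ≈⟨ rows (suc i) ⟩
      0# ∎

    adjacent : ∀ j → 0# ≈ D (suc j) + D (inject₁ j)
    adjacent j = trans (sym (det-zero-row-sums (merged j) (merged-rows j)))
      (det-additive-column j (minor M (suc j)) (minor M (inject₁ j)) (merged j)
        (λ i → trans (merged-at j i) (+-cong (at (≡.sym (punchIn-suc-self j))) (at (≡.sym (punchIn-inject₁-self j)))))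
        (λ i k k≢j → trans (merged-off j i k k≢j) (at (punchIn-inject₁-suc j k k≢j)))
        (λ i → merged-off j i))
      where
      at : ∀ {i k l} → k ≡ l → M i k ≈ M i l
      at ≡.refl = refl

    alternate : ∀ j → s j * D j ≈ D zero
    alternate = <-weakInduction _ (*-identityˡ _) λ j ih → begin
      (- 1# * (- 1#) ^ toℕ j) * D (suc j)
        ≈⟨ solve 3 (λ t d d′ → (:- con (ℤ.+ 1) :* t) :* d := t :* d′ :- t :* (d :+ d′)) refl _ _ (D (inject₁ j)) ⟩
      (- 1#) ^ toℕ j * D (inject₁ j) - (- 1#) ^ toℕ j * (D (suc j) + D (inject₁ j))
        ≈⟨ +-cong (*-congʳ (reflexive (≡.cong ((- 1#) ^_) (≡.sym (toℕ-inject₁ j)))))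
                  (-‿cong (*-congˡ (sym (adjacent j)))) ⟩
      s (inject₁ j) * D (inject₁ j) - (- 1#) ^ toℕ j * 0#
        ≈⟨ solve 2 (λ a t → a :- t :* con (ℤ.+ 0) := a) refl _ _ ⟩
      s (inject₁ j) * D (inject₁ j)
        ≈⟨ ih ⟩
      D zero ∎

  -- The Laplace signs are built into the sum, so that `leibniz` needs no theory of the signature;
  -- the sign of one permutation reappears when the summand is supported there.
  ∑perm : ∀ n → ((Fin n → Fin n) → Carrier) → Carrier
  ∑perm zero    F = F id
  ∑perm (suc n) F = sum λ j → (- 1#) ^ toℕ j * ∑perm n (F ∘ insertImage j)

  ∑perm-cong : ∀ n {F G : (Fin n → Fin n) → Carrier} →
    (∀ π → Injective _≡_ _≡_ π → F π ≈ G π) → ∑perm n F ≈ ∑perm n G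
  ∑perm-cong zero    F≈G = F≈G id id
  ∑perm-cong (suc n) F≈G = sum-cong-≋ λ j → *-congˡ {(- 1#) ^ toℕ j}
    (∑perm-cong n λ π inj → F≈G (insertImage j π) (insertImage-injective j inj))

  ∑perm-zero : ∀ n {F : (Fin n → Fin n) → Carrier} →
    (∀ π → Injective _≡_ _≡_ π → F π ≈ 0#) → ∑perm n F ≈ 0#
  ∑perm-zero zero    F≈0 = F≈0 id id
  ∑perm-zero (suc n) {F} F≈0 = sum-zero (λ j → (- 1#) ^ toℕ j * ∑perm n (F ∘ insertImage j)) λ j → trans (*-congˡ {(- 1#) ^ toℕ j}
    (∑perm-zero n λ π inj → F≈0 (insertImage j π) (insertImage-injective j inj))) (zeroʳ _)

  ∑perm-* : ∀ n a (F : (Fin n → Fin n) → Carrier) → ∑perm n (λ π → a * F π) ≈ a * ∑perm n F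
  ∑perm-* zero    a F = refl
  ∑perm-* (suc n) a F = begin
    sum (λ j → (- 1#) ^ toℕ j * ∑perm n (λ π → a * F (insertImage j π)))
      ≈⟨ sum-cong-≋ (λ j → trans (*-congˡ {(- 1#) ^ toℕ j} (∑perm-* n a (F ∘ insertImage j)))
           (solve 3 (λ s a d → s :* (a :* d) := a :* (s :* d)) refl ((- 1#) ^ toℕ j) a _)) ⟩
    sum (λ j → a * ((- 1#) ^ toℕ j * ∑perm n (F ∘ insertImage j)))
      ≈⟨ *-distribˡ-sum a (λ j → (- 1#) ^ toℕ j * ∑perm n (F ∘ insertImage j)) ⟨
    a * ∑perm (suc n) F ∎

  ∑perm-+ : ∀ n (F G : (Fin n → Fin n) → Carrier) →
    ∑perm n (λ π → F π + G π) ≈ ∑perm n F + ∑perm n G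
  ∑perm-+ zero    F G = refl
  ∑perm-+ (suc n) F G = trans
    (sum-cong-≋ λ j → trans (*-congˡ {(- 1#) ^ toℕ j} (∑perm-+ n (F ∘ insertImage j) (G ∘ insertImage j))) (distribˡ _ _ _))
    (∑-distrib-+ (λ j → (- 1#) ^ toℕ j * ∑perm n (F ∘ insertImage j))
                 (λ j → (- 1#) ^ toℕ j * ∑perm n (G ∘ insertImage j)))

  diagonalProduct : ∀ {n} → Mat n → (Fin n → Fin n) → Carrier
  diagonalProduct M π = product λ i → M i (π i)

  leibniz : ∀ {n} (M : Mat n) → det M ≈ ∑perm n (diagonalProduct M)
  leibniz {zero}  M = refl
  leibniz {suc n} M = sum-cong-≋ λ j → *-congˡ {(- 1#) ^ toℕ j} (trans
    (*-congˡ (leibniz (minor M j)))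
    (sym (∑perm-* n (M zero j) (diagonalProduct (minor M j)))))

  -- The parity of the number of inversions: `toℕ (f zero)` counts the later values below `f zero`.
  sgn : ∀ {n} (f : Fin n → Fin n) → Injective _≡_ _≡_ f → Carrier
  sgn {zero}  f inj = 1#
  sgn {suc n} f inj = (- 1#) ^ toℕ (f zero) * sgn (deleteImage f inj) (deleteImage-injective f inj)

  sgn-id : ∀ n (inj : Injective _≡_ _≡_ id) → sgn {n} id inj ≈ 1#
  sgn-id zero    inj = refl
  sgn-id (suc n) inj = trans (*-identityˡ _) (sgn-id n _)

  ∑perm-single : ∀ {n} (F : (Fin n → Fin n) → Carrier) (f : Fin n → Fin n) (inj : Injective _≡_ _≡_ f) →
    (∀ {π ρ} → π ≗ ρ → F π ≈ F ρ) →
    (∀ π → Injective _≡_ _≡_ π → ¬ π ≗ f → F π ≈ 0#) →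
    ∑perm n F ≈ sgn f inj * F f
  ∑perm-single {zero}  F f inj resp supp = trans (resp λ ()) (sym (*-identityˡ _))
  ∑perm-single {suc n} F f inj resp supp = begin
    sum (λ j → (- 1#) ^ toℕ j * ∑perm n (F ∘ insertImage j))
      ≈⟨ sum-single (λ j → (- 1#) ^ toℕ j * ∑perm n (F ∘ insertImage j)) (f zero)
           (λ j j≢ → trans (*-congˡ {(- 1#) ^ toℕ j} (∑perm-zero n λ π π-inj →
           supp (insertImage j π) (insertImage-injective j π-inj) (λ eq → j≢ (eq zero)))) (zeroʳ _)) ⟩
    (- 1#) ^ toℕ (f zero) * ∑perm n (F ∘ insertImage (f zero))
      ≈⟨ *-congˡ (∑perm-single (F ∘ insertImage (f zero)) (deleteImage f inj) (deleteImage-injective f inj)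
           (λ {π} {ρ} eq → resp (insertImage-cong eq))
           (λ π π-inj π≢ → supp _ (insertImage-injective (f zero) π-inj) (π≢ ∘ insertImage-≗ f inj))) ⟩
    (- 1#) ^ toℕ (f zero) * (sgn (deleteImage f inj) (deleteImage-injective f inj) * F (insertImage (f zero) (deleteImage f inj)))
      ≈⟨ *-assoc _ _ _ ⟨
    sgn f inj * F (insertImage (f zero) (deleteImage f inj))
      ≈⟨ *-congˡ (resp (insertImage-deleteImage f inj)) ⟩
    sgn f inj * F f ∎
    where
    insertImage-cong : ∀ {j : Fin (suc n)} {π ρ : Fin n → Fin n} → π ≗ ρ → insertImage j π ≗ insertImage j ρ
    insertImage-cong eq zero    = ≡.refl
    insertImage-cong {j} eq (suc i) = ≡.cong (punchIn j) (eq i)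

  product-zero : ∀ {n} (t : Fin n → Carrier) i → t i ≈ 0# → product t ≈ 0#
  product-zero {suc n} t i tᵢ≈0 = trans (Product.sum-remove {i = i} t) (trans (*-congʳ tᵢ≈0) (zeroˡ _))

  det-two-permutations : ∀ {n} (M : Mat n) (f g : Fin n → Fin n)
    (f-inj : Injective _≡_ _≡_ f) (g-inj : Injective _≡_ _≡_ g) → ¬ f ≗ g →
    (∀ π → Injective _≡_ _≡_ π → ¬ π ≗ f → ¬ π ≗ g → diagonalProduct M π ≈ 0#) →
    det M ≈ sgn f f-inj * diagonalProduct M f + sgn g g-inj * diagonalProduct M g
  det-two-permutations {n} M f g f-inj g-inj f≢g supp = begin
    det M                                                   ≈⟨ leibniz M ⟩
    ∑perm n F                                               ≈⟨ ∑perm-cong n split ⟩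
    ∑perm n (λ π → at f π + at g π)                         ≈⟨ ∑perm-+ n (at f) (at g) ⟩
    ∑perm n (at f) + ∑perm n (at g)                         ≈⟨ +-cong (single f f-inj) (single g g-inj) ⟩
    sgn f f-inj * F f + sgn g g-inj * F g                   ∎
    where
    F : (Fin n → Fin n) → Carrier
    F = diagonalProduct M

    F-resp : ∀ {π ρ} → π ≗ ρ → F π ≈ F ρ
    F-resp eq = Product.sum-cong-≋ λ i → reflexive (≡.cong (M i) (eq i))

    _≗?_ : (π ρ : Fin n → Fin n) → Dec (π ≗ ρ)
    π ≗? ρ = all? λ i → π i ≟ ρ i

    -- Functions are compared pointwise, so the summand is restricted to the functions pointwise
    -- equal to `h`, and `at-resp` has to be checked before `∑perm-single` applies.
    at : (Fin n → Fin n) → (Fin n → Fin n) → Carrier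
    at h π with π ≗? h
    ... | yes _ = F π
    ... | no  _ = 0#

    at-yes : ∀ h π → π ≗ h → at h π ≈ F π
    at-yes h π eq with π ≗? h
    ... | yes _ = refl
    ... | no ≢  = contradiction eq ≢

    at-no : ∀ h π → ¬ π ≗ h → at h π ≈ 0#
    at-no h π ≢ with π ≗? h
    ... | yes eq = contradiction eq ≢
    ... | no _   = refl

    split : ∀ π → Injective _≡_ _≡_ π → F π ≈ at f π + at g π
    split π inj with π ≗? f | π ≗? g
    ... | yes π≗f | yes π≗g = contradiction (λ i → ≡.trans (≡.sym (π≗f i)) (π≗g i)) f≢g
    ... | yes _   | no  _   = sym (+-identityʳ _)
    ... | no  _   | yes _   = sym (+-identityˡ _)
    ... | no  π≢f | no  π≢g = trans (supp π inj π≢f π≢g) (sym (+-identityʳ _))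

    at-resp : ∀ h {π ρ} → π ≗ ρ → at h π ≈ at h ρ
    at-resp h {π} {ρ} eq with ρ ≗? h
    ... | yes ρ≗h = trans (at-yes h π λ i → ≡.trans (eq i) (ρ≗h i)) (F-resp eq)
    ... | no  ρ≢h = at-no h π λ π≗h → ρ≢h λ i → ≡.trans (≡.sym (eq i)) (π≗h i)

    single : ∀ h (inj : Injective _≡_ _≡_ h) → ∑perm n (at h) ≈ sgn h inj * F h
    single h inj = trans
      (∑perm-single (at h) h inj (at-resp h) (λ π _ → at-no h π))
      (*-congˡ (at-yes h h λ _ → ≡.refl))

-- The cyclic successor and orbits of permutations.

toℕ-next-< : ∀ {k} (i : Fin (suc k)) → toℕ i ℕ.< k → toℕ (next i) ≡ suc (toℕ i)
toℕ-next-< i i<k = ≡.trans (toℕ-fromℕ< _) (m<n⇒m%n≡m (s≤s i<k))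

toℕ-next-last : ∀ {k} (i : Fin (suc k)) → toℕ i ≡ k → toℕ (next i) ≡ 0
toℕ-next-last {k} i i≡k = ≡.trans (toℕ-fromℕ< _)
  (≡.trans (≡.cong (λ t → suc t % suc k) i≡k) (n%n≡0 (suc k)))

last-or-< : ∀ {k} (i : Fin (suc k)) → toℕ i ≡ k ⊎ toℕ i ℕ.< k
last-or-< {k} i with toℕ i ℕ.≟ k
... | yes i≡k = inj₁ i≡k
... | no  i≢k = inj₂ (ℕ.≤∧≢⇒< (ℕ.s≤s⁻¹ (toℕ<n i)) i≢k)

next-injective : ∀ {k} → Injective _≡_ _≡_ (next {k})
next-injective {k} {i} {j} eq with last-or-< i | last-or-< j
... | inj₁ i≡k | inj₁ j≡k = toℕ-injective (≡.trans i≡k (≡.sym j≡k))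
... | inj₁ i≡k | inj₂ j<k
  with () ← ≡.trans (≡.sym (toℕ-next-last i i≡k)) (≡.trans (≡.cong toℕ eq) (toℕ-next-< j j<k))
... | inj₂ i<k | inj₁ j≡k
  with () ← ≡.trans (≡.sym (toℕ-next-< i i<k)) (≡.trans (≡.cong toℕ eq) (toℕ-next-last j j≡k))
... | inj₂ i<k | inj₂ j<k = toℕ-injective (ℕ.suc-injective
  (≡.trans (≡.sym (toℕ-next-< i i<k)) (≡.trans (≡.cong toℕ eq) (toℕ-next-< j j<k))))

next-≢ : ∀ {k} (i : Fin (suc (suc k))) → next i ≢ i
next-≢ {k} i eq with last-or-< i
... | inj₁ i≡k with () ← ≡.trans (≡.sym i≡k) (≡.trans (≡.cong toℕ (≡.sym eq)) (toℕ-next-last i i≡k))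
... | inj₂ i<k = ℕ.1+n≢n (≡.trans (≡.sym (toℕ-next-< i i<k)) (≡.cong toℕ eq))

m<n⇒m+[1+o]≡n : ∀ {m n} → m ℕ.< n → ∃[ o ] m ℕ.+ suc o ≡ n
m<n⇒m+[1+o]≡n {m} m<n with o , eq ← ℕ.m≤n⇒∃[o]m+o≡n m<n = o , ≡.trans (ℕ.+-suc m o) eq

least : ∀ {p} {P : ℕ → Set p} → Decidable P → ∀ n → P n → ∃[ m ] P m × (∀ k → k ℕ.< m → ¬ P k)
least {P = P} P? = <-rec _ λ n rec Pn → helper n rec Pn (ℕ.anyUpTo? P? n)
  where
  helper : ∀ n → (∀ {k} → k ℕ.< n → P k → ∃[ m ] P m × (∀ l → l ℕ.< m → ¬ P l)) → P n →
           Dec (∃[ k ] k ℕ.< n × P k) → ∃[ m ] P m × (∀ l → l ℕ.< m → ¬ P l)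
  helper n rec Pn (yes (k , k<n , Pk)) = rec k<n Pk
  helper n rec Pn (no none)            = n , Pn , λ k k<n Pk → none (k , k<n , Pk)

module Orbit {n} (π : Fin n → Fin n) (π-inj : Injective _≡_ _≡_ π) (i : Fin n) where

  orbit : ℕ → Fin n
  orbit = fold i π

  orbit-cancel : ∀ a b → orbit (a ℕ.+ b) ≡ orbit a → orbit b ≡ i
  orbit-cancel zero    b eq = eq
  orbit-cancel (suc a) b eq = orbit-cancel a b (π-inj eq)

  returns : ∃[ k ] orbit (suc k) ≡ i
  returns with a , b , a<b , eq ← pigeonhole (ℕ.n<1+n n) (orbit ∘ toℕ)
          with k , a+[1+k]≡b ← m<n⇒m+[1+o]≡n a<b
    = k , orbit-cancel (toℕ a) (suc k) (≡.trans (≡.cong orbit a+[1+k]≡b) (≡.sym eq))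

  firstReturn : ∃[ k ] orbit (suc k) ≡ i × (∀ l → l ℕ.< k → orbit (suc l) ≢ i)
  firstReturn = least (λ k → orbit (suc k) ≟ i) (proj₁ returns) (proj₂ returns)

  orbit-distinct : ∀ {k} → (∀ l → l ℕ.< k → orbit (suc l) ≢ i) →
                   ∀ {a b} → a ℕ.< b → b ℕ.≤ k → orbit a ≢ orbit b
  orbit-distinct {k} first {a} {b} a<b b≤k eq
    with l , a+[1+l]≡b ← m<n⇒m+[1+o]≡n a<b
    = first l (ℕ.≤-trans (ℕ.m≤n+m (suc l) a) (ℕ.≤-trans (ℕ.≤-reflexive a+[1+l]≡b) b≤k))
        (orbit-cancel a (suc l) (≡.trans (≡.cong orbit a+[1+l]≡b) (≡.sym eq)))

  module _ (S : Sidigraph n) (arcs : ∀ v → π v ≢ v → ∃[ s ] Sidigraph.arc S v (π v) ≡ just s) (moved : π i ≢ i) where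

    abstract
      -- A moved point cannot return after one step, so its period has the form k + 2 that `Cycle`
      -- demands.
      period : ∃[ k ] orbit (suc (suc k)) ≡ i × (∀ l → l ℕ.< suc k → orbit (suc l) ≢ i)
      period with firstReturn
      ... | zero  , back , _     = contradiction back moved
      ... | suc k , back , first = k , back , first

    private
      k = proj₁ period

    orbit-next : (a : Fin (suc (suc k))) → orbit (toℕ (next a)) ≡ π (orbit (toℕ a))
    orbit-next a with last-or-< a
    ... | inj₁ a≡k = ≡.trans (≡.cong orbit (toℕ-next-last a a≡k))
                       (≡.trans (≡.sym (proj₁ (proj₂ period))) (≡.cong (π ∘ orbit) (≡.sym a≡k)))
    ... | inj₂ a<k = ≡.cong orbit (toℕ-next-< a a<k)

    orbit-moved : ∀ a → π (orbit a) ≢ orbit a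
    orbit-moved zero    = moved
    orbit-moved (suc a) = orbit-moved a ∘ π-inj

    orbitCycle : Cycle S
    orbitCycle = record
      { length-2   = k
      ; vertex     = orbit ∘ toℕ
      ; vertex-inj = vertex-inj
      ; arcSign    = λ a → proj₁ (arcs (orbit (toℕ a)) (orbit-moved (toℕ a)))
      ; isArc      = λ a → ≡.trans (≡.cong (Sidigraph.arc S (orbit (toℕ a))) (orbit-next a))
                                   (proj₂ (arcs (orbit (toℕ a)) (orbit-moved (toℕ a))))
      }
      where
      distinct = orbit-distinct (proj₂ (proj₂ period))
      vertex-inj : Injective _≡_ _≡_ (λ (a : Fin (suc (suc k))) → orbit (toℕ a))
      vertex-inj {a} {b} eq with ℕ.<-cmp (toℕ a) (toℕ b)
      ... | tri< a<b _ _ = contradiction eq (distinct a<b (ℕ.s≤s⁻¹ (toℕ<n b)))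
      ... | tri≈ _ a≡b _ = toℕ-injective a≡b
      ... | tri> _ _ b<a = contradiction (≡.sym eq) (distinct b<a (ℕ.s≤s⁻¹ (toℕ<n a)))

    orbitCycle-starts : Cycle.Traverses orbitCycle i (π i)
    orbitCycle-starts = zero , ≡.refl , orbit-next zero

    orbitCycle-follows : ∀ {u w} → Cycle.Traverses orbitCycle u w → π u ≡ w
    orbitCycle-follows (a , ≡.refl , ≡.refl) = ≡.sym (orbit-next a)

-- Permutations compatible with a sidigraph that has a single cycle.

module UniqueCycle {n} (S : Sidigraph n) (c : Cycle S) (unique : ∀ d → SameCycle c d) where
  open Cycle c

  onCycle? : ∀ v → Dec (∃[ a ] vertex a ≡ v)
  onCycle? v = any? λ a → vertex a ≟ v

  succᶜ : Fin n → Fin n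
  succᶜ v with onCycle? v
  ... | yes (a , _) = vertex (next a)
  ... | no  _       = v

  succᶜ-vertex : ∀ a → succᶜ (vertex a) ≡ vertex (next a)
  succᶜ-vertex a with onCycle? (vertex a)
  ... | yes (b , eq) = ≡.cong (vertex ∘ next) (vertex-inj eq)
  ... | no  off      = contradiction (a , ≡.refl) off

  succᶜ-off : ∀ {v} → ¬ (∃[ a ] vertex a ≡ v) → succᶜ v ≡ v
  succᶜ-off {v} off with onCycle? v
  ... | yes on = contradiction on off
  ... | no  _  = ≡.refl

  succᶜ-injective : Injective _≡_ _≡_ succᶜ
  succᶜ-injective {u} {v} eq with onCycle? u | onCycle? v
  ... | yes (a , ≡.refl) | yes (b , ≡.refl) = ≡.cong vertex (next-injective (vertex-inj eq))
  ... | yes (a , _)      | no off           = contradiction (next a , eq) off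
  ... | no off           | yes (b , _)      = contradiction (next b , ≡.sym eq) off
  ... | no _             | no _             = eq

  succᶜ-moves : ∀ a → succᶜ (vertex a) ≢ vertex a
  succᶜ-moves a eq = next-≢ a (vertex-inj (≡.trans (≡.sym (succᶜ-vertex a)) eq))

  succᶜ≢id : ¬ succᶜ ≗ id
  succᶜ≢id eq = succᶜ-moves zero (eq (vertex zero))

  FollowsArcs : (Fin n → Fin n) → Set
  FollowsArcs π = ∀ v → π v ≢ v → ∃[ s ] Sidigraph.arc S v (π v) ≡ just s

  -- The orbit of any moved vertex is a cycle of `S`, hence has the arcs of `c`. So `π` follows `c`
  -- along the whole cycle, and a moved vertex must lie on `c`.
  followsArcs⇒succᶜ : ∀ π → Injective _≡_ _≡_ π → FollowsArcs π → ¬ π ≗ id → π ≗ succᶜ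
  followsArcs⇒succᶜ π π-inj arcs π≢id v with onCycle? v
  ... | yes (a , ≡.refl)
      with i , moved ← ¬∀⟶∃¬ n _ (λ i → π i ≟ i) π≢id
      = orbitCycle-follows π π-inj i S arcs moved
          (Equivalence.to (unique (orbitCycle π π-inj i S arcs moved) _ _) (a , ≡.refl , ≡.refl))
    where open Orbit
  ... | no off with π v ≟ v
  ...   | yes fixed = fixed
  ...   | no  moved
        with a , a≡v , _ ← Equivalence.from (unique (Orbit.orbitCycle π π-inj v S arcs moved) _ _)
                             (Orbit.orbitCycle-starts π π-inj v S arcs moved)
        = contradiction (a , a≡v) off

  -- Unlike `succᶜ` this map has no fixed point, so the identity minus its 0-1 matrix has diagonal 1
  -- and zero row sums. Vertices off `c` are sent into `c`, which creates no further cycle.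
  collapse : Fin n → Fin n
  collapse v with onCycle? v
  ... | yes (a , _) = vertex (next a)
  ... | no  _       = vertex zero

  collapse-on : ∀ a → collapse (vertex a) ≡ succᶜ (vertex a)
  collapse-on a with onCycle? (vertex a)
  ... | yes _   = ≡.refl
  ... | no  off = contradiction (a , ≡.refl) off

  collapse-moves : ∀ v → collapse v ≢ v
  collapse-moves v eq with onCycle? v
  ... | yes (a , ≡.refl) = next-≢ a (vertex-inj eq)
  ... | no  off          = off (zero , eq)

  -- Steps of `collapse` on the cycle are arcs of `S`. Those off the cycle need not be, but they
  -- would enter the cycle and are incompatible with injectivity; this reduces the claim to
  -- `followsArcs⇒succᶜ`.
  followsCollapse⇒succᶜ : ∀ π → Injective _≡_ _≡_ π → (∀ v → π v ≡ v ⊎ π v ≡ collapse v) →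
                          ¬ π ≗ id → π ≗ succᶜ
  followsCollapse⇒succᶜ π π-inj follows = followsArcs⇒succᶜ π π-inj arcs
    where
    stays : ∀ {v} → (∃[ a ] vertex a ≡ v) → ∃[ a ] vertex a ≡ π v
    stays (a , ≡.refl) with follows (vertex a)
    ... | inj₁ fixed = a , ≡.sym fixed
    ... | inj₂ moved = next a , ≡.sym (≡.trans moved (≡.trans (collapse-on a) (succᶜ-vertex a)))

    -- An orbit entering the cycle never leaves it, hence cannot return.
    on-if-enters : ∀ v → (∃[ a ] vertex a ≡ π v) → ∃[ a ] vertex a ≡ v
    on-if-enters v enters
      with k , back ← Orbit.returns π π-inj v
      = ≡.subst (λ w → ∃[ a ] vertex a ≡ w) back (later k)
      where
      later : ∀ k → ∃[ a ] vertex a ≡ Orbit.orbit π π-inj v (suc k)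
      later zero    = enters
      later (suc k) = stays (later k)

    collapse-onCycle : ∀ v → ∃[ a ] vertex a ≡ collapse v
    collapse-onCycle v with onCycle? v
    ... | yes (a , _) = next a , ≡.refl
    ... | no  _       = zero , ≡.refl

    arcs : FollowsArcs π
    arcs v moved with follows v
    ... | inj₁ fixed = contradiction fixed moved
    ... | inj₂ πv≡ with on-if-enters v (≡.subst (λ w → ∃[ a ] vertex a ≡ w) (≡.sym πv≡) (collapse-onCycle v))
    ...   | a , ≡.refl = arcSign a , ≡.trans
            (≡.cong (Sidigraph.arc S (vertex a)) (≡.trans πv≡ (≡.trans (collapse-on a) (succᶜ-vertex a)))) (isArc a)

-- Products over the vertices and the sign of the cycle.

module Reindexing {c ℓ} (M : CommutativeMonoid c ℓ) where
  open CommutativeMonoid M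
  open CommutativeMonoidSum M
  open MonoidMult monoid renaming (_×_ to _⋆_)
  open SetoidReasoning setoid

  -- Stated for a commutative monoid because it serves twice: for signs, with trivial factor off the
  -- cycle, and for diagonal products, where each vertex off the cycle contributes 1 or `x`.
  sum-reindex : ∀ {m n} (v : Fin m → Fin n) → Injective _≡_ _≡_ v → (g : Fin n → Carrier) (x : Carrier) →
    (∀ i → (∀ a → v a ≢ i) → g i ≈ x) → sum g ≈ sum (g ∘ v) ∙ ((n ∸ m) ⋆ x)
  sum-reindex {zero}  {n} v v-inj g x off = begin
    sum g                ≈⟨ sum-cong-≋ {n} {g} {λ _ → x} (λ i → off i λ ()) ⟩
    sum {n} (λ _ → x)    ≈⟨ sum-replicate n ⟩
    n ⋆ x                ≈⟨ identityˡ _ ⟨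
    ε ∙ (n ⋆ x)          ∎
  sum-reindex {suc m} {zero} v v-inj g x off with () ← v zero
  sum-reindex {suc m} {suc n} v v-inj g x off = begin
    sum g                                            ≈⟨ sum-remove {i = v zero} g ⟩
    g (v zero) ∙ sum (removeAt g (v zero))           ≈⟨ ∙-congˡ (sum-reindex v′ v′-inj (removeAt g (v zero)) x off′) ⟩
    g (v zero) ∙ (sum (removeAt g (v zero) ∘ v′) ∙ ((n ∸ m) ⋆ x))
      ≈⟨ ∙-congˡ (∙-congʳ (sum-cong-≋ {m} λ a → reflexive (≡.cong g (punchIn-punchOut (v₀≢ a))))) ⟩
    g (v zero) ∙ (sum (g ∘ v ∘ suc) ∙ ((n ∸ m) ⋆ x)) ≈⟨ assoc _ _ _ ⟨
    sum (g ∘ v) ∙ ((n ∸ m) ⋆ x)                      ∎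
    where
    v₀≢ : ∀ a → v zero ≢ v (suc a)
    v₀≢ a eq with () ← v-inj eq
    v′ : Fin m → Fin n
    v′ a = punchOut (v₀≢ a)
    v′-inj : Injective _≡_ _≡_ v′
    v′-inj {a} {b} eq = suc-injective (v-inj (punchOut-injective (v₀≢ a) (v₀≢ b) eq))
    off′ : ∀ i → (∀ a → v′ a ≢ i) → g (punchIn (v zero) i) ≈ x
    off′ i v′≢i = off _ λ where
      zero    eq → punchInᵢ≢i (v zero) i (≡.sym eq)
      (suc a) eq → v′≢i a (punchIn-injective (v zero) _ _ (≡.trans (punchIn-punchOut (v₀≢ a)) eq))

module CycleSign {n} (S : Sidigraph n) (c : Cycle S) (unique : ∀ d → SameCycle c d) where
  open UniqueCycle S c unique
  open Reindexing Sign.*-commutativeMonoid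
  open CommutativeMonoidSum Sign.*-commutativeMonoid using (sum; sum-cong-≗)
  open MonoidMult Sign.*-monoid renaming (_×_ to _⋆_)

  localSign : Fin n → Sign
  localSign v with onCycle? v
  ... | yes (a , _) = Cycle.arcSign c a
  ... | no  _       = Sign.+

  localSign-off : ∀ v → ¬ (∃[ a ] Cycle.vertex c a ≡ v) → localSign v ≡ Sign.+
  localSign-off v off with onCycle? v
  ... | yes on = contradiction on off
  ... | no  _  = ≡.refl

  localSign-arc : ∀ {u w s} → Cycle.Traverses c u w → Sidigraph.arc S u w ≡ just s → localSign u ≡ s
  localSign-arc {s = s} (a , ≡.refl , ≡.refl) arc with onCycle? (Cycle.vertex c a)
  ... | no  off      = contradiction (a , ≡.refl) off
  ... | yes (b , eq) = ≡.trans (≡.cong (Cycle.arcSign c) (Cycle.vertex-inj c eq))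
                               (just-injective (≡.trans (≡.sym (Cycle.isArc c a)) arc))

  -- A product over vertices does not depend on the initial vertex of a cycle. Cycles with the same
  -- arcs have the same vertices and the same sign on the arc leaving each, so one product computes
  -- the signs of all of them.
  sign-unique : ∀ d → Cycle.sign d ≡ sum localSign
  sign-unique d = ≡.sym (≡.trans (sum-reindex D.vertex D.vertex-inj localSign Sign.+ off)
    (≡.trans (≡.cong₂ Sign._*_ (sum-cong-≗ on) (trivial (n ∸ D.length))) (Sign.*-identityʳ D.sign)))
    where
    module D = Cycle d
    on : localSign ∘ D.vertex ≗ D.arcSign
    on a = localSign-arc (Equivalence.from (unique d _ _) (a , ≡.refl , ≡.refl)) (D.isArc a)
    off : ∀ v → (∀ a → D.vertex a ≢ v) → localSign v ≡ Sign.+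
    off v D≢v = localSign-off v λ where
      (a , ≡.refl) → let b , b≡ , _ = Equivalence.to (unique d _ _) (a , ≡.refl , ≡.refl) in D≢v b b≡
    trivial : ∀ k → k ⋆ Sign.+ ≡ Sign.+
    trivial zero    = ≡.refl
    trivial (suc k) = trivial k

unicyclic-negative : ∀ {n} {S : Sidigraph n} (U : Unicyclic S) → NonCycleBalanced S → Cycle.sign (proj₁ U) ≡ Sign.-
unicyclic-negative {S = S} (c , unique) unbalanced with Cycle.sign c in eq
... | Sign.- = ≡.refl
... | Sign.+ = contradiction (λ d → ≡.trans (sign-unique d) (≡.trans (≡.sym (sign-unique c)) eq)) unbalanced
  where open CycleSign S c unique

-- The characteristic polynomial of a unicyclic sidigraph.

module CharacteristicPolynomial {c ℓ} (R : CommutativeRing c ℓ) where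
  open CommutativeRing R hiding (zero)
  open Matrix rawRing using (Mat; det; product; charPoly; entry; adjacency)
  open Exp semiring using (_^_)
  open SemiringSum semiring using (sum; sum-cong-≋)
  open Determinant R
  open Reindexing *-commutativeMonoid using () renaming (sum-reindex to product-reindex)
  open RingProperties ring
  open SetoidReasoning setoid
  open IntegerCoefficients R using (solve; _:=_; con; _:+_; _:*_; _:-_; :-_)

  δ : ∀ {n} → Fin n → Fin n → Carrier
  δ i j = if does (i ≟ j) then 1# else 0#

  if-same : ∀ {n} {a b : Carrier} (i : Fin n) → (if does (i ≟ i) then a else b) ≡ a
  if-same i = ≡.cong (if_then _ else _) (dec-true (i ≟ i) ≡.refl)

  if-distinct : ∀ {n} {a b : Carrier} {i j : Fin n} → i ≢ j → (if does (i ≟ j) then a else b) ≡ b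
  if-distinct {i = i} {j} i≢j = ≡.cong (if_then _ else _) (dec-false (i ≟ j) i≢j)

  sum-δ : ∀ {n} (i : Fin n) → sum (δ i) ≈ 1#
  sum-δ i = trans (sum-single (δ i) i λ j j≢i → reflexive (if-distinct (j≢i ∘ ≡.sym))) (reflexive (if-same i))

  product-const : ∀ {n} (x : Carrier) (t : Fin n → Carrier) → (∀ i → t i ≈ x) → product t ≈ x ^ n
  product-const {n} x t t≈x = trans (Product.sum-cong-≋ {n} {t} {λ _ → x} t≈x) (Product.sum-replicate n)

  1^ : ∀ k → 1# ^ k ≈ 1#
  1^ zero    = refl
  1^ (suc k) = trans (*-identityˡ _) (1^ k)

  -1^-square : ∀ k → (- 1#) ^ k * (- 1#) ^ k ≈ 1#
  -1^-square zero    = *-identityˡ 1#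
  -1^-square (suc k) = trans
    (solve 1 (λ t → (:- con (ℤ.+ 1) :* t) :* (:- con (ℤ.+ 1) :* t) := t :* t) refl _) (-1^-square k)

  module _ {n} (S : Sidigraph n) (c : Cycle S) (unique : ∀ d → SameCycle c d) where
    open UniqueCycle S c unique
    open Cycle c using (vertex; vertex-inj; arcSign) renaming (length to m)

    -- The rows of this matrix sum to zero, so its determinant vanishes; the
    -- Leibniz formula then reveals the sign of the permutation succᶜ.
    sgn-succᶜ : sgn succᶜ succᶜ-injective ≈ - (- 1#) ^ m
    sgn-succᶜ = begin
      s                                 ≈⟨ solve 2 (λ s e → s := s :* (con (ℤ.+ 1) :- e :* e) :+ s :* e :* e) refl s e ⟩
      s * (1# - e * e) + s * e * e      ≈⟨ +-congʳ (*-congˡ (+-congˡ (-‿cong (-1^-square m)))) ⟩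
      s * (1# - 1#) + s * e * e         ≈⟨ solve 2 (λ s e → s :* (con (ℤ.+ 1) :- con (ℤ.+ 1)) :+ s :* e :* e
                                             := (con (ℤ.+ 1) :+ s :* e) :* e :- e) refl s e ⟩
      (1# + s * e) * e - e              ≈⟨ +-congʳ (*-congʳ 1+se≈0) ⟩
      0# * e - e                        ≈⟨ solve 1 (λ e → con (ℤ.+ 0) :* e :- e := :- e) refl e ⟩
      - e                               ∎
      where
      s = sgn succᶜ succᶜ-injective
      e = (- 1#) ^ m

      N : Mat n
      N i j = δ i j - δ (collapse i) j

      rows : ∀ i → sum (N i) ≈ 0#
      rows i = begin
        sum (N i)                                          ≈⟨ ∑-distrib-+ (δ i) (λ j → - δ (collapse i) j) ⟩
        sum (δ i) + sum (λ j → - δ (collapse i) j)         ≈⟨ +-congˡ (sum-cong-≋ λ j → -1*x≈-x (δ (collapse i) j)) ⟨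
        sum (δ i) + sum (λ j → - 1# * δ (collapse i) j)    ≈⟨ +-congˡ (*-distribˡ-sum (- 1#) (δ (collapse i))) ⟨
        sum (δ i) + - 1# * sum (δ (collapse i))            ≈⟨ +-cong (sum-δ i) (*-congˡ (sum-δ (collapse i))) ⟩
        1# + - 1# * 1#                                     ≈⟨ solve 0 (con (ℤ.+ 1) :+ :- con (ℤ.+ 1) :* con (ℤ.+ 1) := con (ℤ.+ 0)) refl ⟩
        0#                                                 ∎
        where open SemiringSum semiring using (∑-distrib-+; *-distribˡ-sum)

      det-N : det N ≈ 0#
      -- The vanishing criterion concerns nonempty matrices; a vertex of the cycle witnesses that
      -- `n` is not zero.
      det-N = helper n N rows (vertex zero)
        where
        helper : ∀ k (A : Mat k) → (∀ i → sum (A i) ≈ 0#) → Fin k → det A ≈ 0#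
        helper (suc k) A A-rows _ = det-zero-row-sums A A-rows

      N-diagonal : ∀ i → N i i ≈ 1#
      N-diagonal i = begin
        δ i i - δ (collapse i) i   ≡⟨ ≡.cong₂ _-_ (if-same i) (if-distinct (collapse-moves i)) ⟩
        1# - 0#                    ≈⟨ solve 0 (con (ℤ.+ 1) :- con (ℤ.+ 0) := con (ℤ.+ 1)) refl ⟩
        1#                         ∎

      N-cycle : ∀ a → N (vertex a) (succᶜ (vertex a)) ≈ - 1#
      N-cycle a = begin
        δ (vertex a) (succᶜ (vertex a)) - δ (collapse (vertex a)) (succᶜ (vertex a))
          ≡⟨ ≡.cong₂ _-_ (if-distinct (succᶜ-moves a ∘ ≡.sym))
               (≡.trans (≡.cong (λ w → δ w (succᶜ (vertex a))) (collapse-on a)) (if-same (succᶜ (vertex a)))) ⟩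
        0# - 1#  ≈⟨ +-identityˡ _ ⟩
        - 1#     ∎

      N-elsewhere : ∀ {i j} → j ≢ i → j ≢ collapse i → N i j ≈ 0#
      N-elsewhere {i} {j} j≢i j≢ = begin
        δ i j - δ (collapse i) j  ≡⟨ ≡.cong₂ _-_ (if-distinct (j≢i ∘ ≡.sym)) (if-distinct (j≢ ∘ ≡.sym)) ⟩
        0# - 0#                   ≈⟨ -‿inverseʳ 0# ⟩
        0#                        ∎

      support : ∀ π → Injective _≡_ _≡_ π → ¬ π ≗ id → ¬ π ≗ succᶜ → diagonalProduct N π ≈ 0#
      support π π-inj π≢id π≢succ
        with i , bad ← ¬∀⟶∃¬ n _ (λ v → (π v ≟ v) ⊎-dec (π v ≟ collapse v))
                         (λ good → π≢succ (followsCollapse⇒succᶜ π π-inj good π≢id))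
        = product-zero (λ v → N v (π v)) i (N-elsewhere (bad ∘ inj₁) (bad ∘ inj₂))

      product-succᶜ : diagonalProduct N succᶜ ≈ e
      product-succᶜ = begin
        diagonalProduct N succᶜ
          ≈⟨ product-reindex vertex vertex-inj (λ v → N v (succᶜ v)) 1# (λ v off →
               trans (reflexive (≡.cong (N v) (succᶜ-off λ (a , eq) → off a eq))) (N-diagonal v)) ⟩
        product (λ a → N (vertex a) (succᶜ (vertex a))) * 1# ^ (n ∸ m)
          ≈⟨ *-cong (product-const (- 1#) (λ a → N (vertex a) (succᶜ (vertex a))) N-cycle) (1^ (n ∸ m)) ⟩
        e * 1#  ≈⟨ *-identityʳ e ⟩
        e       ∎

      1+se≈0 : 1# + s * e ≈ 0#
      1+se≈0 = begin
        1# + s * e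
          ≈⟨ +-cong (trans (*-cong (sgn-id n id) (trans (product-const 1# (λ i → N i i) N-diagonal) (1^ n))) (*-identityʳ 1#))
                    (*-congˡ product-succᶜ) ⟨
        sgn {n} id id * diagonalProduct N id + s * diagonalProduct N succᶜ
          ≈⟨ det-two-permutations N id succᶜ id succᶜ-injective (λ eq → succᶜ≢id (≡.sym ∘ eq)) support ⟨
        det N  ≈⟨ det-N ⟩
        0#     ∎

    entry-* : ∀ s t → entry (just (s Sign.* t)) ≈ entry (just s) * entry (just t)
    entry-* Sign.+ t      = sym (*-identityˡ _)
    entry-* Sign.- Sign.+ = sym (*-identityʳ _)
    entry-* Sign.- Sign.- = solve 0 (con (ℤ.+ 1) := (:- con (ℤ.+ 1)) :* (:- con (ℤ.+ 1))) refl

    product-entry : ∀ {k} (s : Fin k → Sign) →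
      product (λ a → - entry (just (s a))) ≈ (- 1#) ^ k * entry (just (foldr Sign._*_ Sign.+ s))
    product-entry {zero}  s = sym (*-identityˡ _)
    product-entry {suc k} s = begin
      - entry (just (s zero)) * product (λ a → - entry (just (s (suc a))))
        ≈⟨ *-congˡ (product-entry (s ∘ suc)) ⟩
      - entry (just (s zero)) * ((- 1#) ^ k * entry (just (foldr Sign._*_ Sign.+ (s ∘ suc))))
        ≈⟨ solve 3 (λ x t y → :- x :* (t :* y) := (:- con (ℤ.+ 1) :* t) :* (x :* y)) refl _ _ _ ⟩
      (- 1#) ^ suc k * (entry (just (s zero)) * entry (just (foldr Sign._*_ Sign.+ (s ∘ suc))))
        ≈⟨ *-congˡ (entry-* (s zero) _) ⟨
      (- 1#) ^ suc k * entry (just (foldr Sign._*_ Sign.+ s)) ∎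

    -- The factor (-1)ᵐ of the signature of `succᶜ` cancels the (-1)ᵐ from the `m` negated entries
    -- on the cycle, leaving only minus the sign of the cycle.
    charPoly-unicyclic : ∀ x →
      charPoly (adjacency S) x ≈ x ^ n + - entry (just (Cycle.sign c)) * x ^ (n ∸ m)
    charPoly-unicyclic x = begin
      det M
        ≈⟨ det-two-permutations M id succᶜ id succᶜ-injective (λ eq → succᶜ≢id (≡.sym ∘ eq)) support ⟩
      sgn {n} id id * diagonalProduct M id + sgn succᶜ succᶜ-injective * diagonalProduct M succᶜ
        ≈⟨ +-cong (*-cong (sgn-id n id) (product-const x (λ i → M i i) M-diagonal)) (*-cong sgn-succᶜ product-succᶜ) ⟩
      1# * x ^ n + - e * (e * ε * x ^ (n ∸ m))
        ≈⟨ solve 4 (λ a e ε b → con (ℤ.+ 1) :* a :+ :- e :* (e :* ε :* b) := a :+ (e :* e) :* (:- ε :* b)) refl (x ^ n) e ε (x ^ (n ∸ m)) ⟩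
      x ^ n + e * e * (- ε * x ^ (n ∸ m))
        ≈⟨ +-congˡ (trans (*-congʳ (-1^-square m)) (*-identityˡ _)) ⟩
      x ^ n + - ε * x ^ (n ∸ m) ∎
      where
      open Sidigraph S
      e = (- 1#) ^ m
      ε = entry (just (Cycle.sign c))

      M : Mat n
      M i j = (if does (i ≟ j) then x else 0#) + (- adjacency S i j)

      M-diagonal : ∀ i → M i i ≈ x
      M-diagonal i = begin
        (if does (i ≟ i) then x else 0#) + (- entry (arc i i))
          ≡⟨ ≡.cong₂ (λ a b → a + (- entry b)) (if-same i) (loopless i) ⟩
        x - 0#  ≈⟨ solve 1 (λ x → x :- con (ℤ.+ 0) := x) refl x ⟩
        x       ∎

      M-off : ∀ {i j} → j ≢ i → M i j ≈ - entry (arc i j)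
      M-off {i} {j} j≢i = trans (+-congʳ (reflexive (if-distinct (j≢i ∘ ≡.sym)))) (+-identityˡ _)

      stepOrStay? : ∀ (π : Fin n → Fin n) v → Dec (π v ≢ v → ∃[ s ] arc v (π v) ≡ just s)
      stepOrStay? π v with π v ≟ v
      ... | yes eq = yes λ ≢ → contradiction eq ≢
      ... | no  ≢ with arc v (π v)
      ...   | just s  = yes λ _ → s , ≡.refl
      ...   | nothing = no λ f → case f ≢ of λ ()

      missing : ∀ {i j} → ¬ (j ≢ i → ∃[ s ] arc i j ≡ just s) → M i j ≈ 0#
      missing {i} {j} bad with arc i j in eq
      ... | just s  = contradiction (λ _ → s , ≡.refl) bad
      ... | nothing = begin
        (if does (i ≟ j) then x else 0#) + (- 0#)
          ≡⟨ ≡.cong (_+ (- 0#)) (if-distinct λ i≡j → bad λ j≢i → contradiction (≡.sym i≡j) j≢i) ⟩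
        0# - 0#  ≈⟨ -‿inverseʳ 0# ⟩
        0#       ∎

      support : ∀ π → Injective _≡_ _≡_ π → ¬ π ≗ id → ¬ π ≗ succᶜ → diagonalProduct M π ≈ 0#
      support π π-inj π≢id π≢succ
        with i , bad ← ¬∀⟶∃¬ n _ (stepOrStay? π) (λ good → π≢succ (followsArcs⇒succᶜ π π-inj good π≢id))
        = product-zero (λ v → M v (π v)) i (missing bad)

      product-succᶜ : diagonalProduct M succᶜ ≈ e * ε * x ^ (n ∸ m)
      product-succᶜ = begin
        diagonalProduct M succᶜ
          ≈⟨ product-reindex vertex vertex-inj (λ v → M v (succᶜ v)) x (λ v off →
               trans (reflexive (≡.cong (M v) (succᶜ-off λ (a , eq) → off a eq))) (M-diagonal v)) ⟩
        product (λ a → M (vertex a) (succᶜ (vertex a))) * x ^ (n ∸ m)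
          ≈⟨ *-congʳ (Product.sum-cong-≋ {m} {λ a → M (vertex a) (succᶜ (vertex a))} {λ a → - entry (just (arcSign a))} λ a →
               trans (M-off (succᶜ-moves a)) (reflexive (≡.cong (λ b → - entry b)
                 (≡.trans (≡.cong (arc (vertex a)) (succᶜ-vertex a)) (Cycle.isArc c a))))) ⟩
        product (λ a → - entry (just (arcSign a))) * x ^ (n ∸ m)
          ≈⟨ *-congʳ (product-entry arcSign) ⟩
        e * ε * x ^ (n ∸ m) ∎

-- Constructive order theory of the reals.

module OrderedField {c ℓ₁ ℓ₂} (ℝ : RealField c ℓ₁ ℓ₂) where
  open RealField ℝ hiding (zero)
  open IsStrictPartialOrder isStrictPartialOrder public
    using (<-resp-≈; <-respˡ-≈; <-respʳ-≈)
    renaming (irrefl to <-irrefl; trans to <-trans; asym to <-asym)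

  ℝ-ring : CommutativeRing c ℓ₁
  ℝ-ring = record { isCommutativeRing = isCommutativeRing }

  open CommutativeRing ℝ-ring public using (semiring; ring)
  open RingProperties ring using (-0#≈0#)
  open HeytingProperties heytingCommutativeRing using (1#0; x-0≈x)
  open IntegerCoefficients ℝ-ring using (solve; _:=_; con; _:+_; _:*_; _:-_; :-_)
  open SemiringSum semiring using (sum)

  <⇒# : ∀ {x y} → x < y → x # y
  <⇒# x<y = Equivalence.from (#⇔< _ _) (inj₁ x<y)

  <-cotrans : ∀ {x y} → x < y → ∀ z → x < z ⊎ z < y
  <-cotrans {x} {y} x<y z with #-cotrans (<⇒# x<y) z
  ... | inj₁ x#z = [ inj₁ , (λ z<x → inj₂ (<-trans z<x x<y)) ]′ (Equivalence.to (#⇔< _ _) x#z)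
  ... | inj₂ z#y = [ inj₂ , (λ y<z → inj₁ (<-trans x<y y<z)) ]′ (Equivalence.to (#⇔< _ _) z#y)

  ≤-reflexive : ∀ {x y} → x ≈ y → x ≤ y
  ≤-reflexive x≈y y<x = <-irrefl (sym x≈y) y<x

  ≤-refl : ∀ {x} → x ≤ x
  ≤-refl = ≤-reflexive refl

  ≤-trans : ∀ {x y z} → x ≤ y → y ≤ z → x ≤ z
  ≤-trans x≤y y≤z z<x = [ y≤z , x≤y ]′ (<-cotrans z<x _)

  <⇒≤ : ∀ {x y} → x < y → x ≤ y
  <⇒≤ = <-asym

  <-≤-trans : ∀ {x y z} → x < y → y ≤ z → x < z
  <-≤-trans x<y y≤z = [ id , (λ z<y → contradiction z<y y≤z) ]′ (<-cotrans x<y _)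

  ≤-<-trans : ∀ {x y z} → x ≤ y → y < z → x < z
  ≤-<-trans x≤y y<z = [ (λ y<x → contradiction y<x x≤y) , id ]′ (<-cotrans y<z _)

  ≤-antisym : ∀ {x y} → x ≤ y → y ≤ x → x ≈ y
  ≤-antisym x≤y y≤x = proj₁ (tight _ _) λ x#y → [ y≤x , x≤y ]′ (Equivalence.to (#⇔< _ _) x#y)

  -- Inequalities are negations, so they may be proved by cases although
  -- the order is not decidable.
  ≤-cases : ∀ x y {a b} → (x ≤ y → a ≤ b) → (y ≤ x → a ≤ b) → a ≤ b
  ≤-cases x y f g b<a = f (λ y<x → g (<⇒≤ y<x) b<a) b<a

  +-mono-< : ∀ {x y u v} → x < y → u < v → x + u < y + v
  +-mono-< {x} {y} {u} {v} x<y u<v = <-trans (+-monoˡ-< u x<y)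
    (<-resp-≈ .proj₁ (+-comm v y) (<-resp-≈ .proj₂ (+-comm u y) (+-monoˡ-< y u<v)))

  0<y-x : ∀ {x y} → x < y → 0# < y - x
  0<y-x {x} {y} x<y = <-respˡ-≈ (-‿inverseʳ x) (+-monoˡ-< (- x) x<y)

  <-by : ∀ {x y} d → 0# < d → y ≈ x + d → x < y
  <-by {x} {y} d 0<d y≈x+d = <-respˡ-≈ (+-identityˡ x)
    (<-respʳ-≈ (trans (+-comm d x) (sym y≈x+d)) (+-monoˡ-< x 0<d))

  ≤-by : ∀ {x y} d → 0# ≤ d → y ≈ x + d → x ≤ y
  ≤-by {x} {y} d 0≤d y≈x+d y<x = 0≤d (<-by (x - y) (0<y-x y<x)
    (solve 3 (λ x y d → con (ℤ.+ 0) := d :+ (x :- (x :+ d))) refl x y d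
      ∙ +-congˡ (+-congˡ (-‿cong (sym y≈x+d)))))
    where _∙_ = trans

  0≤y-x : ∀ {x y} → x ≤ y → 0# ≤ y - x
  0≤y-x {x} {y} x≤y y-x<0 = x≤y (<-by (0# - (y - x)) (0<y-x y-x<0)
    (solve 2 (λ x y → x := y :+ (con (ℤ.+ 0) :- (y :- x))) refl x y))

  +-mono-≤ : ∀ {x y u v} → x ≤ y → u ≤ v → x + u ≤ y + v
  +-mono-≤ {x} {y} {u} {v} x≤y u≤v = ≤-trans (step x≤y)
    (≤-trans (≤-reflexive (+-comm y u)) (≤-trans (step u≤v) (≤-reflexive (+-comm v y))))
    where
    step : ∀ {a b d} → a ≤ b → a + d ≤ b + d
    step {a} {b} {d} a≤b = ≤-by (b - a) (0≤y-x a≤b) (solve 3 (λ a b d → b :+ d := a :+ d :+ (b :- a)) refl a b d)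

  +-nonneg : ∀ {x y} → 0# ≤ x → 0# ≤ y → 0# ≤ x + y
  +-nonneg 0≤x 0≤y = ≤-trans (≤-reflexive (sym (+-identityˡ 0#))) (+-mono-≤ 0≤x 0≤y)

  +-pos : ∀ {x y} → 0# < x → 0# < y → 0# < x + y
  +-pos 0<x 0<y = <-respˡ-≈ (+-identityˡ 0#) (+-mono-< 0<x 0<y)

  neg-≤ : ∀ {x y} → x ≤ y → - y ≤ - x
  neg-≤ {x} {y} x≤y = ≤-by (y - x) (0≤y-x x≤y) (solve 2 (λ x y → :- x := :- y :+ (y :- x)) refl x y)

  invertible⇒#0 : ∀ {x y} → x * y ≈ 1# → x # 0#
  invertible⇒#0 {x} {y} xy≈1 = invertible⇒# (y , trans (*-comm _ _) x-0*y≈1 , x-0*y≈1)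
    where
    x-0*y≈1 : (x - 0#) * y ≈ 1#
    x-0*y≈1 = trans (*-congʳ (x-0≈x x)) xy≈1

  inverse : ∀ {x} → x # 0# → ∃[ y ] x * y ≈ 1#
  inverse {x} x#0 with y , _ , right ← #⇒invertible x#0 = y , trans (*-congʳ (sym (x-0≈x x))) right

  *-cancel-0 : ∀ {x y} → x # 0# → x * y ≈ 0# → y ≈ 0#
  *-cancel-0 {x} {y} x#0 xy≈0 with x⁻¹ , inv ← inverse x#0 =
    trans (sym (*-identityˡ y)) (trans (*-congʳ (sym inv))
      (trans (solve 3 (λ x i y → x :* i :* y := x :* y :* i) refl x x⁻¹ y)
        (trans (*-congʳ xy≈0) (zeroˡ _))))

  -- Which factor vanishes cannot be decided. If the inequality failed, neither factor could be
  -- zero; but `x` apart from zero forces `y` to be zero, and tightness of apartness closes the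
  -- argument.
  zero-product-≤ : ∀ {x y a b} → x * y ≈ 0# → (x ≈ 0# → a ≤ b) → (y ≈ 0# → a ≤ b) → a ≤ b
  zero-product-≤ xy≈0 f g b<a =
    f (proj₁ (tight _ _) λ x#0 → g (*-cancel-0 x#0 xy≈0) b<a) b<a

  zero-product-≈ : ∀ {x y a b} → x * y ≈ 0# → (x ≈ 0# → a ≈ b) → (y ≈ 0# → a ≈ b) → a ≈ b
  zero-product-≈ xy≈0 f g = ≤-antisym
    (zero-product-≤ xy≈0 (≤-reflexive ∘ f) (≤-reflexive ∘ g))
    (zero-product-≤ xy≈0 (≤-reflexive ∘ sym ∘ f) (≤-reflexive ∘ sym ∘ g))

  square-zero : ∀ {x} → x * x ≈ 0# → x ≈ 0#
  square-zero xx≈0 = zero-product-≈ xx≈0 id id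

  -- The axiom `*-pos` concerns strict inequalities. A nonnegative number that is not zero is
  -- positive up to double negation, which suffices for refuting `x * y < 0#`.
  *-nonneg : ∀ {x y} → 0# ≤ x → 0# ≤ y → 0# ≤ x * y
  *-nonneg {x} {y} 0≤x 0≤y xy<0 = ≤-cases x 0#
    (λ x≤0 → ≤-reflexive (trans (sym (zeroˡ y)) (*-congʳ (≤-antisym 0≤x x≤0))))
    (λ _ → ≤-cases y 0#
      (λ y≤0 → ≤-reflexive (trans (sym (zeroʳ x)) (*-congˡ (≤-antisym 0≤y y≤0))))
      (λ _ xy<0 → pos x 0≤x (λ x≈0 → <-irrefl (trans (*-congʳ x≈0) (zeroˡ y)) xy<0) λ 0<x →
                  pos y 0≤y (λ y≈0 → <-irrefl (trans (*-congˡ y≈0) (zeroʳ x)) xy<0) λ 0<y →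
                  <-asym (*-pos 0<x 0<y) xy<0))
    xy<0
    where
    pos : ∀ z → 0# ≤ z → ¬ z ≈ 0# → ¬ ¬ 0# < z
    pos z 0≤z z≉0 z≯0 = z≉0 (≤-antisym z≯0 0≤z)

  square-nonneg : ∀ x → 0# ≤ x * x
  square-nonneg x = ≤-cases 0# x (λ 0≤x → *-nonneg 0≤x 0≤x)
    (λ x≤0 → ≤-trans (*-nonneg (0≤-x x≤0) (0≤-x x≤0)) (≤-reflexive (solve 1 (λ x → :- x :* :- x := x :* x) refl x)))
    where
    0≤-x : ∀ {x} → x ≤ 0# → 0# ≤ - x
    0≤-x x≤0 = ≤-trans (≤-reflexive (sym -0#≈0#)) (neg-≤ x≤0)

  0<1 : 0# < 1#
  0<1 with Equivalence.to (#⇔< _ _) 1#0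
  ... | inj₂ 0<1 = 0<1
  ... | inj₁ 1<0 = contradiction 1<0 (≤-trans (square-nonneg 1#) (≤-reflexive (*-identityˡ 1#)))

  *-monoˡ-≤ : ∀ {x y z} → 0# ≤ z → x ≤ y → z * x ≤ z * y
  *-monoˡ-≤ {x} {y} {z} 0≤z x≤y = ≤-by (z * (y - x)) (*-nonneg 0≤z (0≤y-x x≤y))
    (solve 3 (λ x y z → z :* y := z :* x :+ z :* (y :- x)) refl x y z)

  *-monoʳ-≤ : ∀ {x y z} → 0# ≤ z → x ≤ y → x * z ≤ y * z
  *-monoʳ-≤ {x} {y} {z} 0≤z x≤y = ≤-by (z * (y - x)) (*-nonneg 0≤z (0≤y-x x≤y))
    (solve 3 (λ x y z → y :* z := x :* z :+ z :* (y :- x)) refl x y z)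

  *-monoʳ-< : ∀ {x y z} → 0# < z → x < y → x * z < y * z
  *-monoʳ-< {x} {y} {z} 0<z x<y = <-by (z * (y - x)) (*-pos 0<z (0<y-x x<y))
    (solve 3 (λ x y z → y :* z := x :* z :+ z :* (y :- x)) refl x y z)

  *-cancelʳ-≤ : ∀ {x y z} → 0# < z → x * z ≤ y * z → x ≤ y
  *-cancelʳ-≤ 0<z xz≤yz y<x = xz≤yz (*-monoʳ-< 0<z y<x)

  *-cancelʳ-< : ∀ {x y z} → 0# < z → x * z < y * z → x < y
  *-cancelʳ-< {x} {y} {z} 0<z xz<yz
    with z⁻¹ , inv ← inverse (#-sym (<⇒# 0<z))
    with Equivalence.to (#⇔< _ _) (invertible⇒#0 (trans (*-comm z⁻¹ z) inv))
  ... | inj₁ z⁻¹<0 = contradiction 0<1 (≤-trans (≤-reflexive (sym inv)) (λ 0<zz⁻¹ → <-asym (*-monoʳ-< 0<z z⁻¹<0)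
                       (<-respˡ-≈ (sym (zeroˡ z)) (<-respʳ-≈ (*-comm z z⁻¹) 0<zz⁻¹))))
  ... | inj₂ 0<z⁻¹ = <-respˡ-≈ (cancel x) (<-respʳ-≈ (cancel y) (*-monoʳ-< 0<z⁻¹ xz<yz))
    where
    cancel : ∀ w → w * z * z⁻¹ ≈ w
    cancel w = trans (*-assoc w z z⁻¹) (trans (*-congˡ inv) (*-identityʳ w))

  reciprocal : ∀ {x} → 0# < x → ∃[ y ] 0# < y × x * y ≈ 1#
  reciprocal {x} 0<x with y , inv ← inverse (#-sym (<⇒# 0<x)) =
    y , *-cancelʳ-< 0<x (<-respˡ-≈ (sym (zeroˡ x)) (<-respʳ-≈ (trans (sym inv) (*-comm x y)) 0<1)) , inv

  square-cancel-≤ : ∀ {x y} → 0# ≤ y → x * x ≤ y * y → x ≤ y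
  square-cancel-≤ {x} {y} 0≤y xx≤yy y<x = xx≤yy (≤-<-trans (*-monoˡ-≤ 0≤y (<⇒≤ y<x)) (*-monoʳ-< (≤-<-trans 0≤y y<x) y<x))

  sum-mono-≤ : ∀ {n} (f g : Fin n → Carrier) → (∀ i → f i ≤ g i) → sum f ≤ sum g
  sum-mono-≤ {zero}  f g f≤g = ≤-refl
  sum-mono-≤ {suc n} f g f≤g = +-mono-≤ (f≤g zero) (sum-mono-≤ (f ∘ suc) (g ∘ suc) (f≤g ∘ suc))

  ∣x∣-cases-≈ : ∀ x {a b} → (∣ x ∣ ≈ x → a ≈ b) → (∣ x ∣ ≈ - x → a ≈ b) → a ≈ b
  ∣x∣-cases-≈ x f g = ≤-antisym (cases (≤-reflexive ∘ f) (≤-reflexive ∘ g))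
                               (cases (≤-reflexive ∘ sym ∘ f) (≤-reflexive ∘ sym ∘ g))
    where
    sup = ⊔-supremum x (- x)
    cases : ∀ {a b} → (∣ x ∣ ≈ x → a ≤ b) → (∣ x ∣ ≈ - x → a ≤ b) → a ≤ b
    cases f g = ≤-cases (- x) x
      (λ -x≤x → f (≤-antisym (sup .proj₂ .proj₂ x ≤-refl -x≤x) (sup .proj₁)))
      (λ x≤-x → g (≤-antisym (sup .proj₂ .proj₂ (- x) x≤-x ≤-refl) (sup .proj₂ .proj₁)))

  ∣x∣-square : ∀ x → ∣ x ∣ * ∣ x ∣ ≈ x * x
  ∣x∣-square x = ∣x∣-cases-≈ x (λ eq → *-cong eq eq)
    (λ eq → trans (*-cong eq eq) (solve 1 (λ x → :- x :* :- x := x :* x) refl x))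

  0≤∣x∣ : ∀ x → 0# ≤ ∣ x ∣
  0≤∣x∣ x = ≤-cases 0# x (λ 0≤x → ≤-trans 0≤x (⊔-supremum x (- x) .proj₁))
    (λ x≤0 → ≤-trans (≤-trans (≤-reflexive (sym -0#≈0#)) (neg-≤ x≤0)) (⊔-supremum x (- x) .proj₂ .proj₁))

  open SemiringMult semiring public using (×-homo-+) renaming (_×_ to _⋆_)

  ι : ℕ → Carrier
  ι n = n ⋆ 1#

  ι-nonneg : ∀ n → 0# ≤ ι n
  ι-nonneg zero    = ≤-refl
  ι-nonneg (suc n) = +-nonneg (<⇒≤ 0<1) (ι-nonneg n)

  ι-pos : ∀ n → 0# < ι (suc n)
  ι-pos n = <-≤-trans 0<1 (≤-by (ι n) (ι-nonneg n) refl)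

-- Newton's identities and comparison of coefficients.

module Newton {c ℓ} (R : CommutativeRing c ℓ) where
  open CommutativeRing R hiding (zero)
  open Matrix rawRing using (product)
  open Exp semiring using (_^_)
  open SemiringMult semiring using () renaming (_×_ to _⋆_)
  open SemiringSum semiring using (sum; sum-cong-≋; ∑-distrib-+; *-distribˡ-sum)
  open SetoidReasoning setoid
  open IntegerCoefficients R using (solve; _:=_; con; _:+_; _:*_; _:-_; :-_)

  ι : ℕ → Carrier
  ι k = k ⋆ 1#

  indicator : ℕ → ℕ → Carrier
  indicator m k = if does (k ℕ.≟ m) then 1# else 0#

  -- Coefficient sequences of formal power series in t, and multiplication
  -- and division by 1 − a t.
  mul : Carrier → (ℕ → Carrier) → ℕ → Carrier
  mul a f zero    = f zero
  mul a f (suc k) = f (suc k) - a * f k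

  div : Carrier → (ℕ → Carrier) → ℕ → Carrier
  div a f zero    = f zero
  div a f (suc k) = f (suc k) + a * div a f k

  -- The coefficients of ∏ⱼ (1 − zⱼ t).
  coeff : ∀ {n} → (Fin n → Carrier) → ℕ → Carrier
  coeff {zero}  z = indicator 0
  coeff {suc n} z = mul (z zero) (coeff (z ∘ suc))

  div-mul : ∀ a f k → div a (mul a f) k ≈ f k
  div-mul a f zero    = refl
  div-mul a f (suc k) = trans (+-congˡ (*-congˡ (div-mul a f k)))
    (solve 3 (λ x a y → x :- a :* y :+ a :* y := x) refl _ _ _)

  div-mul-comm : ∀ a b f k → div a (mul b f) k ≈ mul b (div a f) k
  div-mul-comm a b f zero          = refl
  div-mul-comm a b f (suc zero)    = solve 4 (λ x y a b → x :- b :* y :+ a :* y := x :+ a :* y :- b :* y) refl _ _ a b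
  div-mul-comm a b f (suc (suc k)) = trans (+-congˡ (*-congˡ (div-mul-comm a b f (suc k))))
    (solve 5 (λ x y d a b → x :- b :* y :+ a :* (y :+ a :* d :- b :* d)
                         := x :+ a :* (y :+ a :* d) :- b :* (y :+ a :* d)) refl _ _ _ a b)

  sum-mul : ∀ {n} b (f : Fin n → ℕ → Carrier) k →
    sum (λ j → mul b (f j) k) ≈ mul b (λ l → sum (λ j → f j l)) k
  sum-mul b f zero    = refl
  sum-mul b f (suc k) = begin
    sum (λ j → f j (suc k) - b * f j k)
      ≈⟨ sum-cong-≋ (λ j → solve 3 (λ x b y → x :- b :* y := x :+ (:- b) :* y) refl (f j (suc k)) b (f j k)) ⟩
    sum (λ j → f j (suc k) + - b * f j k)
      ≈⟨ ∑-distrib-+ (λ j → f j (suc k)) (λ j → - b * f j k) ⟩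
    sum (λ j → f j (suc k)) + sum (λ j → - b * f j k)
      ≈⟨ +-congˡ (*-distribˡ-sum (- b) (λ j → f j k)) ⟨
    sum (λ j → f j (suc k)) + - b * sum (λ j → f j k)
      ≈⟨ solve 3 (λ x b y → x :+ (:- b) :* y := x :- b :* y) refl _ b _ ⟩
    sum (λ j → f j (suc k)) - b * sum (λ j → f j k) ∎

  -- The derivative of the monic polynomial ∏ⱼ (x − zⱼ) of degree n is the sum
  -- of its quotients by the factors x − zⱼ.
  newton : ∀ {n} (z : Fin n → Carrier) k →
    sum (λ j → div (z j) (coeff z) k) + ι k * coeff z k ≈ ι n * coeff z k
  newton {zero} z zero    = solve 1 (λ x → con (ℤ.+ 0) :+ con (ℤ.+ 0) :* x := con (ℤ.+ 0) :* x) refl _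
  newton {zero} z (suc k) = solve 1 (λ x → con (ℤ.+ 0) :+ x :* con (ℤ.+ 0) := con (ℤ.+ 0) :* con (ℤ.+ 0)) refl _
  newton {suc n} z k = begin
    div a (mul a f) k + sum (λ j → div (z (suc j)) (mul a f) k) + ι k * mul a f k
      ≈⟨ +-congʳ (+-cong (div-mul a f k) (trans (sum-cong-≋ λ j → div-mul-comm (z (suc j)) a f k)
                                               (sum-mul a (λ j → div (z (suc j)) f) k))) ⟩
    f k + mul a g k + ι k * mul a f k
      ≈⟨ step k ⟩
    ι (suc n) * mul a f k ∎
    where
    a = z zero
    f = coeff (z ∘ suc)
    g : ℕ → Carrier
    g k = sum (λ j → div (z (suc j)) f k)
    ih : ∀ k → g k ≈ ι n * f k - ι k * f k
    ih k = trans (solve 2 (λ g t → g := g :+ t :- t) refl (g k) (ι k * f k)) (+-congʳ (newton (z ∘ suc) k))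
    step : ∀ k → f k + mul a g k + ι k * mul a f k ≈ ι (suc n) * mul a f k
    step zero    = trans (+-congʳ (+-congˡ (ih 0)))
      (solve 2 (λ f n → f :+ (n :* f :- con (ℤ.+ 0) :* f) :+ con (ℤ.+ 0) :* f := (con (ℤ.+ 1) :+ n) :* f) refl (f 0) (ι n))
    step (suc k) = trans (+-congʳ (+-congˡ (+-cong (ih (suc k)) (-‿cong (*-congˡ (ih k))))))
      (solve 5 (λ f f′ a n k →
        f :+ ((n :* f :- (con (ℤ.+ 1) :+ k) :* f) :- a :* (n :* f′ :- k :* f′)) :+ (con (ℤ.+ 1) :+ k) :* (f :- a :* f′)
          := (con (ℤ.+ 1) :+ n) :* (f :- a :* f′)) refl (f (suc k)) (f k) a (ι n) (ι k))

  -- The polynomial e₀ xⁿ + e₁ xⁿ⁻¹ + ⋯ + eₙ.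
  horner : ℕ → (ℕ → Carrier) → Carrier → Carrier
  horner zero    e x = e zero
  horner (suc n) e x = x * horner n e x + e (suc n)

  horner-cong : ∀ n {e f} x → (∀ k → e k ≈ f k) → horner n e x ≈ horner n f x
  horner-cong zero    x e≈f = e≈f zero
  horner-cong (suc n) x e≈f = +-cong (*-congˡ (horner-cong n x e≈f)) (e≈f (suc n))

  horner-linear : ∀ n e f a x → horner n (λ k → e k + a * f k) x ≈ horner n e x + a * horner n f x
  horner-linear zero    e f a x = refl
  horner-linear (suc n) e f a x = trans (+-congʳ (*-congˡ (horner-linear n e f a x)))
    (solve 6 (λ x a p q e f → x :* (p :+ a :* q) :+ (e :+ a :* f) := x :* p :+ e :+ a :* (x :* q :+ f)) refl x a _ _ _ _)

  horner-shift : ∀ n e x → e zero ≈ 0# → horner (suc n) e x ≈ horner n (e ∘ suc) x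
  horner-shift zero    e x e₀≈0 = trans (+-congʳ (*-congˡ e₀≈0)) (solve 2 (λ x e → x :* con (ℤ.+ 0) :+ e := e) refl x _)
  horner-shift (suc n) e x e₀≈0 = +-congʳ (*-congˡ (horner-shift n e x e₀≈0))

  coeff-degree : ∀ {n} (z : Fin n → Carrier) k → n ℕ.< k → coeff z k ≈ 0#
  coeff-degree {zero}  z (suc k) _             = refl
  coeff-degree {suc n} z (suc k) (ℕ.s≤s n<k) = trans
    (+-cong (coeff-degree (z ∘ suc) (suc k) (ℕ.m<n⇒m<1+n n<k)) (-‿cong (*-congˡ (coeff-degree (z ∘ suc) k n<k))))
    (solve 1 (λ a → con (ℤ.+ 0) :- a :* con (ℤ.+ 0) := con (ℤ.+ 0)) refl _)

  product-coeff : ∀ {n} (z : Fin n → Carrier) x → product (λ j → x + (- z j)) ≈ horner n (coeff z) x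
  product-coeff {zero}  z x = refl
  product-coeff {suc n} z x = begin
    (x - a) * product (λ j → x + (- z (suc j)))
      ≈⟨ *-congˡ (product-coeff (z ∘ suc) x) ⟩
    (x - a) * horner n f x
      ≈⟨ solve 3 (λ x a h → (x :- a) :* h := x :* h :+ con (ℤ.+ 0) :+ (:- a) :* h) refl x a _ ⟩
    x * horner n f x + 0# + - a * horner n f x
      ≈⟨ +-cong (+-congˡ (coeff-degree (z ∘ suc) (suc n) ℕ.≤-refl)) (*-congˡ (horner-shift n shifted x refl)) ⟨
    horner (suc n) f x + - a * horner (suc n) shifted x
      ≈⟨ horner-linear (suc n) f shifted (- a) x ⟨
    horner (suc n) (λ k → f k + - a * shifted k) x
      ≈⟨ horner-cong (suc n) x pointwise ⟨
    horner (suc n) (mul a f) x ∎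
    where
    a = z zero
    f = coeff (z ∘ suc)
    shifted : ℕ → Carrier
    shifted zero    = 0#
    shifted (suc k) = f k
    pointwise : ∀ k → mul a f k ≈ f k + - a * shifted k
    pointwise zero    = solve 2 (λ f a → f := f :+ (:- a) :* con (ℤ.+ 0)) refl _ a
    pointwise (suc k) = solve 3 (λ x a y → x :- a :* y := x :+ (:- a) :* y) refl _ a _

  indicator-same : ∀ m → indicator m m ≡ 1#
  indicator-same m = ≡.cong (if_then 1# else 0#) (dec-true (m ℕ.≟ m) ≡.refl)

  indicator-distinct : ∀ {m k} → k ≢ m → indicator m k ≡ 0#
  indicator-distinct {m} {k} k≢m = ≡.cong (if_then 1# else 0#) (dec-false (k ℕ.≟ m) k≢m)

  horner-zero : ∀ n e x → (∀ k → k ℕ.≤ n → e k ≈ 0#) → horner n e x ≈ 0#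
  horner-zero zero    e x e≈0 = e≈0 zero ℕ.z≤n
  horner-zero (suc n) e x e≈0 = trans
    (+-cong (*-congˡ (horner-zero n e x λ k k≤n → e≈0 k (ℕ.m≤n⇒m≤1+n k≤n))) (e≈0 (suc n) ℕ.≤-refl))
    (solve 1 (λ x → x :* con (ℤ.+ 0) :+ con (ℤ.+ 0) := con (ℤ.+ 0)) refl x)

  horner-indicator : ∀ m i x → horner (i ℕ.+ m) (indicator m) x ≈ x ^ i
  horner-indicator zero    zero x = refl
  horner-indicator (suc m) zero x = trans
    (+-cong (*-congˡ (horner-zero m (indicator (suc m)) x λ k k≤m →
               reflexive (indicator-distinct (ℕ.<⇒≢ (ℕ.s≤s k≤m))))) (reflexive (indicator-same (suc m))))
    (solve 1 (λ x → x :* con (ℤ.+ 0) :+ con (ℤ.+ 1) := con (ℤ.+ 1)) refl x)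
  horner-indicator m (suc i) x = trans
    (+-cong (*-congˡ (horner-indicator m i x))
            (reflexive (indicator-distinct (ℕ.<⇒≢ (ℕ.s≤s (ℕ.m≤n+m m i)) ∘ ≡.sym))))
    (+-identityʳ _)

  horner-leading : ∀ n e → (∀ k → k ℕ.< n → e (suc k) ≈ 0#) → horner n e 1# ≈ e 0
  horner-leading zero    e _   = refl
  horner-leading (suc n) e e≈0 = trans
    (+-cong (*-congˡ (horner-leading n e λ k k<n → e≈0 k (ℕ.m<n⇒m<1+n k<n))) (e≈0 n ℕ.≤-refl))
    (solve 1 (λ x → con (ℤ.+ 1) :* x :+ con (ℤ.+ 0) := x) refl _)

  2^ : ℕ → Carrier
  2^ k = (1# + 1#) ^ k

  horner-scale : ∀ n e x → horner n (λ k → 2^ k * e k) ((1# + 1#) * x) ≈ 2^ n * horner n e x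
  horner-scale zero    e x = refl
  horner-scale (suc n) e x = trans (+-congʳ (*-congˡ (horner-scale n e x)))
    (solve 4 (λ x t h e → let two = con (ℤ.+ 1) :+ con (ℤ.+ 1) in
       two :* x :* (t :* h) :+ two :* t :* e := two :* t :* (x :* h :+ e)) refl x (2^ n) _ (e (suc n)))

  module _ (half : Carrier) (2*half : (1# + 1#) * half ≈ 1#)
           (2^-1-cancel : ∀ k x → (2^ (suc k) - 1#) * x ≈ 0# → x ≈ 0#) where

    -- Comparing the polynomial at x and at 2x eliminates its leading term.
    horner-vanishing : ∀ n e → (∀ x → horner n e x ≈ 0#) → ∀ k → k ℕ.≤ n → e k ≈ 0#
    horner-vanishing-tail : ∀ n e → (∀ x → horner n e x ≈ 0#) → ∀ k → k ℕ.< n → e (suc k) ≈ 0#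

    horner-vanishing n e vanishes zero    _   =
      trans (sym (horner-leading n e (horner-vanishing-tail n e vanishes))) (vanishes 1#)
    horner-vanishing n e vanishes (suc k) k<n = horner-vanishing-tail n e vanishes k k<n

    horner-vanishing-tail (suc n) e vanishes k (ℕ.s≤s k≤n) = 2^-1-cancel k _ (trans
      (solve 2 (λ t e → (t :- con (ℤ.+ 1)) :* e := t :* e :+ (:- con (ℤ.+ 1)) :* e) refl (2^ (suc k)) (e (suc k)))
      (horner-vanishing n (d ∘ suc) (λ x → trans (sym (horner-shift n d x d₀≈0)) (d-vanishes x)) k k≤n))
      where
      d : ℕ → Carrier
      d k = 2^ k * e k + - 1# * e k
      d₀≈0 : d 0 ≈ 0#
      d₀≈0 = solve 1 (λ e → con (ℤ.+ 1) :* e :+ (:- con (ℤ.+ 1)) :* e := con (ℤ.+ 0)) refl (e 0)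
      d-vanishes : ∀ x → horner (suc n) d x ≈ 0#
      d-vanishes x = begin
        horner (suc n) d x
          ≈⟨ horner-linear (suc n) (λ k → 2^ k * e k) e (- 1#) x ⟩
        horner (suc n) (λ k → 2^ k * e k) x + - 1# * horner (suc n) e x
          ≈⟨ +-cong (horner-congʳ (suc n) (λ k → 2^ k * e k) (sym 2hx≈x)) (*-congˡ (vanishes x)) ⟩
        horner (suc n) (λ k → 2^ k * e k) ((1# + 1#) * (half * x)) + - 1# * 0#
          ≈⟨ +-congʳ (trans (horner-scale (suc n) e (half * x)) (*-congˡ (vanishes (half * x)))) ⟩
        2^ (suc n) * 0# + - 1# * 0#
          ≈⟨ solve 1 (λ t → t :* con (ℤ.+ 0) :+ (:- con (ℤ.+ 1)) :* con (ℤ.+ 0) := con (ℤ.+ 0)) refl (2^ (suc n)) ⟩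
        0# ∎
        where
        2hx≈x : (1# + 1#) * (half * x) ≈ x
        2hx≈x = trans (sym (*-assoc _ half x)) (trans (*-congʳ 2*half) (*-identityˡ x))
        horner-congʳ : ∀ n e {x y} → x ≈ y → horner n e x ≈ horner n e y
        horner-congʳ zero    e x≈y = refl
        horner-congʳ (suc n) e x≈y = +-congʳ (*-cong x≈y (horner-congʳ n e x≈y))

    module _ {n m : ℕ} (m≢0 : m ≢ 0) (m≤n : m ℕ.≤ n) (z : Fin n → Carrier)
             (factors : ∀ x → x ^ n + x ^ (n ∸ m) ≈ product (λ j → x + (- z j))) where

      -- The factorisation is an equality of functions only; `horner-vanishing` turns it into one of
      -- coefficients. Read as a power series, ∏ⱼ (1 - zⱼ t) is 1 + tᵐ.
      coeff-known : ∀ k → k ℕ.≤ n → coeff z k ≈ indicator 0 k + indicator m k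
      coeff-known k k≤n = trans
        (solve 3 (λ c a b → c := (c :+ (:- con (ℤ.+ 1)) :* (a :+ b)) :+ (a :+ b)) refl (coeff z k) _ _)
        (trans (+-congʳ (horner-vanishing n (λ k → coeff z k + - 1# * (indicator 0 k + indicator m k)) vanishes k k≤n))
               (+-identityˡ _))
        where
        at : ∀ {i j} → i ≡ j → ∀ m x → horner i (indicator m) x ≈ horner j (indicator m) x
        at ≡.refl m x = refl
        vanishes : ∀ x → horner n (λ k → coeff z k + - 1# * (indicator 0 k + indicator m k)) x ≈ 0#
        vanishes x = begin
          horner n (λ k → coeff z k + - 1# * (indicator 0 k + indicator m k)) x
            ≈⟨ horner-linear n (coeff z) (λ k → indicator 0 k + indicator m k) (- 1#) x ⟩
          horner n (coeff z) x + - 1# * horner n (λ k → indicator 0 k + indicator m k) x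
            ≈⟨ +-congˡ (*-congˡ (trans (horner-cong n x (λ k → +-congˡ (sym (*-identityˡ _))))
                                       (horner-linear n (indicator 0) (indicator m) 1# x))) ⟩
          horner n (coeff z) x + - 1# * (horner n (indicator 0) x + 1# * horner n (indicator m) x)
            ≈⟨ +-cong (trans (sym (product-coeff z x)) (sym (factors x)))
                 (*-congˡ (+-cong (trans (at (≡.sym (ℕ.+-identityʳ n)) 0 x) (horner-indicator 0 n x))
                                  (*-congˡ (trans (at (≡.sym (ℕ.m∸n+n≡m m≤n)) m x) (horner-indicator m (n ∸ m) x))))) ⟩
          (x ^ n + x ^ (n ∸ m)) + - 1# * (x ^ n + 1# * x ^ (n ∸ m))
            ≈⟨ solve 2 (λ a b → (a :+ b) :+ (:- con (ℤ.+ 1)) :* (a :+ con (ℤ.+ 1) :* b) := con (ℤ.+ 0)) refl (x ^ n) (x ^ (n ∸ m)) ⟩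
          0# ∎

      coeff-low : ∀ k → suc k ℕ.< m → coeff z (suc k) ≈ 0#
      coeff-low k k<m = trans (coeff-known (suc k) (ℕ.<⇒≤ (ℕ.<-≤-trans k<m m≤n)))
        (trans (+-congˡ (reflexive (indicator-distinct (ℕ.<⇒≢ k<m)))) (+-identityˡ 0#))

      coeff-m : coeff z m ≈ 1#
      coeff-m = trans (coeff-known m m≤n)
        (trans (+-cong (reflexive (indicator-distinct m≢0)) (reflexive (indicator-same m))) (+-identityˡ 1#))

      -- Below degree m the series 1 + tᵐ agrees with 1, so dividing by 1 - at gives the geometric
      -- series; `div-m` adds the first correction. Summing over the eigenvalues makes power sums
      -- appear in `newton`.
      div-low : ∀ a k → k ℕ.< m → div a (coeff z) k ≈ a ^ k
      div-low a zero    0<m = trans (coeff-known 0 ℕ.z≤n)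
        (trans (+-congˡ (reflexive (indicator-distinct (m≢0 ∘ ≡.sym)))) (+-identityʳ 1#))
      div-low a (suc k) k<m = trans (+-cong (coeff-low k k<m) (*-congˡ (div-low a k (ℕ.<⇒≤ k<m)))) (+-identityˡ _)

      div-m : ∀ a → div a (coeff z) m ≈ 1# + a ^ m
      div-m a = at m ≡.refl
        where
        at : ∀ l → l ≡ m → div a (coeff z) l ≈ 1# + a ^ l
        at zero    l≡m = contradiction (≡.sym l≡m) m≢0
        at (suc l) l≡m = +-cong (≡.subst (λ k → coeff z k ≈ 1#) (≡.sym l≡m) coeff-m)
                                (*-congˡ (div-low a l (ℕ.≤-reflexive l≡m)))

      powerSum-low : ∀ k → k ≢ 0 → k ℕ.< m → sum (λ j → z j ^ k) ≈ 0#
      powerSum-low zero    k≢0 _   = contradiction ≡.refl k≢0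
      powerSum-low (suc k) _   k<m = begin
        sum (λ j → z j ^ suc k)
          ≈⟨ sum-cong-≋ (λ j → div-low (z j) (suc k) k<m) ⟨
        s
          ≈⟨ solve 2 (λ s k → s := s :+ k :* con (ℤ.+ 0)) refl s (ι (suc k)) ⟩
        s + ι (suc k) * 0#
          ≈⟨ +-congˡ (*-congˡ (coeff-low k k<m)) ⟨
        s + ι (suc k) * coeff z (suc k)
          ≈⟨ newton z (suc k) ⟩
        ι n * coeff z (suc k)
          ≈⟨ trans (*-congˡ (coeff-low k k<m)) (zeroʳ _) ⟩
        0# ∎
        where s = sum (λ j → div (z j) (coeff z) (suc k))

      powerSum-m : sum (λ j → z j ^ m) ≈ - ι m
      powerSum-m = begin
        s
          ≈⟨ solve 3 (λ s n m → s := (n :+ s) :+ m :- n :- m) refl s (ι n) (ι m) ⟩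
        (ι n + s) + ι m - ι n - ι m
          ≈⟨ +-congʳ (+-congʳ (+-cong sums (trans (sym (*-identityʳ (ι m))) (*-congˡ (sym coeff-m))))) ⟩
        sum (λ j → div (z j) (coeff z) m) + ι m * coeff z m - ι n - ι m
          ≈⟨ +-congʳ (+-congʳ (trans (newton z m) (*-congˡ coeff-m))) ⟩
        ι n * 1# - ι n - ι m
          ≈⟨ solve 2 (λ n m → n :* con (ℤ.+ 1) :- n :- m := :- m) refl (ι n) (ι m) ⟩
        - ι m ∎
        where
        open SemiringSum semiring using (sum-replicate)
        s = sum (λ j → z j ^ m)
        sums : ι n + s ≈ sum (λ j → div (z j) (coeff z) m)
        sums = begin
          ι n + s                                  ≈⟨ +-congʳ (sum-replicate n) ⟨
          sum {n} (λ _ → 1#) + s                   ≈⟨ ∑-distrib-+ (λ _ → 1#) (λ j → z j ^ m) ⟨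
          sum (λ j → 1# + z j ^ m)                 ≈⟨ sum-cong-≋ (λ j → div-m (z j)) ⟨
          sum (λ j → div (z j) (coeff z) m)        ∎

-- Mixed moments of two related families.

even-gap : ∀ a d s → a ℕ.+ (a ℕ.+ suc d) ≡ s ℕ.+ s → ∃[ l ] suc l ℕ.≤ s × d ≡ l ℕ.+ suc l
even-gap zero d (suc s) eq = s , ℕ.≤-refl , ℕ.suc-injective eq
even-gap (suc a) d (suc s) eq with l , l≤s , d≡ ← even-gap a d s (ℕ.suc-injective (ℕ.suc-injective
  (≡.trans (≡.cong suc (≡.sym (ℕ.+-suc a (a ℕ.+ suc d)))) (≡.trans eq (≡.cong suc (ℕ.+-suc s s))))))
  = l , ℕ.m≤n⇒m≤1+n l≤s , d≡

module Moments {c ℓ} (R : CommutativeRing c ℓ) (κ : CommutativeRing.Carrier R) where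
  open CommutativeRing R hiding (zero)
  open Exp semiring using (_^_)
  open SemiringMult semiring using () renaming (_×_ to _⋆_)
  open SemiringSum semiring using (sum; sum-cong-≋; ∑-distrib-+; *-distribˡ-sum)
  open SetoidReasoning setoid
  open IntegerCoefficients R using (solve; _:=_; con; _:+_; _:*_; _:-_; :-_)

  private
    ι : ℕ → Carrier
    ι k = k ⋆ 1#

  -- This is the power of `κ` with exponent 2b + l, in the form that follows the recursion on `b`.
  collapsed : ℕ → ℕ → Carrier
  collapsed zero    l = κ ^ l
  collapsed (suc b) l = κ * κ * collapsed b l

  power-scale : ∀ l x → (κ * x) ^ l ≈ κ ^ l * x ^ l
  power-scale zero    x = sym (*-identityˡ 1#)
  power-scale (suc l) x = trans (*-congˡ (power-scale l x))
    (solve 4 (λ k x p q → k :* x :* (p :* q) := k :* p :* (x :* q)) refl κ x _ _)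

  -- The hypothesis makes `y` a pseudo-inverse of `x`, as for a complex number of modulus 0 or 1 and
  -- its conjugate. A pair `x * y` may be cancelled as long as another factor `x` remains, whence
  -- `suc l`.
  collapse-off-diagonal : ∀ x y → x * y * x ≈ x → ∀ b l →
    (κ * x) ^ (b ℕ.+ suc l) * (κ * y) ^ b ≈ collapsed b (suc l) * x ^ suc l
  collapse-off-diagonal x y xyx zero    l = trans (*-identityʳ _) (power-scale (suc l) x)
  collapse-off-diagonal x y xyx (suc b) l = begin
    (κ * x * (κ * x) ^ (b ℕ.+ suc l)) * (κ * y * (κ * y) ^ b)
      ≈⟨ solve 5 (λ k x y p q → (k :* x :* p) :* (k :* y :* q) := k :* k :* x :* y :* (p :* q)) refl κ x y _ _ ⟩
    κ * κ * x * y * ((κ * x) ^ (b ℕ.+ suc l) * (κ * y) ^ b)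
      ≈⟨ *-congˡ (collapse-off-diagonal x y xyx b l) ⟩
    κ * κ * x * y * (collapsed b (suc l) * (x * x ^ l))
      ≈⟨ solve 5 (λ k x y p q → k :* k :* x :* y :* (p :* (x :* q)) := k :* k :* p :* (x :* y :* x :* q)) refl κ x y _ _ ⟩
    κ * κ * collapsed b (suc l) * (x * y * x * x ^ l)
      ≈⟨ *-congˡ (*-congʳ xyx) ⟩
    κ * κ * collapsed b (suc l) * (x * x ^ l) ∎

  collapse-diagonal : ∀ x y → x * y * x ≈ x → ∀ b →
    (κ * x) ^ suc b * (κ * y) ^ suc b ≈ collapsed (suc b) 0 * (x * y)
  collapse-diagonal x y xyx zero    = solve 3 (λ k x y →
    k :* x :* con (ℤ.+ 1) :* (k :* y :* con (ℤ.+ 1)) := k :* k :* con (ℤ.+ 1) :* (x :* y)) refl κ x y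
  collapse-diagonal x y xyx (suc b) = begin
    (κ * x * (κ * x) ^ suc b) * (κ * y * (κ * y) ^ suc b)
      ≈⟨ solve 5 (λ k x y p q → (k :* x :* p) :* (k :* y :* q) := k :* k :* x :* y :* (p :* q)) refl κ x y _ _ ⟩
    κ * κ * x * y * ((κ * x) ^ suc b * (κ * y) ^ suc b)
      ≈⟨ *-congˡ (collapse-diagonal x y xyx b) ⟩
    κ * κ * x * y * (collapsed (suc b) 0 * (x * y))
      ≈⟨ solve 4 (λ k x y p → k :* k :* x :* y :* (p :* (x :* y)) := k :* k :* p :* (x :* y :* x :* y)) refl κ x y _ ⟩
    κ * κ * collapsed (suc b) 0 * (x * y * x * y)
      ≈⟨ *-congˡ (*-congʳ xyx) ⟩
    κ * κ * collapsed (suc b) 0 * (x * y) ∎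

  module _ {n} (x y : Fin n → Carrier) where

    moment : ℕ → ℕ → ℕ → Carrier
    moment k a b = sum λ j → (κ * x j) ^ a * (κ * y j) ^ b * (κ * x j - κ * y j) ^ k

    moment-suc : ∀ k a b → moment (suc k) a b ≈ moment k (suc a) b - moment k a (suc b)
    moment-suc k a b = begin
      moment (suc k) a b
        ≈⟨ sum-cong-≋ (λ j → solve 5 (λ u v p q d → p :* q :* ((u :- v) :* d) :=
             u :* p :* q :* d :+ (:- con (ℤ.+ 1)) :* (p :* (v :* q) :* d)) refl
             (κ * x j) (κ * y j) ((κ * x j) ^ a) ((κ * y j) ^ b) ((κ * x j - κ * y j) ^ k)) ⟩
      sum (λ j → f j + - 1# * g j)
        ≈⟨ ∑-distrib-+ f (λ j → - 1# * g j) ⟩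
      moment k (suc a) b + sum (λ j → - 1# * g j)
        ≈⟨ +-congˡ (*-distribˡ-sum (- 1#) g) ⟨
      moment k (suc a) b + - 1# * moment k a (suc b)
        ≈⟨ solve 2 (λ p q → p :+ (:- con (ℤ.+ 1)) :* q := p :- q) refl _ _ ⟩
      moment k (suc a) b - moment k a (suc b) ∎
      where
      f g : Fin n → Carrier
      f j = (κ * x j) ^ suc a * (κ * y j) ^ b * (κ * x j - κ * y j) ^ k
      g j = (κ * x j) ^ a * (κ * y j) ^ suc b * (κ * x j - κ * y j) ^ k

    -- The Euler operator u ∂ᵤ − v ∂ᵥ multiplies uᵃ vᵇ by a − b, so it annihilates
    -- sums over which only the diagonal moments survive; here it is applied to
    -- uᵃ vᵇ (u − v)ᵏ.
    module _ (s : ℕ) (off-diagonal : ∀ a b → a ℕ.+ b ≡ s → (ι a - ι b) * moment 0 a b ≈ 0#) where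

      -- By the product rule this is the contribution of the factor (u - v)ᵏ, on which the operator
      -- gives k (u + v)(u - v)ᵏ⁻¹.
      eulerTail : ℕ → ℕ → ℕ → Carrier
      eulerTail zero    a b = 0#
      eulerTail (suc k) a b = ι (suc k) * (moment k (suc a) b + moment k a (suc b))

      eulerTail-step : ∀ k a b → eulerTail k (suc a) b - eulerTail k a (suc b) ≈
                                 ι k * (moment k (suc a) b + moment k a (suc b))
      eulerTail-step zero    a b = solve 1 (λ t → con (ℤ.+ 0) :- con (ℤ.+ 0) := con (ℤ.+ 0) :* t) refl _
      eulerTail-step (suc k) a b = trans
        (solve 4 (λ i p q r → i :* (p :+ q) :- i :* (q :+ r) := i :* ((p :- q) :+ (q :- r))) refl
          (ι (suc k)) _ (moment k (suc a) (suc b)) _)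
        (*-congˡ (sym (+-cong (moment-suc k (suc a) b) (moment-suc k a (suc b)))))

      euler : ∀ k a b → a ℕ.+ b ℕ.+ k ≡ s → (ι a - ι b) * moment k a b + eulerTail k a b ≈ 0#
      euler zero    a b eq = trans (+-identityʳ _) (off-diagonal a b (≡.trans (≡.sym (ℕ.+-identityʳ _)) eq))
      euler (suc k) a b eq = begin
        (ι a - ι b) * moment (suc k) a b + (1# + ι k) * (p + q)
          ≈⟨ +-congʳ (*-congˡ (moment-suc k a b)) ⟩
        (ι a - ι b) * (p - q) + (1# + ι k) * (p + q)
          ≈⟨ solve 5 (λ a b k p q → (a :- b) :* (p :- q) :+ (con (ℤ.+ 1) :+ k) :* (p :+ q) :=
               ((con (ℤ.+ 1) :+ a) :- b) :* p :- (a :- (con (ℤ.+ 1) :+ b)) :* q :+ k :* (p :+ q)) refl (ι a) (ι b) (ι k) p q ⟩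
        (ι (suc a) - ι b) * p - (ι a - ι (suc b)) * q + ι k * (p + q)
          ≈⟨ +-congˡ (eulerTail-step k a b) ⟨
        (ι (suc a) - ι b) * p - (ι a - ι (suc b)) * q + (eulerTail k (suc a) b - eulerTail k a (suc b))
          ≈⟨ solve 4 (λ p q r s → p :- q :+ (r :- s) := (p :+ r) :- (q :+ s)) refl _ _ _ _ ⟩
        ((ι (suc a) - ι b) * p + eulerTail k (suc a) b) - ((ι a - ι (suc b)) * q + eulerTail k a (suc b))
          ≈⟨ +-cong (euler k (suc a) b (≡.trans (≡.sym (ℕ.+-suc (a ℕ.+ b) k)) eq))
                    (-‿cong (euler k a (suc b) (≡.trans (≡.cong (ℕ._+ k) (ℕ.+-suc a b)) (≡.trans (≡.sym (ℕ.+-suc (a ℕ.+ b) k)) eq)))) ⟩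
        0# - 0#
          ≈⟨ -‿inverseʳ 0# ⟩
        0# ∎
        where
        p = moment k (suc a) b
        q = moment k a (suc b)

      -- A discrete integration by parts, as in the reduction formula for integrals of powers of
      -- sine. Adding the instances for the exponents (1, 0) and (0, 1) produces (u + v)², which is
      -- (u - v)² + 4uv.
      euler-central : ∀ k → suc (suc k) ≡ s →
        (1# + (1# + ι k)) * moment (suc (suc k)) 0 0 ≈
        - ((1# + 1# + 1# + 1#) * ((1# + ι k) * moment k 1 1))
      euler-central k eq = begin
        (1# + (1# + ι k)) * moment (suc (suc k)) 0 0
          ≈⟨ solve 2 (λ k t → (con (ℤ.+ 1) :+ (con (ℤ.+ 1) :+ k)) :* t := t :+ (con (ℤ.+ 1) :+ k) :* t) refl (ι k) _ ⟩
        moment (suc (suc k)) 0 0 + (1# + ι k) * moment (suc (suc k)) 0 0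
          ≈⟨ +-cong (moment-suc (suc k) 0 0) (*-congˡ (trans (moment-suc (suc k) 0 0)
               (+-cong (moment-suc k 1 0) (-‿cong (moment-suc k 0 1))))) ⟩
        (p - q) + (1# + ι k) * ((t₂₀ - t₁₁) - (t₁₁ - t₀₂))
          ≈⟨ solve 6 (λ p q k a b d → (p :- q) :+ (con (ℤ.+ 1) :+ k) :* ((a :- b) :- (b :- d)) :=
               ((con (ℤ.+ 1) :+ con (ℤ.+ 0) :- con (ℤ.+ 0)) :* p :+ (con (ℤ.+ 1) :+ k) :* (a :+ b))
               :+ ((con (ℤ.+ 0) :- (con (ℤ.+ 1) :+ con (ℤ.+ 0))) :* q :+ (con (ℤ.+ 1) :+ k) :* (b :+ d))
               :- con (ℤ.+ 4) :* ((con (ℤ.+ 1) :+ k) :* b)) refl p q (ι k) t₂₀ t₁₁ t₀₂ ⟩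
        ((ι 1 - ι 0) * p + eulerTail (suc k) 1 0) + ((ι 0 - ι 1) * q + eulerTail (suc k) 0 1)
          - (1# + 1# + 1# + 1#) * ((1# + ι k) * t₁₁)
          ≈⟨ +-congʳ (+-cong (euler (suc k) 1 0 eq) (euler (suc k) 0 1 eq)) ⟩
        0# + 0# - (1# + 1# + 1# + 1#) * ((1# + ι k) * t₁₁)
          ≈⟨ solve 1 (λ t → con (ℤ.+ 0) :+ con (ℤ.+ 0) :- t := :- t) refl _ ⟩
        - ((1# + 1# + 1# + 1#) * ((1# + ι k) * t₁₁)) ∎
        where
        p = moment (suc k) 1 0
        q = moment (suc k) 0 1
        t₂₀ = moment k 2 0
        t₁₁ = moment k 1 1
        t₀₂ = moment k 0 2

    module _ (xyx : ∀ j → x j * y j * x j ≈ x j) (yxy : ∀ j → y j * x j * y j ≈ y j) where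

      moment-above : ∀ b l → moment 0 (b ℕ.+ suc l) b ≈ collapsed b (suc l) * sum (λ j → x j ^ suc l)
      moment-above b l = trans
        (sum-cong-≋ λ j → trans (*-identityʳ _) (collapse-off-diagonal (x j) (y j) (xyx j) b l))
        (sym (*-distribˡ-sum (collapsed b (suc l)) (λ j → x j ^ suc l)))

      moment-below : ∀ a l → moment 0 a (a ℕ.+ suc l) ≈ collapsed a (suc l) * sum (λ j → y j ^ suc l)
      moment-below a l = trans
        (sum-cong-≋ λ j → trans (*-identityʳ _) (trans (*-comm _ _) (collapse-off-diagonal (y j) (x j) (yxy j) a l)))
        (sym (*-distribˡ-sum (collapsed a (suc l)) (λ j → y j ^ suc l)))

      moment-diagonal : ∀ b → moment 0 (suc b) (suc b) ≈ collapsed (suc b) 0 * sum (λ j → x j * y j)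
      moment-diagonal b = trans
        (sum-cong-≋ λ j → trans (*-identityʳ _) (collapse-diagonal (x j) (y j) (xyx j) b))
        (sym (*-distribˡ-sum (collapsed (suc b) 0) (λ j → x j * y j)))

      -- On the diagonal the factor `ι a - ι b` vanishes. Off it, the total degree is even, so the
      -- gap between the exponents is even and positive, and the moment collapses to a multiple of
      -- an even power sum.
      off-diagonal-zero : ∀ s →
        (∀ l → suc l ℕ.≤ s → sum (λ j → x j ^ (suc l ℕ.+ suc l)) ≈ 0#) →
        (∀ l → suc l ℕ.≤ s → sum (λ j → y j ^ (suc l ℕ.+ suc l)) ≈ 0#) →
        ∀ a b → a ℕ.+ b ≡ s ℕ.+ s → (ι a - ι b) * moment 0 a b ≈ 0#
      off-diagonal-zero s x-sums y-sums a b eq with ℕ.<-cmp a b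
      ... | tri≈ _ ≡.refl _ = trans (*-congʳ (-‿inverseʳ (ι a))) (zeroˡ _)
      ... | tri< a<b _ _ with d , ≡.refl ← m<n⇒m+[1+o]≡n a<b with l , l≤s , ≡.refl ← even-gap a d s eq
        = trans (*-congˡ (trans (moment-below a _) (trans (*-congˡ (y-sums l l≤s)) (zeroʳ _)))) (zeroʳ _)
      ... | tri> _ _ b<a with d , ≡.refl ← m<n⇒m+[1+o]≡n b<a with l , l≤s , ≡.refl ← even-gap b d s (≡.trans (ℕ.+-comm b _) eq)
        = trans (*-congˡ (trans (moment-above b _) (trans (*-congˡ (x-sums l l≤s)) (zeroʳ _)))) (zeroʳ _)

-- Complex numbers over the constructive reals.

module ComplexNumbers {c ℓ₁ ℓ₂} (ℝ : RealField c ℓ₁ ℓ₂) where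
  open RealField ℝ hiding (zero)
  open OrderedField ℝ
  open Energy ℝ
  open IntegerCoefficients ℝ-ring using (solve; _:=_; con; _:+_; _:*_; _:-_; :-_)

  ℂ-ring : CommutativeRing c ℓ₁
  ℂ-ring = record
    { Carrier = ℂ
    ; _≈_ = C._≈_ ; _+_ = C._+_ ; _*_ = C._*_ ; -_ = C.-_ ; 0# = C.0# ; 1# = C.1#
    ; isCommutativeRing = record
      { isRing = record
        { +-isAbelianGroup = record
          { isGroup = record
            { isMonoid = record
              { isSemigroup = record
                { isMagma = record
                  { isEquivalence = record
                    { refl = refl , refl
                    ; sym = λ (p , q) → sym p , sym q
                    ; trans = λ (p , q) (r , s) → trans p r , trans q s
                    }
                  ; ∙-cong = λ (p , q) (r , s) → +-cong p r , +-cong q s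
                  }
                ; assoc = λ x y z → +-assoc _ _ _ , +-assoc _ _ _
                }
              ; identity = (λ x → +-identityˡ _ , +-identityˡ _) , (λ x → +-identityʳ _ , +-identityʳ _)
              }
            ; inverse = (λ x → -‿inverseˡ _ , -‿inverseˡ _) , (λ x → -‿inverseʳ _ , -‿inverseʳ _)
            ; ⁻¹-cong = λ (p , q) → -‿cong p , -‿cong q
            }
          ; comm = λ x y → +-comm _ _ , +-comm _ _
          }
        ; *-cong = λ (p , q) (r , s) → +-cong (*-cong p r) (-‿cong (*-cong q s)) , +-cong (*-cong p s) (*-cong q r)
        ; *-assoc = λ x y z →
            solve 6 (λ a b c d e f → (a :* c :- b :* d) :* e :- (a :* d :+ b :* c) :* f
                                  := a :* (c :* e :- d :* f) :- b :* (c :* f :+ d :* e)) refl (re x) (im x) (re y) (im y) (re z) (im z) ,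
            solve 6 (λ a b c d e f → (a :* c :- b :* d) :* f :+ (a :* d :+ b :* c) :* e
                                  := a :* (c :* f :+ d :* e) :+ b :* (c :* e :- d :* f)) refl (re x) (im x) (re y) (im y) (re z) (im z)
        ; *-identity =
            (λ x → solve 2 (λ a b → con (ℤ.+ 1) :* a :- con (ℤ.+ 0) :* b := a) refl (re x) (im x) ,
                   solve 2 (λ a b → con (ℤ.+ 1) :* b :+ con (ℤ.+ 0) :* a := b) refl (re x) (im x)) ,
            (λ x → solve 2 (λ a b → a :* con (ℤ.+ 1) :- b :* con (ℤ.+ 0) := a) refl (re x) (im x) ,
                   solve 2 (λ a b → a :* con (ℤ.+ 0) :+ b :* con (ℤ.+ 1) := b) refl (re x) (im x))
        ; distrib =
            (λ x y z →
              solve 6 (λ a b c d e f → a :* (c :+ e) :- b :* (d :+ f) := (a :* c :- b :* d) :+ (a :* e :- b :* f)) refl (re x) (im x) (re y) (im y) (re z) (im z) ,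
              solve 6 (λ a b c d e f → a :* (d :+ f) :+ b :* (c :+ e) := (a :* d :+ b :* c) :+ (a :* f :+ b :* e)) refl (re x) (im x) (re y) (im y) (re z) (im z)) ,
            (λ x y z →
              solve 6 (λ a b c d e f → (c :+ e) :* a :- (d :+ f) :* b := (c :* a :- d :* b) :+ (e :* a :- f :* b)) refl (re x) (im x) (re y) (im y) (re z) (im z) ,
              solve 6 (λ a b c d e f → (c :+ e) :* b :+ (d :+ f) :* a := (c :* b :+ d :* a) :+ (e :* b :+ f :* a)) refl (re x) (im x) (re y) (im y) (re z) (im z))
        }
      ; *-comm = λ x y →
          solve 4 (λ a b c d → a :* c :- b :* d := c :* a :- d :* b) refl (re x) (im x) (re y) (im y) ,
          solve 4 (λ a b c d → a :* d :+ b :* c := c :* b :+ d :* a) refl (re x) (im x) (re y) (im y)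
      }
    }

  module ℂᵣ = CommutativeRing ℂ-ring
  open Exp semiring using () renaming (_^_ to _^ᵣ_) public
  open Exp ℂᵣ.semiring using (_^_) public
  open SemiringMult ℂᵣ.semiring using () renaming (_×_ to _⋆ᶜ_) public
  module ∑ = SemiringSum semiring
  module ∑ᶜ = SemiringSum ℂᵣ.semiring

  re-sum : ∀ {n} (f : Fin n → ℂ) → re (∑ᶜ.sum f) ≈ ∑.sum (λ j → re (f j))
  re-sum {zero}  f = refl
  re-sum {suc n} f = +-congˡ (re-sum (f ∘ suc))

  im-sum : ∀ {n} (f : Fin n → ℂ) → im (∑ᶜ.sum f) ≈ ∑.sum (λ j → im (f j))
  im-sum {zero}  f = refl
  im-sum {suc n} f = +-congˡ (im-sum (f ∘ suc))

  [_] : Carrier → ℂ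
  [ x ] = x +i 0#

  ι-complex : ∀ n → (n ⋆ᶜ C.1#) C.≈ [ ι n ]
  ι-complex zero    = ℂᵣ.refl
  ι-complex (suc n) = +-congˡ (proj₁ (ι-complex n)) , trans (+-congˡ (proj₂ (ι-complex n))) (+-identityˡ 0#)

  conj : ℂ → ℂ
  conj z = re z +i (- im z)

  conj-^ : ∀ k z → conj z ^ k C.≈ conj (z ^ k)
  conj-^ zero    z = refl , solve 0 (con (ℤ.+ 0) := :- con (ℤ.+ 0)) refl
  conj-^ (suc k) z = ℂᵣ.trans (ℂᵣ.*-cong (ℂᵣ.refl {conj z}) (conj-^ k z))
    ( solve 4 (λ a b c d → a :* c :- (:- b) :* (:- d) := a :* c :- b :* d) refl (re z) (im z) (re (z ^ k)) (im (z ^ k))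
    , solve 4 (λ a b c d → a :* (:- d) :+ (:- b) :* c := :- (a :* d :+ b :* c)) refl (re z) (im z) (re (z ^ k)) (im (z ^ k)))

  conj-sum-^ : ∀ {n} k (z : Fin n → ℂ) → ∑ᶜ.sum (λ j → conj (z j) ^ k) C.≈ conj (∑ᶜ.sum (λ j → z j ^ k))
  conj-sum-^ k z = ℂᵣ.trans (∑ᶜ.sum-cong-≋ λ j → conj-^ k (z j))
    ( trans (re-sum (λ j → conj (z j ^ k))) (sym (re-sum (λ j → z j ^ k)))
    , trans (im-sum (λ j → conj (z j ^ k))) (trans (sum-neg (λ j → im (z j ^ k))) (-‿cong (sym (im-sum (λ j → z j ^ k))))))
    where
    sum-neg : ∀ {n} (f : Fin n → Carrier) → ∑.sum (λ j → - f j) ≈ - ∑.sum f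
    sum-neg {zero}  f = solve 0 (con (ℤ.+ 0) := :- con (ℤ.+ 0)) refl
    sum-neg {suc n} f = trans (+-congˡ (sum-neg (f ∘ suc))) (solve 2 (λ a b → :- a :+ :- b := :- (a :+ b)) refl _ _)

  conj-sum-^-zero : ∀ {n} k (z : Fin n → ℂ) → ∑ᶜ.sum (λ j → z j ^ k) C.≈ C.0# → ∑ᶜ.sum (λ j → conj (z j) ^ k) C.≈ C.0#
  conj-sum-^-zero k z (re≈0 , im≈0) = ℂᵣ.trans (conj-sum-^ k z)
    (re≈0 , trans (-‿cong im≈0) (solve 0 (:- con (ℤ.+ 0) := con (ℤ.+ 0)) refl))

  normSq : ℂ → Carrier
  normSq z = re z * re z + im z * im z

  normSq-cong : ∀ {z w} → z C.≈ w → normSq z ≈ normSq w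
  normSq-cong (p , q) = +-cong (*-cong p p) (*-cong q q)

  normSq-* : ∀ z w → normSq (z C.* w) ≈ normSq z * normSq w
  normSq-* z w = solve 4 (λ a b c d →
    (a :* c :- b :* d) :* (a :* c :- b :* d) :+ (a :* d :+ b :* c) :* (a :* d :+ b :* c)
      := (a :* a :+ b :* b) :* (c :* c :+ d :* d)) refl (re z) (im z) (re w) (im w)

  normSq-^ : ∀ k z → normSq (z ^ k) ≈ normSq z ^ᵣ k
  normSq-^ zero    z = solve 0 (con (ℤ.+ 1) :* con (ℤ.+ 1) :+ con (ℤ.+ 0) :* con (ℤ.+ 0) := con (ℤ.+ 1)) refl
  normSq-^ (suc k) z = trans (normSq-* z (z ^ k)) (*-congˡ (normSq-^ k z))

  normSq-nonneg : ∀ z → 0# ≤ normSq z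
  normSq-nonneg z = +-nonneg (square-nonneg (re z)) (square-nonneg (im z))

  normSq-zero : ∀ {z} → normSq z ≈ 0# → z C.≈ C.0#
  normSq-zero {z} eq = square-zero (part (square-nonneg (re z)) (square-nonneg (im z)) eq)
                     , square-zero (part (square-nonneg (im z)) (square-nonneg (re z)) (trans (+-comm _ _) eq))
    where
    part : ∀ {a b} → 0# ≤ a → 0# ≤ b → a + b ≈ 0# → a ≈ 0#
    part {a} {b} 0≤a 0≤b a+b≈0 = ≤-antisym (≤-by b 0≤b (sym a+b≈0)) 0≤a

  ℂ-zero-product-≤ : ∀ {z w a b} → z C.* w C.≈ C.0# → (z C.≈ C.0# → a ≤ b) → (w C.≈ C.0# → a ≤ b) → a ≤ b
  ℂ-zero-product-≤ {z} {w} zw≈0 f g = zero-product-≤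
    (trans (sym (normSq-* z w)) (trans (normSq-cong zw≈0) (solve 0 (con (ℤ.+ 0) :* con (ℤ.+ 0) :+ con (ℤ.+ 0) :* con (ℤ.+ 0) := con (ℤ.+ 0)) refl)))
    (f ∘ normSq-zero) (g ∘ normSq-zero)

  by-cases-≈ : ∀ {p q} {P : Set p} {Q : Set q} → (∀ {a b} → (P → a ≤ b) → (Q → a ≤ b) → a ≤ b) →
    ∀ {a b} → (P → a ≈ b) → (Q → a ≈ b) → a ≈ b
  by-cases-≈ cases f g = ≤-antisym (cases (≤-reflexive ∘ f) (≤-reflexive ∘ g))
                                   (cases (≤-reflexive ∘ sym ∘ f) (≤-reflexive ∘ sym ∘ g))

  -- For r ≤ 1 the power is at most r, and for 1 ≤ r it is at least r. In either case its being 1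
  -- supplies the missing inequality.
  power-one : ∀ k {r} → 0# ≤ r → r ^ᵣ suc k ≈ 1# → r ≈ 1#
  power-one k {r} 0≤r rᵏ≈1 = by-cases-≈ (≤-cases r 1#)
    (λ r≤1 → ≤-antisym r≤1 (≤-trans (≤-reflexive (sym rᵏ≈1)) (≤-trans (*-monoˡ-≤ 0≤r (below k r≤1)) (≤-reflexive (*-identityʳ r)))))
    (λ 1≤r → ≤-antisym (≤-trans (≤-reflexive (sym (*-identityʳ r))) (≤-trans (*-monoˡ-≤ 0≤r (above k 1≤r)) (≤-reflexive rᵏ≈1))) 1≤r)
    where
    below : ∀ k → r ≤ 1# → r ^ᵣ k ≤ 1#
    below zero    _   = ≤-refl
    below (suc k) r≤1 = ≤-trans (*-monoˡ-≤ 0≤r (below k r≤1)) (≤-trans (≤-reflexive (*-identityʳ r)) r≤1)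
    above : ∀ k → 1# ≤ r → 1# ≤ r ^ᵣ k
    above zero    _   = ≤-refl
    above (suc k) 1≤r = ≤-trans 1≤r (≤-trans (≤-reflexive (sym (*-identityʳ r))) (*-monoˡ-≤ 0≤r (above k 1≤r)))

  abstract
    half : Carrier
    half = proj₁ (reciprocal (ι-pos 1))

    2*half : ι 2 * half ≈ 1#
    2*half = proj₂ (proj₂ (reciprocal (ι-pos 1)))

  module ℂNewton = Newton ℂ-ring

  2*halfᶜ : (C.1# C.+ C.1#) C.* [ half ] C.≈ C.1#
  2*halfᶜ = trans (solve 1 (λ h → (con (ℤ.+ 1) :+ con (ℤ.+ 1)) :* h :- (con (ℤ.+ 0) :+ con (ℤ.+ 0)) :* con (ℤ.+ 0)
                             := (con (ℤ.+ 1) :+ (con (ℤ.+ 1) :+ con (ℤ.+ 0))) :* h) refl half) 2*half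
          , solve 1 (λ h → (con (ℤ.+ 1) :+ con (ℤ.+ 1)) :* con (ℤ.+ 0) :+ (con (ℤ.+ 0) :+ con (ℤ.+ 0)) :* h := con (ℤ.+ 0)) refl half

  -- The number 2ᵏ⁺¹ - 1 is real and at least 1, so it is apart from zero and can be cancelled from
  -- both coordinates.
  2^-1-cancelᶜ : ∀ k x → (ℂNewton.2^ (suc k) C.+ (C.- C.1#)) C.* x C.≈ C.0# → x C.≈ C.0#
  2^-1-cancelᶜ k x (eq-re , eq-im) =
      *-cancel-0 a#0 (trans (sym (trans (+-congˡ (-‿cong (*-congʳ b≈0))) (solve 3 (λ a x y → a :* x :- con (ℤ.+ 0) :* y := a :* x) refl a (re x) (im x)))) eq-re)
    , *-cancel-0 a#0 (trans (sym (trans (+-congˡ (*-congʳ b≈0)) (solve 3 (λ a x y → a :* y :+ con (ℤ.+ 0) :* x := a :* y) refl a (re x) (im x)))) eq-im)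
    where
    a = re (ℂNewton.2^ (suc k)) - 1#
    b = im (ℂNewton.2^ (suc k)) - 0#
    real : ∀ k → im (ℂNewton.2^ k) ≈ 0#
    real zero    = refl
    real (suc k) = trans (+-congʳ (*-congˡ (real k)))
      (solve 1 (λ t → (con (ℤ.+ 1) :+ con (ℤ.+ 1)) :* con (ℤ.+ 0) :+ (con (ℤ.+ 0) :+ con (ℤ.+ 0)) :* t := con (ℤ.+ 0)) refl _)
    double : ∀ k → re (ℂNewton.2^ (suc k)) ≈ re (ℂNewton.2^ k) + re (ℂNewton.2^ k)
    double k = trans (+-congˡ (-‿cong (*-congˡ (real k))))
      (solve 1 (λ t → (con (ℤ.+ 1) :+ con (ℤ.+ 1)) :* t :- (con (ℤ.+ 0) :+ con (ℤ.+ 0)) :* con (ℤ.+ 0) := t :+ t) refl _)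
    large : ∀ k → 1# ≤ re (ℂNewton.2^ k)
    large zero    = ≤-refl
    large (suc k) = ≤-trans (large k) (≤-by (re (ℂNewton.2^ k)) (≤-trans (<⇒≤ 0<1) (large k)) (double k))
    b≈0 : b ≈ 0#
    b≈0 = trans (+-congʳ (real (suc k))) (-‿inverseʳ 0#)
    a#0 : a # 0#
    a#0 = #-sym (<⇒# (<-≤-trans 0<1 (≤-by ((t - 1#) + (t - 1#)) (+-nonneg (0≤y-x (large k)) (0≤y-x (large k)))
      (trans (+-congʳ (double k)) (solve 1 (λ t → let one = con (ℤ.+ 1) in
        t :+ t :- one := one :+ ((t :- one) :+ (t :- one))) refl t)))))
      where t = re (ℂNewton.2^ k)

-- Power sums and imaginary moments of the eigenvalues.

even≢odd : ∀ a b → a ℕ.+ a ≢ suc (b ℕ.+ b)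
even≢odd (suc a) (suc b) eq = even≢odd a b (ℕ.suc-injective (ℕ.suc-injective
  (≡.trans (≡.cong suc (≡.sym (ℕ.+-suc a a))) (≡.trans eq (≡.cong (λ i → suc (suc i)) (ℕ.+-suc b b))))))
even≢odd (suc a) zero    eq with () ← ≡.trans (≡.sym (ℕ.+-suc a a)) (ℕ.suc-injective eq)

module NegativeSpectrum {c ℓ₁ ℓ₂} (ℝ : RealField c ℓ₁ ℓ₂) where
  open RealField ℝ hiding (zero)
  open OrderedField ℝ
  open Energy ℝ
  open ComplexNumbers ℝ
  open IntegerCoefficients ℝ-ring using (solve; _:=_; con; _:+_; _:*_; _:-_; :-_)
  module ℂSolver = IntegerCoefficients ℂ-ring

  -- The factor -i/2 turns z - z̄ into the imaginary part of z, and zz̄ into -|z|²/4.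
  κ : ℂ
  κ = 0# +i (- half)

  open Moments ℂ-ring κ

  -- The eigenvalues of a unicyclic sidigraph on n vertices whose cycle is
  -- negative of length m.
  record NegativeEigenvalues (n m : ℕ) (z : Fin n → ℂ) : Set (c Level.⊔ ℓ₁) where
    field
      m≢0     : m ≢ 0
      m≤n     : m ℕ.≤ n
      factors : ∀ x → x ^ n C.+ x ^ (n ∸ m) C.≈ ℂMat.product (λ j → x C.+ (C.- z j))

    -- Evaluating the factorisation at an eigenvalue gives zⁿ⁻ᵐ(zᵐ + 1) = 0. The power is reduced to
    -- a single factor, which also gives the case n = m the same form.
    root : ∀ j → z j C.* (z j ^ m C.+ C.1#) C.≈ C.0#
    root j = annihilate (n ∸ m) (begin
      w ^ (n ∸ m) C.* (w ^ m C.+ C.1#)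
        ≈⟨ ℂSolver.solve 2 (λ p q → p ℂSolver.:* (q ℂSolver.:+ ℂSolver.con (ℤ.+ 1))
             ℂSolver.:= p ℂSolver.:* q ℂSolver.:+ p) ℂᵣ.refl (w ^ (n ∸ m)) (w ^ m) ⟩
      w ^ (n ∸ m) C.* w ^ m C.+ w ^ (n ∸ m)
        ≈⟨ ℂᵣ.+-congʳ {w ^ (n ∸ m)} (ℂExp.^-homo-* w (n ∸ m) m) ⟨
      w ^ ((n ∸ m) ℕ.+ m) C.+ w ^ (n ∸ m)
        ≡⟨ ≡.cong (λ k → w ^ k C.+ w ^ (n ∸ m)) (ℕ.m∸n+n≡m m≤n) ⟩
      w ^ n C.+ w ^ (n ∸ m)
        ≈⟨ factors w ⟩
      ℂMat.product (λ i → w C.+ (C.- z i))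
        ≈⟨ Determinant.product-zero ℂ-ring (λ i → w C.+ (C.- z i)) j (ℂᵣ.-‿inverseʳ w) ⟩
      C.0# ∎)
      where
      open SetoidReasoning ℂᵣ.setoid
      module ℂExp = Exp ℂᵣ.semiring
      w = z j
      u = w ^ m C.+ C.1#
      annihilate : ∀ i → w ^ i C.* u C.≈ C.0# → w C.* u C.≈ C.0#
      annihilate zero    u≈0  = ℂᵣ.trans (ℂᵣ.*-congˡ {w} (ℂᵣ.trans (ℂᵣ.sym (ℂᵣ.*-identityˡ u)) u≈0)) (ℂᵣ.zeroʳ w)
      annihilate (suc i) eq   = part re proj₁ , part im proj₂
        where
        part : (a : ℂ → Carrier) → (∀ {p q} → p C.≈ q → a p ≈ a q) → a (w C.* u) ≈ a C.0#
        part a proj = by-cases-≈ (ℂ-zero-product-≤ (ℂᵣ.trans (ℂᵣ.sym (ℂᵣ.*-assoc w (w ^ i) u)) eq))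
          (λ w≈0 → proj (ℂᵣ.trans (ℂᵣ.*-congʳ {u} w≈0) (ℂᵣ.zeroˡ u)))
          (λ wⁱu≈0 → proj (annihilate i wⁱu≈0))

    r y Y : Fin n → Carrier
    r j = normSq (z j)
    y j = im (z j)
    Y j = y j * y j

    root-cases : ∀ j {a b} → (z j C.≈ C.0# → a ≤ b) →
      (r j ≈ 1# × z j ^ m C.≈ (C.- C.1#) → a ≤ b) → a ≤ b
    root-cases j f g = ℂ-zero-product-≤ (root j) f λ u≈0 →
      let zᵐ≈-1 = ℂᵣ.trans (ℂSolver.solve 1 (λ p → p ℂSolver.:= p ℂSolver.:+ ℂSolver.con (ℤ.+ 1) ℂSolver.:- ℂSolver.con (ℤ.+ 1)) ℂᵣ.refl (z j ^ m))
                           (ℂᵣ.trans (ℂᵣ.+-congʳ {C.- C.1#} u≈0) (ℂᵣ.+-identityˡ (C.- C.1#)))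
      in g (unit zᵐ≈-1 , zᵐ≈-1)
      where
      at : ∀ k → k ≡ m → normSq (z j) ^ᵣ k ≈ 1# → r j ≈ 1#
      at zero    0≡m _  = contradiction (≡.sym 0≡m) m≢0
      at (suc k) _   eq = power-one k (normSq-nonneg (z j)) eq
      unit : z j ^ m C.≈ (C.- C.1#) → r j ≈ 1#
      unit eq = at m ≡.refl (trans (sym (normSq-^ m (z j))) (trans (normSq-cong eq)
        (solve 0 (:- con (ℤ.+ 1) :* :- con (ℤ.+ 1) :+ :- con (ℤ.+ 0) :* :- con (ℤ.+ 0) := con (ℤ.+ 1)) refl)))

    root-cases-≈ : ∀ j {a b} → (z j C.≈ C.0# → a ≈ b) →
      (r j ≈ 1# × z j ^ m C.≈ (C.- C.1#) → a ≈ b) → a ≈ b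
    root-cases-≈ j = by-cases-≈ (root-cases j)

    root-cases-C : ∀ j {a b} → (z j C.≈ C.0# → a C.≈ b) →
      (r j ≈ 1# × z j ^ m C.≈ (C.- C.1#) → a C.≈ b) → a C.≈ b
    root-cases-C j f g = root-cases-≈ j (proj₁ ∘ f) (proj₁ ∘ g) , root-cases-≈ j (proj₂ ∘ f) (proj₂ ∘ g)

    z-conj-z : ∀ j → z j C.* conj (z j) C.≈ [ r j ]
    z-conj-z j = solve 2 (λ a b → a :* a :- b :* (:- b) := a :* a :+ b :* b) refl (re (z j)) (im (z j))
               , solve 2 (λ a b → a :* (:- b) :+ b :* a := con (ℤ.+ 0)) refl (re (z j)) (im (z j))

    rz : ∀ j → z j C.* conj (z j) C.* z j C.≈ z j
    rz j = root-cases-C j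
      (λ z≈0 → ℂᵣ.trans (ℂᵣ.*-congˡ {z j C.* conj (z j)} z≈0) (ℂᵣ.trans (ℂᵣ.zeroʳ (z j C.* conj (z j))) (ℂᵣ.sym z≈0)))
      (λ (r≈1 , _) → ℂᵣ.trans (ℂᵣ.*-congʳ {z j} (ℂᵣ.trans (z-conj-z j) (r≈1 , refl))) (ℂᵣ.*-identityˡ (z j)))

    rz̄ : ∀ j → conj (z j) C.* z j C.* conj (z j) C.≈ conj (z j)
    rz̄ j = root-cases-C j
      (λ (re≈0 , im≈0) → let z̄≈0 = re≈0 , trans (-‿cong im≈0) (solve 0 (:- con (ℤ.+ 0) := con (ℤ.+ 0)) refl) in
        ℂᵣ.trans (ℂᵣ.*-congˡ {conj (z j) C.* z j} z̄≈0) (ℂᵣ.trans (ℂᵣ.zeroʳ (conj (z j) C.* z j)) (ℂᵣ.sym z̄≈0)))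
      (λ (r≈1 , _) → ℂᵣ.trans (ℂᵣ.*-congʳ {conj (z j)} (ℂᵣ.trans (ℂᵣ.*-comm (conj (z j)) (z j)) (ℂᵣ.trans (z-conj-z j) (r≈1 , refl))))
        (ℂᵣ.*-identityˡ (conj (z j))))

    normSq-0 : ∀ {w} → w C.≈ C.0# → normSq w ≈ 0#
    normSq-0 w≈0 = trans (normSq-cong w≈0) (solve 0 (con (ℤ.+ 0) :* con (ℤ.+ 0) :+ con (ℤ.+ 0) :* con (ℤ.+ 0) := con (ℤ.+ 0)) refl)

    rY : ∀ j → r j * Y j ≈ Y j
    rY j = root-cases-≈ j
      (λ z≈0 → trans (*-congˡ (*-congʳ (proj₂ z≈0))) (trans (solve 2 (λ r y → r :* (con (ℤ.+ 0) :* y) := con (ℤ.+ 0) :* y) refl (r j) (y j))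
                 (*-congʳ (sym (proj₂ z≈0)))))
      (λ (r≈1 , _) → trans (*-congʳ r≈1) (*-identityˡ _))

    -- In both cases of `root-cases`, `r j` is minus the real part of `z j ^ m`; hence the power sum
    -- of exponent m counts the nonzero eigenvalues.
    sum-r : ∑.sum r ≈ ι m
    sum-r = begin
      ∑.sum r
        ≈⟨ ∑.sum-cong-≋ (λ j → root-cases-≈ j
             (λ z≈0 → trans (normSq-0 z≈0) (trans (sym (*-zero (z^m≈0 j z≈0 m ≡.refl))) refl))
             (λ (r≈1 , zᵐ≈-1) → trans r≈1 (trans (solve 0 (con (ℤ.+ 1) := :- con (ℤ.+ 1) :* :- con (ℤ.+ 1)) refl) (*-congˡ (sym (proj₁ zᵐ≈-1)))))) ⟩
      ∑.sum (λ j → - 1# * re (z j ^ m))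
        ≈⟨ ∑.*-distribˡ-sum (- 1#) (λ j → re (z j ^ m)) ⟨
      - 1# * ∑.sum (λ j → re (z j ^ m))
        ≈⟨ *-congˡ (re-sum (λ j → z j ^ m)) ⟨
      - 1# * re (∑ᶜ.sum (λ j → z j ^ m))
        ≈⟨ *-congˡ (trans (proj₁ powerSum-m) (-‿cong (proj₁ (ι-complex m)))) ⟩
      - 1# * - ι m
        ≈⟨ solve 1 (λ t → :- con (ℤ.+ 1) :* :- t := t) refl (ι m) ⟩
      ι m ∎
      where
      open SetoidReasoning setoid
      powerSum-m = ℂNewton.powerSum-m [ half ] 2*halfᶜ 2^-1-cancelᶜ m≢0 m≤n z factors
      *-zero : ∀ {a} → a ≈ 0# → - 1# * a ≈ 0#
      *-zero a≈0 = trans (*-congˡ a≈0) (zeroʳ _)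
      z^m≈0 : ∀ j → z j C.≈ C.0# → ∀ k → k ≡ m → re (z j ^ k) ≈ 0#
      z^m≈0 j z≈0 zero    0≡m = contradiction (≡.sym 0≡m) m≢0
      z^m≈0 j z≈0 (suc k) _   = proj₁ (ℂᵣ.trans (ℂᵣ.*-congʳ {z j ^ k} z≈0) (ℂᵣ.zeroˡ (z j ^ k)))

    sum-zz̄ : ∑ᶜ.sum (λ j → z j C.* conj (z j)) C.≈ [ ι m ]
    sum-zz̄ = trans (re-sum (λ j → z j C.* conj (z j))) (trans (∑.sum-cong-≋ (λ j → proj₁ (z-conj-z j))) sum-r)
           , trans (im-sum (λ j → z j C.* conj (z j))) (trans (∑.sum-cong-≋ {n} {_} {λ _ → 0#} (λ j → proj₂ (z-conj-z j))) (∑.sum-replicate-zero n))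

    powerSum : ℕ → ℂ
    powerSum k = ∑ᶜ.sum (λ j → z j ^ k)

    powerSum-low : ∀ k → k ≢ 0 → k ℕ.< m → powerSum k C.≈ C.0#
    powerSum-low = ℂNewton.powerSum-low [ half ] 2*halfᶜ 2^-1-cancelᶜ m≢0 m≤n z factors

    powerSum-m : powerSum m C.≈ [ - ι m ]
    powerSum-m = ℂᵣ.trans (ℂNewton.powerSum-m [ half ] 2*halfᶜ 2^-1-cancelᶜ m≢0 m≤n z factors)
      (-‿cong (proj₁ (ι-complex m)) , trans (-‿cong (proj₂ (ι-complex m))) (solve 0 (:- con (ℤ.+ 0) := con (ℤ.+ 0)) refl))

    -- Every zᵐ is -1 except at zero eigenvalues, which contribute nothing because the exponent
    -- `suc k` is positive.
    powerSum-periodic : ∀ k → powerSum (suc k ℕ.+ m) C.≈ (C.- C.1#) C.* powerSum (suc k)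
    powerSum-periodic k = ℂᵣ.trans (∑ᶜ.sum-cong-≋ pointwise) (ℂᵣ.sym (∑ᶜ.*-distribˡ-sum (C.- C.1#) (λ j → z j ^ suc k)))
      where
      module ℂExp = Exp ℂᵣ.semiring
      pointwise : ∀ j → z j ^ (suc k ℕ.+ m) C.≈ (C.- C.1#) C.* z j ^ suc k
      pointwise j = root-cases-C j
        (λ z≈0 → ℂᵣ.trans (vanish z≈0 (z j ^ (k ℕ.+ m))) (ℂᵣ.sym (ℂᵣ.trans (ℂᵣ.*-congˡ {C.- C.1#} (vanish z≈0 (z j ^ k))) (ℂᵣ.zeroʳ (C.- C.1#)))))
        (λ (_ , zᵐ≈-1) → ℂᵣ.trans (ℂExp.^-homo-* (z j) (suc k) m)
          (ℂᵣ.trans (ℂᵣ.*-congˡ {z j ^ suc k} zᵐ≈-1) (ℂᵣ.*-comm (z j ^ suc k) (C.- C.1#))))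
        where
        vanish : z j C.≈ C.0# → ∀ t → z j C.* t C.≈ C.0#
        vanish z≈0 t = ℂᵣ.trans (ℂᵣ.*-congʳ {t} z≈0) (ℂᵣ.zeroˡ t)

    -- The weight `r j` discards the zero eigenvalues, so that already `M 0` is `m` and not `n`.
    M : ℕ → Carrier
    M k = ∑.sum λ j → r j * Y j ^ᵣ k

    M-zero : M 0 ≈ ι m
    M-zero = trans (∑.sum-cong-≋ λ j → *-identityʳ (r j)) sum-r

    EvenSumsVanish : ℕ → Set ℓ₁
    EvenSumsVanish K = ∀ l → suc l ℕ.≤ K → powerSum (suc l ℕ.+ suc l) C.≈ C.0#

    u-v : ∀ j → κ C.* z j C.+ (C.- (κ C.* conj (z j))) C.≈ [ y j ]
    u-v j = trans (solve 3 (λ h a b → (con (ℤ.+ 0) :* a :- :- h :* b) :- (con (ℤ.+ 0) :* a :- :- h :* :- b)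
                              := (con (ℤ.+ 1) :+ (con (ℤ.+ 1) :+ con (ℤ.+ 0))) :* h :* b) refl half (re (z j)) (y j))
                  (trans (*-congʳ 2*half) (*-identityˡ _))
          , solve 3 (λ h a b → (con (ℤ.+ 0) :* b :+ :- h :* a) :- (con (ℤ.+ 0) :* :- b :+ :- h :* a)
                              := con (ℤ.+ 0)) refl half (re (z j)) (y j)

    u-v-power : ∀ k j → (κ C.* z j C.+ (C.- (κ C.* conj (z j)))) ^ (k ℕ.+ k) C.≈ [ Y j ^ᵣ k ]
    u-v-power zero    j = ℂᵣ.refl
    u-v-power (suc k) j = ℂᵣ.trans (ℂᵣ.reflexive (≡.cong (λ i → d ^ suc i) (ℕ.+-suc k k)))
      (ℂᵣ.trans (ℂᵣ.*-cong (u-v j) (ℂᵣ.*-cong (u-v j) (u-v-power k j)))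
        ( solve 2 (λ y p → y :* (y :* p :- con (ℤ.+ 0) :* con (ℤ.+ 0)) :- con (ℤ.+ 0) :* (y :* con (ℤ.+ 0) :+ con (ℤ.+ 0) :* p)
                     := (y :* y) :* p) refl (y j) (Y j ^ᵣ k)
        , solve 2 (λ y p → y :* (y :* con (ℤ.+ 0) :+ con (ℤ.+ 0) :* p) :+ con (ℤ.+ 0) :* (y :* p :- con (ℤ.+ 0) :* con (ℤ.+ 0))
                     := con (ℤ.+ 0)) refl (y j) (Y j ^ᵣ k)))
      where d = κ C.* z j C.+ (C.- (κ C.* conj (z j)))

    moment₁₁ : ∀ k → re (moment z (conj ∘ z) (k ℕ.+ k) 1 1) ≈ - (half * half) * M k
    moment₁₁ k = trans (proj₁ (∑ᶜ.sum-cong-≋ λ j →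
        ℂᵣ.*-congˡ {(κ C.* z j) ^ 1 C.* (κ C.* conj (z j)) ^ 1} (u-v-power k j)))
      (trans (re-sum (λ j → (κ C.* z j) ^ 1 C.* (κ C.* conj (z j)) ^ 1 C.* [ Y j ^ᵣ k ]))
        (trans (∑.sum-cong-≋ λ j → solve 4 (λ h a b p →
            let o = con (ℤ.+ 0) ; i = con (ℤ.+ 1)
                ur = o :* a :- :- h :* b ; ui = o :* b :+ :- h :* a
                vr = o :* a :- :- h :* :- b ; vi = o :* :- b :+ :- h :* a
                ur′ = ur :* i :- ui :* o ; ui′ = ur :* o :+ ui :* i
                vr′ = vr :* i :- vi :* o ; vi′ = vr :* o :+ vi :* i
            in (ur′ :* vr′ :- ui′ :* vi′) :* p :- (ur′ :* vi′ :+ ui′ :* vr′) :* o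
                 := :- (h :* h) :* ((a :* a :+ b :* b) :* p)) refl half (re (z j)) (y j) (Y j ^ᵣ k))
          (sym (∑.*-distribˡ-sum (- (half * half)) (λ j → r j * Y j ^ᵣ k)))))

    -- For a positive power of `Y j` the weight `r j` can be inserted by `rY`; at exponent zero this
    -- would fail for zero eigenvalues.
    moment₀₀ : ∀ k → re (moment z (conj ∘ z) (suc k ℕ.+ suc k) 0 0) ≈ M (suc k)
    moment₀₀ k = trans (proj₁ (∑ᶜ.sum-cong-≋ λ j → ℂᵣ.*-congˡ {C.1# C.* C.1#} (u-v-power (suc k) j)))
      (trans (re-sum (λ j → C.1# C.* C.1# C.* [ Y j ^ᵣ suc k ]))
        (∑.sum-cong-≋ λ j → trans
          (solve 1 (λ p → let o = con (ℤ.+ 0) ; i = con (ℤ.+ 1) in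
             (i :* i :- o :* o) :* p :- (i :* o :+ o :* i) :* o := p) refl (Y j ^ᵣ suc k))
          (trans (*-congʳ (sym (rY j))) (*-assoc (r j) (Y j) _))))

    -- This is the real part of `euler-central`: uv = -r/4 cancels the factor -4, and what remains
    -- is the recurrence of `w-rec`.
    M-recurrence : ∀ K → EvenSumsVanish K → ∀ k → suc k ℕ.≤ K →
      (1# + (1# + (ι k + ι k))) * M (suc k) ≈ (1# + (ι k + ι k)) * M k
    M-recurrence K vanish k k<K = begin
      (1# + (1# + (ι k + ι k))) * M (suc k)
        ≈⟨ *-cong (+-congˡ (+-congˡ (×-homo-+ 1# k k))) (moment₀₀ k) ⟨
      (1# + (1# + ι (k ℕ.+ k))) * re (moment z (conj ∘ z) (suc k ℕ.+ suc k) 0 0)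
        ≈⟨ real-scale (suc (suc (k ℕ.+ k))) (moment z (conj ∘ z) (suc k ℕ.+ suc k) 0 0) ⟨
      re ((suc (suc (k ℕ.+ k)) ⋆ᶜ C.1#) C.* moment z (conj ∘ z) (suc k ℕ.+ suc k) 0 0)
        ≡⟨ ≡.cong (λ i → re ((suc (suc (k ℕ.+ k)) ⋆ᶜ C.1#) C.* moment z (conj ∘ z) (suc i) 0 0)) (ℕ.+-suc k k) ⟩
      re ((suc (suc (k ℕ.+ k)) ⋆ᶜ C.1#) C.* moment z (conj ∘ z) (suc (suc (k ℕ.+ k))) 0 0)
        ≈⟨ proj₁ (euler-central z (conj ∘ z) (suc k ℕ.+ suc k)
             (off-diagonal-zero z (conj ∘ z) rz rz̄ (suc k)
               (λ l l≤ → vanish l (ℕ.≤-trans l≤ k<K))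
               (λ l l≤ → conj-sum-^-zero (suc l ℕ.+ suc l) z (vanish l (ℕ.≤-trans l≤ k<K))))
             (k ℕ.+ k) (≡.cong suc (≡.sym (ℕ.+-suc k k)))) ⟩
      - re (four C.* (((suc (k ℕ.+ k)) ⋆ᶜ C.1#) C.* moment z (conj ∘ z) (k ℕ.+ k) 1 1))
        ≈⟨ -‿cong (trans
             (solve 3 (λ f a b → let o = con (ℤ.+ 0) in f :* a :- (o :+ o :+ o :+ o) :* b := f :* a) refl (re four) _
               (im (((suc (k ℕ.+ k)) ⋆ᶜ C.1#) C.* moment z (conj ∘ z) (k ℕ.+ k) 1 1)))
             (*-congˡ (real-scale (suc (k ℕ.+ k)) (moment z (conj ∘ z) (k ℕ.+ k) 1 1)))) ⟩
      - (re four * (ι (suc (k ℕ.+ k)) * re (moment z (conj ∘ z) (k ℕ.+ k) 1 1)))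
        ≈⟨ -‿cong (*-congˡ (*-cong (+-congˡ (×-homo-+ 1# k k)) (moment₁₁ k))) ⟩
      - (re four * ((1# + (ι k + ι k)) * (- (half * half) * M k)))
        ≈⟨ solve 3 (λ h t m → let i = con (ℤ.+ 1) ; two = i :+ (i :+ con (ℤ.+ 0)) in
             :- ((i :+ i :+ i :+ i) :* (t :* (:- (h :* h) :* m))) := (two :* h) :* (two :* h) :* (t :* m)) refl half (1# + (ι k + ι k)) (M k) ⟩
      (ι 2 * half) * (ι 2 * half) * ((1# + (ι k + ι k)) * M k)
        ≈⟨ *-congʳ (*-cong 2*half 2*half) ⟩
      1# * 1# * ((1# + (ι k + ι k)) * M k)
        ≈⟨ solve 1 (λ t → con (ℤ.+ 1) :* con (ℤ.+ 1) :* t := t) refl _ ⟩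
      (1# + (ι k + ι k)) * M k ∎
      where
      open SetoidReasoning setoid
      four = C.1# C.+ C.1# C.+ C.1# C.+ C.1#
      real-scale : ∀ i w → re ((i ⋆ᶜ C.1#) C.* w) ≈ ι i * re w
      real-scale i w = trans (+-cong (*-congʳ (proj₁ (ι-complex i))) (-‿cong (*-congʳ (proj₂ (ι-complex i)))))
        (solve 3 (λ i a b → i :* a :- con (ℤ.+ 0) :* b := i :* a) refl (ι i) (re w) (im w))

    evenSums-even : ∀ K → K ℕ.+ K ℕ.< m → EvenSumsVanish K
    evenSums-even K 2K<m l l<K = powerSum-low (suc l ℕ.+ suc l) (λ ()) (ℕ.≤-<-trans (ℕ.+-mono-≤ l<K l<K) 2K<m)

    -- An even exponent below 2m is not m. If it exceeds m, antiperiodicity moves it to a positive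
    -- exponent below m.
    evenSums-odd : ∀ h → m ≡ suc (h ℕ.+ h) → ∀ K → K ℕ.< m → EvenSumsVanish K
    evenSums-odd h m≡ K K<m l l<K with ℕ.<-cmp (suc l ℕ.+ suc l) m
    ... | tri< 2l<m _ _ = powerSum-low (suc l ℕ.+ suc l) (λ ()) 2l<m
    ... | tri≈ _ 2l≡m _ = contradiction (≡.trans 2l≡m m≡) (even≢odd (suc l) h)
    ... | tri> _ _ m<2l with o , m+o≡ ← m<n⇒m+[1+o]≡n m<2l =
      ℂᵣ.trans (ℂᵣ.reflexive (≡.cong powerSum (≡.trans (≡.sym m+o≡) (ℕ.+-comm m (suc o)))))
        (ℂᵣ.trans (powerSum-periodic o) (ℂᵣ.trans (ℂᵣ.*-congˡ {C.- C.1#} (powerSum-low (suc o) (λ ()) o<m)) (ℂᵣ.zeroʳ (C.- C.1#))))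
      where
      o<m : suc o ℕ.< m
      o<m = ℕ.+-cancelˡ-< m (suc o) m (≡.subst (ℕ._< m ℕ.+ m) (≡.sym m+o≡)
              (ℕ.+-mono-< (ℕ.≤-<-trans l<K K<m) (ℕ.≤-<-trans l<K K<m)))

-- Polynomial bounds for the square root of 1 - Y.

module SquareRootSeries {c ℓ₁ ℓ₂} (ℝ : RealField c ℓ₁ ℓ₂) where
  open RealField ℝ hiding (zero)
  open OrderedField ℝ
  open Exp semiring using (_^_)
  open IntegerCoefficients ℝ-ring using (Polynomial; solve; _:=_; con; _:+_; _:*_; _:-_; :-_)

  private
    one two : ∀ {n} → Polynomial n
    one = con (ℤ.+ 1)
    two = one :+ one

  -- The solver verifies that a difference of two sides is a multiple of the
  -- difference of the sides of a known equation.
  modulo : ∀ {a b l r} d → l ≈ r → a ≈ b + d * (l - r) → a ≈ b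
  modulo {l = l} {r} d l≈r eq = trans eq (trans (+-congˡ (trans
    (*-congˡ (trans (+-congʳ l≈r) (-‿inverseʳ r))) (zeroʳ d))) (+-identityʳ _))

  odd even : ℕ → Carrier
  odd k  = 1# + (ι k + ι k)
  even k = 1# + odd k

  odd-pos : ∀ k → 0# < odd k
  odd-pos k = <-≤-trans 0<1 (≤-by (ι k + ι k) (+-nonneg (ι-nonneg k) (ι-nonneg k)) refl)

  even-pos : ∀ k → 0# < even k
  even-pos k = +-pos 0<1 (odd-pos k)

  -- w k = (2k choose k) / 4ᵏ is the coefficient of Yᵏ in (1 − Y)^(−1/2), and also
  -- the mean value of sin²ᵏ.
  abstract
    w : ℕ → Carrier
    w zero    = 1#
    w (suc k) = w k * odd k * proj₁ (reciprocal (even-pos k))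

    w-zero : w 0 ≈ 1#
    w-zero = refl

    w-rec : ∀ k → even k * w (suc k) ≈ odd k * w k
    w-rec k = modulo (w k * odd k) (proj₂ (proj₂ (reciprocal (even-pos k))))
      (solve 4 (λ e w o i → e :* (w :* o :* i) := o :* w :+ w :* o :* (e :* i :- one)) refl (even k) (w k) (odd k) _)

    w-pos : ∀ k → 0# < w k
    w-pos zero    = 0<1
    w-pos (suc k) = *-pos (*-pos (w-pos k) (odd-pos k)) (proj₁ (proj₂ (reciprocal (even-pos k))))

  w-nonneg : ∀ k → 0# ≤ w k
  w-nonneg k = <⇒≤ (w-pos k)

  abstract
    -- 1 / (k + 1)
    recip : ℕ → Carrier
    recip k = proj₁ (reciprocal (ι-pos k))

    recip-pos : ∀ k → 0# < recip k
    recip-pos k = proj₁ (proj₂ (reciprocal (ι-pos k)))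

    recip-inverse : ∀ k → ι (suc k) * recip k ≈ 1#
    recip-inverse k = proj₂ (proj₂ (reciprocal (ι-pos k)))

  recip-nonneg : ∀ k → 0# ≤ recip k
  recip-nonneg k = <⇒≤ (recip-pos k)

  recip-+ : ∀ i j → (1# + (ι i + ι j)) * recip (i ℕ.+ j) ≈ 1#
  recip-+ i j = trans (*-congʳ (+-congˡ (sym (×-homo-+ 1# i j)))) (recip-inverse (i ℕ.+ j))

  power-nonneg : ∀ {x} → 0# ≤ x → ∀ k → 0# ≤ x ^ k
  power-nonneg 0≤x zero    = <⇒≤ 0<1
  power-nonneg 0≤x (suc k) = *-nonneg 0≤x (power-nonneg 0≤x k)

  module _ (Y : Carrier) where

    partialSum : ℕ → Carrier
    partialSum zero    = 0#
    partialSum (suc J) = partialSum J + w J * Y ^ J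

    -- Multiplied by Yⁱ⁺¹, this is the integral of tⁱ R(t) from 0 to Y, with R = `partialSum`. It
    -- arises because the derivative of (1 - Y) R² is minus a constant times Yᵏ R, by the recurrence
    -- of `w`; integrating gives the remainder of `partialSum-square`.
    weightedSum : ℕ → ℕ → Carrier
    weightedSum i zero    = 0#
    weightedSum i (suc J) = weightedSum i J + recip (i ℕ.+ J) * (w J * Y ^ J)

    -- Integration by parts for that integral, stated without calculus: it comes from
    -- differentiating tᴷ (1 - t) R(t) and using the differential equation of the truncated series,
    -- whose boundary term is the last summand.
    weightedSum-shift : ∀ i J → let K = ι (suc i) in
      (K + K) * weightedSum i J ≈
      (1# + 1#) * (1# - Y) * partialSum J + (1# + (K + K)) * Y * weightedSum (suc i) J
        + (ι J + ι J) * recip (i ℕ.+ J) * (w J * Y ^ J)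
    weightedSum-shift i zero = solve 4 (λ k y r p → let o = con (ℤ.+ 0) in
      (k :+ k) :* o := two :* (one :- y) :* o :+ (one :+ (k :+ k)) :* y :* o :+ (o :+ o) :* r :* p) refl (ι (suc i)) Y (recip (i ℕ.+ 0)) (w 0 * Y ^ 0)
    weightedSum-shift i (suc J) = begin
      (K + K) * (weightedSum i J + ρ₀ * (W * P))
        ≈⟨ modulo 1# (weightedSum-shift i J) (modulo ((1# + 1#) * (W * P)) (recip-+ i J)
           (modulo (- ((1# + 1#) * Y * (W * P))) (recip-+ (suc i) J)
           (modulo (- (ρ₁ * Y * P)) (w-rec J)
           (solve 11 (λ y i j b b⁺ r ρ₀ ρ₁ w w′ p →
              let k = one :+ i ; od = one :+ (j :+ j) in
              (k :+ k) :* (b :+ ρ₀ :* (w :* p)) :=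
              two :* (one :- y) :* (r :+ w :* p) :+ (one :+ (k :+ k)) :* y :* (b⁺ :+ ρ₁ :* (w :* p))
                :+ ((one :+ j) :+ (one :+ j)) :* ρ₁ :* (w′ :* (y :* p))
                :+ one :* ((k :+ k) :* b :- (two :* (one :- y) :* r :+ (one :+ (k :+ k)) :* y :* b⁺ :+ (j :+ j) :* ρ₀ :* (w :* p)))
                :+ (two :* (w :* p)) :* ((one :+ (i :+ j)) :* ρ₀ :- one)
                :+ (:- (two :* y :* (w :* p))) :* ((one :+ (k :+ j)) :* ρ₁ :- one)
                :+ (:- (ρ₁ :* y :* p)) :* ((one :+ od) :* w′ :- od :* w))
             refl Y (ι i) (ι J) (weightedSum i J) (weightedSum (suc i) J) (partialSum J) ρ₀ ρ₁ W (w (suc J)) P)))) ⟩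
      (1# + 1#) * (1# - Y) * (partialSum J + W * P) + (1# + (K + K)) * Y * (weightedSum (suc i) J + ρ₁ * (W * P))
        + (ι (suc J) + ι (suc J)) * ρ₁ * (w (suc J) * (Y * P))
        ≡⟨ ≡.cong (λ k → (1# + 1#) * (1# - Y) * (partialSum J + W * P) + (1# + (K + K)) * Y * (weightedSum (suc i) J + ρ₁ * (W * P))
             + (ι (suc J) + ι (suc J)) * recip k * (w (suc J) * (Y * P))) (ℕ.+-suc i J) ⟨
      (1# + 1#) * (1# - Y) * partialSum (suc J) + (1# + (K + K)) * Y * weightedSum (suc i) (suc J)
        + (ι (suc J) + ι (suc J)) * recip (i ℕ.+ suc J) * (w (suc J) * Y ^ suc J) ∎
      where
      open SetoidReasoning setoid
      K = ι (suc i)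
      W = w J
      P = Y ^ J
      ρ₀ = recip (i ℕ.+ J)
      ρ₁ = recip (suc i ℕ.+ J)

    -- (1 − Y) R² differs from 1 by Yᴷ times an explicit polynomial with
    -- nonnegative coefficients; K = k + 1.
    partialSum-square : ∀ k → 1# ≈ (1# - Y) * (partialSum (suc k) * partialSum (suc k))
      + Y ^ suc k * (odd k * w k * weightedSum k (suc k))
    partialSum-square zero = modulo (- Y) (recip-+ 0 0) (modulo (- ((1# - Y) * (w 0 + 1#) + Y * recip 0 * (w 0 + 1#))) w-zero
      (solve 3 (λ y ρ w → let o = con (ℤ.+ 0) ; r = o :+ w :* one in
        one := (one :- y) :* (r :* r) :+ y :* one :* ((one :+ (o :+ o)) :* w :* (o :+ ρ :* (w :* one)))
          :+ (:- y) :* ((one :+ (o :+ o)) :* ρ :- one)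
          :+ (:- ((one :- y) :* (w :+ one) :+ y :* ρ :* (w :+ one))) :* (w :- one)) refl Y (recip 0) (w 0)))
    partialSum-square (suc k) =
      modulo 1# (partialSum-square k)
      (modulo (P * (w (suc k))) (weightedSum-shift k (suc k))
      (modulo (- (P * b)) (w-rec k)
      (modulo (P * P * W * W) (recip-+ k (suc k))
      (modulo (- (P * P * Y * W * W)) (recip-+ (suc k) (suc k))
      (solve 10 (λ y k r p b b⁺ ρ₀ ρ₁ w w′ →
         let k′ = one :+ k ; od = one :+ (k :+ k) ; od′ = one :+ (k′ :+ k′) in
         one := (one :- y) :* ((r :+ w′ :* p) :* (r :+ w′ :* p)) :+ y :* p :* (od′ :* w′ :* (b⁺ :+ ρ₁ :* (w′ :* p)))
           :+ one :* (one :- ((one :- y) :* (r :* r) :+ p :* (od :* w :* b)))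
           :+ (p :* w′) :* ((k′ :+ k′) :* b :- (two :* (one :- y) :* r :+ (one :+ (k′ :+ k′)) :* y :* b⁺ :+ (k′ :+ k′) :* ρ₀ :* (w′ :* p)))
           :+ (:- (p :* b)) :* ((one :+ od) :* w′ :- od :* w)
           :+ (p :* p :* w′ :* w′) :* ((one :+ (k :+ k′)) :* ρ₀ :- one)
           :+ (:- (p :* p :* y :* w′ :* w′)) :* ((one :+ (k′ :+ k′)) :* ρ₁ :- one))
         refl Y (ι k) R P b b⁺ ρ₀ ρ₁ (w k) W)))))
      where
      R = partialSum (suc k)
      W = w (suc k)
      P = Y ^ suc k
      b = weightedSum k (suc k)
      b⁺ = weightedSum (suc k) (suc k)
      ρ₀ = recip (k ℕ.+ suc k)
      ρ₁ = recip (suc k ℕ.+ suc k)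

    module _ (0≤Y : 0# ≤ Y) where

      term-nonneg : ∀ k → 0# ≤ w k * Y ^ k
      term-nonneg k = *-nonneg (w-nonneg k) (power-nonneg 0≤Y k)

      partialSum-nonneg : ∀ J → 0# ≤ partialSum J
      partialSum-nonneg zero    = ≤-refl
      partialSum-nonneg (suc J) = +-nonneg (partialSum-nonneg J) (term-nonneg J)

      weightedSum-nonneg : ∀ i J → 0# ≤ weightedSum i J
      weightedSum-nonneg i zero    = ≤-refl
      weightedSum-nonneg i (suc J) = +-nonneg (weightedSum-nonneg i J) (*-nonneg (recip-nonneg (i ℕ.+ J)) (term-nonneg J))

      -- It holds termwise, because 2i + 1 is at most 2(i + j + 1).
      weightedSum-bound : ∀ i J → odd i * weightedSum i J ≤ (1# + 1#) * partialSum J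
      weightedSum-bound i zero    = ≤-reflexive (trans (zeroʳ _) (sym (zeroʳ _)))
      weightedSum-bound i (suc J) = ≤-trans (≤-reflexive (distribˡ _ _ _))
        (≤-trans (+-mono-≤ (weightedSum-bound i J) last) (≤-reflexive (sym (distribˡ _ _ _))))
        where
        ρ = recip (i ℕ.+ J)
        last : odd i * (ρ * (w J * Y ^ J)) ≤ (1# + 1#) * (w J * Y ^ J)
        last = ≤-by ((1# + (ι J + ι J)) * (ρ * (w J * Y ^ J)))
          (*-nonneg (<⇒≤ (odd-pos J)) (*-nonneg (recip-nonneg (i ℕ.+ J)) (term-nonneg J)))
          (modulo (- ((1# + 1#) * (w J * Y ^ J))) (recip-+ i J)
            (solve 4 (λ i j ρ t → two :* t := (one :+ (i :+ i)) :* (ρ :* t) :+ (one :+ (j :+ j)) :* (ρ :* t)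
               :+ (:- (two :* t)) :* ((one :+ (i :+ j)) :* ρ :- one)) refl (ι i) (ι J) ρ (w J * Y ^ J)))

      module _ (x : Carrier) (0≤x : 0# ≤ x) (x² : x * x ≈ 1# - Y) where

        x*partialSum≤1 : ∀ J → x * partialSum J ≤ 1#
        x*partialSum≤1 zero    = ≤-trans (≤-reflexive (zeroʳ x)) (<⇒≤ 0<1)
        x*partialSum≤1 (suc k) = square-cancel-≤ (<⇒≤ 0<1) (≤-by (Y ^ suc k * (odd k * w k * weightedSum k (suc k)))
          (*-nonneg (power-nonneg 0≤Y (suc k)) (*-nonneg (*-nonneg (<⇒≤ (odd-pos k)) (w-nonneg k)) (weightedSum-nonneg k (suc k))))
          (trans (*-identityˡ 1#) (trans (partialSum-square k) (+-congʳ (trans (*-congʳ (sym x²))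
            (solve 2 (λ x r → x :* x :* (r :* r) := x :* r :* (x :* r)) refl x (partialSum (suc k))))))))

        lower : ∀ J → (1# - Y) * partialSum J ≤ x
        lower J = ≤-trans (≤-reflexive (trans (*-congʳ (sym x²)) (*-assoc _ _ _)))
          (≤-trans (*-monoˡ-≤ 0≤x (x*partialSum≤1 J)) (≤-reflexive (*-identityʳ x)))

        -- After multiplication by 1 + xR, with R one term longer than the sum in the bound, the
        -- square x² can be replaced by 1 - Y. The resulting difference is nonnegative by
        -- `x*partialSum≤1` and `weightedSum-bound`.
        upper : ∀ J → x ≤ (1# - Y) * partialSum J + w J * Y ^ J
        upper J = *-cancelʳ-≤ 1+xR-pos (≤-by
            (Y * P * W * (1# - X + (x * ((1# + 1#) * R - odd J * b))))
            (*-nonneg (*-nonneg (*-nonneg 0≤Y (power-nonneg 0≤Y J)) (w-nonneg J))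
               (+-nonneg (0≤y-x (x*partialSum≤1 (suc J))) (*-nonneg 0≤x (0≤y-x (weightedSum-bound J (suc J))))))
            (modulo (- x) (partialSum-square J)
            (modulo (- R) x²
            (solve 7 (λ x y r₀ p w o b → let r = r₀ :+ w :* p ; xr = x :* r in
               ((one :- y) :* r₀ :+ w :* p) :* (one :+ xr) :=
               x :* (one :+ xr) :+ y :* p :* w :* (one :- xr :+ x :* (two :* r :- o :* b))
                 :+ (:- x) :* (one :- ((one :- y) :* (r :* r) :+ y :* p :* (o :* w :* b)))
                 :+ (:- r) :* (x :* x :- (one :- y)))
               refl x Y R₀ P W (odd J) b))))
          where
          P = Y ^ J
          W = w J
          R₀ = partialSum J
          R = partialSum (suc J)
          X = x * R
          b = weightedSum J (suc J)
          1+xR-pos : 0# < 1# + X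
          1+xR-pos = <-≤-trans 0<1 (≤-by X (*-nonneg 0≤x (partialSum-nonneg (suc J))) refl)

-- Central binomial estimates and the separation of consecutive orders.

module CentralBinomialBounds {c ℓ₁ ℓ₂} (ℝ : RealField c ℓ₁ ℓ₂) where
  open RealField ℝ hiding (zero)
  open OrderedField ℝ
  open SquareRootSeries ℝ
  open IntegerCoefficients ℝ-ring using (Polynomial; ⟦_⟧ℤ; solve; _:=_; con; _:+_; _:*_; _:-_; :-_)

  private
    one two : ∀ {n} → Polynomial n
    one = con (ℤ.+ 1)
    two = one :+ one

    oddᵖ evenᵖ : ∀ {n} → Polynomial n → Polynomial n
    oddᵖ k  = one :+ (k :+ k)
    evenᵖ k = one :+ oddᵖ k

  -- The numeral exactly as the solver reads `con`, in contrast to `ι`, which unfolds to a sum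
  -- ending in `0#`.
  num : ℕ → Carrier
  num n = ⟦ ℤ.+ n ⟧ℤ

  num≈ι : ∀ n → num n ≈ ι n
  num≈ι n = sym (Mult.×ᵤ≈× semiring n 1#)

  num-pos : ∀ n → 0# < num (suc n)
  num-pos n = <-respʳ-≈ (sym (num≈ι (suc n))) (ι-pos n)

  num-nonneg : ∀ n → 0# ≤ num n
  num-nonneg n = ≤-trans (ι-nonneg n) (≤-reflexive (sym (num≈ι n)))

  v : ℕ → Carrier
  v k = w k * w k

  v-pos : ∀ k → 0# < v k
  v-pos k = *-pos (w-pos k) (w-pos k)

  even²-pos : ∀ k → 0# < even k * even k
  even²-pos k = *-pos (even-pos k) (even-pos k)

  lower-scale : ℕ → Carrier
  lower-scale k = odd k + (ι k + ι k)

  -- Since v k ~ 1/(πk), the monotonicity of (4k + 1) v k and of (11k + 3) v k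
  -- compares v k with v (2k) with the right asymptotic constant.
  scaled-v-increasing : ∀ k → lower-scale k * v k ≤ lower-scale (suc k) * v (suc k)
  scaled-v-increasing k = *-cancelʳ-≤ (even²-pos k) (≤-by (v k) (<⇒≤ (v-pos k))
    (modulo (lower-scale (suc k) * (even k * w (suc k) + odd k * w k)) (w-rec k)
      (solve 3 (λ k w w′ → let o = oddᵖ k ; e = evenᵖ k ; k′ = one :+ k ; s = o :+ (k :+ k) ; s′ = oddᵖ k′ :+ (k′ :+ k′) in
        s′ :* (w′ :* w′) :* (e :* e) := s :* (w :* w) :* (e :* e) :+ w :* w :+ s′ :* (e :* w′ :+ o :* w) :* (e :* w′ :- o :* w))
       refl (ι k) (w k) (w (suc k)))))

  upper-scale : ℕ → Carrier
  upper-scale k = num 3 + num 11 * ι k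

  -- With denominators cleared, the cubic and quadratic terms cancel for the scale 11k + 3 and the
  -- difference is k - 2, that is q, times `v k`. Hence the start at k = 2.
  scaled-v-decreasing : ∀ q → let k = suc (suc q) in upper-scale (suc k) * v (suc k) ≤ upper-scale k * v k
  scaled-v-decreasing q = *-cancelʳ-≤ (even²-pos k) (≤-by (ι q * v k) (*-nonneg (ι-nonneg q) (<⇒≤ (v-pos k)))
    (modulo (- (upper-scale (suc k) * (even k * w (suc k) + odd k * w k))) (w-rec k)
      (solve 3 (λ q w w′ → let k = one :+ (one :+ q) ; o = oddᵖ k ; e = evenᵖ k
                               s = con (ℤ.+ 3) :+ con (ℤ.+ 11) :* k ; s′ = con (ℤ.+ 3) :+ con (ℤ.+ 11) :* (one :+ k) in
        s :* (w :* w) :* (e :* e) := s′ :* (w′ :* w′) :* (e :* e) :+ q :* (w :* w)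
          :+ (:- (s′ :* (e :* w′ :+ o :* w))) :* (e :* w′ :- o :* w))
       refl (ι q) (w k) (w (suc k)))))
    where k = suc (suc q)

  -- The product decreases from its value 1 at k = 0. This makes `w` tend to zero, which the
  -- comparison of equal cycle lengths exploits.
  odd*v≤1 : ∀ k → odd k * v k ≤ 1#
  odd*v≤1 zero    = ≤-reflexive (modulo (w 0 + 1#) w-zero (solve 1 (λ w →
    (one :+ (con (ℤ.+ 0) :+ con (ℤ.+ 0))) :* (w :* w) := one :+ (w :+ one) :* (w :- one)) refl (w 0)))
  odd*v≤1 (suc k) = ≤-trans (*-cancelʳ-≤ (even²-pos k) (≤-by (odd k * v k) (*-nonneg (<⇒≤ (odd-pos k)) (<⇒≤ (v-pos k)))
    (modulo (- (odd (suc k) * (even k * w (suc k) + odd k * w k))) (w-rec k)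
      (solve 3 (λ k w w′ → let o = oddᵖ k ; e = evenᵖ k ; o′ = oddᵖ (one :+ k) in
        o :* (w :* w) :* (e :* e) := o′ :* (w′ :* w′) :* (e :* e) :+ o :* (w :* w)
          :+ (:- (o′ :* (e :* w′ :+ o :* w))) :* (e :* w′ :- o :* w))
       refl (ι k) (w k) (w (suc k)))))) (odd*v≤1 k)

  lower-scale-mono : ∀ {k l} → k ℕ.≤′ l → lower-scale k * v k ≤ lower-scale l * v l
  lower-scale-mono ℕ.≤′-refl       = ≤-refl
  lower-scale-mono (ℕ.≤′-step k≤l) = ≤-trans (lower-scale-mono k≤l) (scaled-v-increasing _)

  upper-scale-mono : ∀ {q l} → suc (suc q) ℕ.≤′ l → upper-scale l * v l ≤ upper-scale (suc (suc q)) * v (suc (suc q))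
  upper-scale-mono ℕ.≤′-refl = ≤-refl
  upper-scale-mono {q} (ℕ.≤′-step {n = suc (suc l)} q≤l) = ≤-trans (scaled-v-decreasing l) (upper-scale-mono q≤l)
  upper-scale-mono {q} (ℕ.≤′-step {n = suc zero} q≤l) with ℕ.≤′⇒≤ q≤l
  ... | ℕ.s≤s ()
  upper-scale-mono {q} (ℕ.≤′-step {n = zero} q≤l) with ℕ.≤′⇒≤ q≤l
  ... | ()

  private
    <-with-remainder : ∀ {x y} d e → 0# ≤ d → 0# < e → y ≈ x + (d + e) → x < y
    <-with-remainder d e 0≤d 0<e = <-by (d + e) (<-≤-trans 0<e (≤-by d 0≤d (+-comm d e)))

  ι-double : ∀ k → ι (k ℕ.+ k) ≈ ι k + ι k
  ι-double k = ×-homo-+ 1# k k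

  -- The inequalities of the next two lemmas, multiplied by a scale, become
  -- polynomial inequalities in q with positive coefficients.
  odd-to-even : ∀ q → let h = suc (suc q) in
    odd h * (odd (h ℕ.+ h) * v (h ℕ.+ h)) < even h * ((ι h + ι h) * v h)
  odd-to-even q = <-respˡ-≈ (*-congˡ (*-congʳ (+-congˡ (sym (+-cong (ι-double h) (ι-double h))))))
    (*-cancelʳ-< {z = num 3 + num 11 * κ} scale-pos (<-with-remainder
      (odd h * (1# + (κ + κ)) * (upper-scale h * v h - (num 3 + num 11 * κ) * u))
      -- This is 10h² - 17h - 3 at h = q + 2. It is negative at h = 1, which is why the step from
      -- order 3 to order 4 is exceptional.
      ((num 10 * (ι q * ι q) + num 23 * ι q + num 3) * v h)
      (*-nonneg (*-nonneg (<⇒≤ (odd-pos h)) (+-nonneg (<⇒≤ 0<1) (+-nonneg 0≤κ 0≤κ)))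
        (0≤y-x (≤-trans (≤-reflexive (*-congʳ (+-congˡ (*-congˡ (sym (ι-double h))))))
          (upper-scale-mono (ℕ.≤⇒≤′ (ℕ.m≤m+n h h))))))
      (*-pos (≤-<-trans (+-nonneg (*-nonneg (num-nonneg 10) (square-nonneg (ι q))) (*-nonneg (num-nonneg 23) (ι-nonneg q)))
                (<-by (num 3) (num-pos 2) refl)) (v-pos h))
      (solve 3 (λ q u u′ → let h = one :+ (one :+ q) ; κ = h :+ h ; s = con (ℤ.+ 3) :+ con (ℤ.+ 11) :* κ in
         evenᵖ h :* ((h :+ h) :* u′) :* s := oddᵖ h :* (oddᵖ κ :* u) :* s :+
           (oddᵖ h :* oddᵖ κ :* ((con (ℤ.+ 3) :+ con (ℤ.+ 11) :* h) :* u′ :- s :* u)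
            :+ (con (ℤ.+ 10) :* (q :* q) :+ con (ℤ.+ 23) :* q :+ con (ℤ.+ 3)) :* u′)) refl (ι q) u (v h))))
    where
    h = suc (suc q)
    κ = ι h + ι h
    u = v (h ℕ.+ h)
    0≤κ : 0# ≤ κ
    0≤κ = +-nonneg (ι-nonneg h) (ι-nonneg h)
    scale-pos : 0# < num 3 + num 11 * κ
    scale-pos = <-≤-trans (num-pos 2) (≤-by _ (*-nonneg (num-nonneg 11) 0≤κ) refl)

  even-to-odd : ∀ q → let b = suc (suc q) ; h = suc b in
    even b * (odd b * v b) < odd h * ((ι (h ℕ.+ h) + ι (h ℕ.+ h)) * v (h ℕ.+ h))
  even-to-odd q = <-respʳ-≈ (*-congˡ (*-congʳ (sym (+-cong (ι-double h) (ι-double h)))))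
    (*-cancelʳ-< {z = 1# + (κ + κ) + (κ + κ)} scale-pos (<-with-remainder
      (odd h * (κ + κ) * ((1# + (κ + κ) + (κ + κ)) * u - lower-scale b * v b))
      -- This is (2b + 2)(2b - 3) at b = q + 2. It is negative for b = 0 and b = 1, the exceptional
      -- orders 2 and 4.
      ((num 4 * (ι q * ι q) + num 14 * ι q + num 6) * v b)
      (*-nonneg (*-nonneg (<⇒≤ (odd-pos h)) (+-nonneg 0≤κ 0≤κ))
        (0≤y-x (≤-trans (lower-scale-mono (ℕ.≤⇒≤′ (ℕ.≤-trans (ℕ.n≤1+n b) (ℕ.m≤m+n h h))))
          (≤-reflexive (*-congʳ (+-cong (+-congˡ (+-cong (ι-double h) (ι-double h))) (+-cong (ι-double h) (ι-double h))))))))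
      (*-pos (≤-<-trans (+-nonneg (*-nonneg (num-nonneg 4) (square-nonneg (ι q))) (*-nonneg (num-nonneg 14) (ι-nonneg q)))
                (<-by (num 6) (num-pos 5) refl)) (v-pos b))
      (solve 3 (λ q u u′ → let b = one :+ (one :+ q) ; h = one :+ b ; κ = h :+ h ; s = one :+ (κ :+ κ) :+ (κ :+ κ) in
         oddᵖ h :* ((κ :+ κ) :* u) :* s := evenᵖ b :* (oddᵖ b :* u′) :* s :+
           (oddᵖ h :* (κ :+ κ) :* (s :* u :- (oddᵖ b :+ (b :+ b)) :* u′)
            :+ (con (ℤ.+ 4) :* (q :* q) :+ con (ℤ.+ 14) :* q :+ con (ℤ.+ 6)) :* u′)) refl (ι q) u (v b))))
    where
    b = suc (suc q)
    h = suc b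
    κ = ι h + ι h
    u = v (h ℕ.+ h)
    0≤κ : 0# ≤ κ
    0≤κ = +-nonneg (ι-nonneg h) (ι-nonneg h)
    scale-pos : 0# < 1# + (κ + κ) + (κ + κ)
    scale-pos = <-≤-trans 0<1 (≤-by (κ + κ + (κ + κ)) (+-nonneg (+-nonneg 0≤κ 0≤κ) (+-nonneg 0≤κ 0≤κ)) (+-assoc _ _ _))

  -- 1/32
  t : Carrier
  t = recip 31

  t-pos : 0# < t
  t-pos = recip-pos 31

  t-value : num 32 * t ≈ 1#
  t-value = trans (*-congʳ (num≈ι 32)) (recip-inverse 31)

  -- The denominator 32 suits all numbers in the exceptional comparisons: `w 2` is 12/32, four times
  -- `w 4` is 35/32, and 1/√2, the absolute real part of the nonzero eigenvalues at order 4, lies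
  -- between 22/32 and 23/32.
  w₂-value : w 2 ≈ num 12 * t
  w₂-value = modulo (num 12 * t) w-zero (modulo (num 4 * t * num 3) (w-rec 0) (modulo (num 4 * t * num 2) (w-rec 1) (modulo (- w 2) t-value
    (solve 4 (λ w₀ w₁ w₂ t → let o = con (ℤ.+ 0) ; i = one :+ o in
      w₂ := con (ℤ.+ 12) :* t :+ con (ℤ.+ 12) :* t :* (w₀ :- one) :+ con (ℤ.+ 4) :* t :* con (ℤ.+ 3) :* (evenᵖ o :* w₁ :- oddᵖ o :* w₀)
        :+ con (ℤ.+ 4) :* t :* con (ℤ.+ 2) :* (evenᵖ i :* w₂ :- oddᵖ i :* w₁) :+ (:- w₂) :* (con (ℤ.+ 32) :* t :- one))
      refl (w 0) (w 1) (w 2) t))))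

  w₄-value : num 4 * w 4 ≈ num 35 * t
  w₄-value = modulo 1# (*-cancel-0 (#-sym (<⇒# (num-pos 11)))
      (modulo (num 6) (w-rec 3) (modulo (num 7) (w-rec 2) (modulo (num 35) w₂-value
        (solve 4 (λ w₂ w₃ w₄ t → let two′ = one :+ (one :+ con (ℤ.+ 0)) ; three = one :+ two′ in
          con (ℤ.+ 12) :* (con (ℤ.+ 4) :* w₄ :- con (ℤ.+ 35) :* t) := con (ℤ.+ 0)
            :+ con (ℤ.+ 6) :* (evenᵖ three :* w₄ :- oddᵖ three :* w₃) :+ con (ℤ.+ 7) :* (evenᵖ two′ :* w₃ :- oddᵖ two′ :* w₂)
            :+ con (ℤ.+ 35) :* (w₂ :- con (ℤ.+ 12) :* t))
          refl (w 2) (w 3) (w 4) t)))))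
    (solve 2 (λ w t → con (ℤ.+ 4) :* w := con (ℤ.+ 35) :* t :+ one :* (con (ℤ.+ 4) :* w :- con (ℤ.+ 35) :* t :- con (ℤ.+ 0))) refl (w 4) t)

  data Order : ℕ → Set where
    even-order : ∀ b → Order (2 ℕ.+ b ℕ.* 2)
    odd-order  : ∀ a → Order (3 ℕ.+ a ℕ.* 2)

  nextOrder : ∀ {m} → Order m → Order (suc m)
  nextOrder (even-order b) = odd-order b
  nextOrder (odd-order a)  = even-order (suc a)

  order : ∀ i → Order (2 ℕ.+ i)
  order zero    = even-order 0
  order (suc i) = nextOrder (order i)

  -- Bounds for the energy of a negative cycle of the given length.  The lengths
  -- 2 and 4, for which the general bounds are too weak, are exceptional.
  lowerBound upperBound : ∀ {m} → Order m → Carrier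
  lowerBound (even-order 0)               = 0#
  lowerBound (even-order 1)               = ι 4 * (num 22 * t)
  lowerBound (even-order b@(suc (suc _))) = even b * ((ι b + ι b) * v b)
  lowerBound (odd-order a)                = let h = suc a in odd h * ((ι (h ℕ.+ h) + ι (h ℕ.+ h)) * v (h ℕ.+ h))
  upperBound (even-order 0)               = 0#
  upperBound (even-order 1)               = ι 4 * (num 23 * t)
  upperBound (even-order b@(suc (suc _))) = even b * (odd b * v b)
  upperBound (odd-order a)                = let h = suc a in odd h * (odd (h ℕ.+ h) * v (h ℕ.+ h))

  lower≤upper : ∀ {m} (o : Order m) → lowerBound o ≤ upperBound o
  lower≤upper (even-order 0)               = ≤-refl
  lower≤upper (even-order 1)               = ≤-by (ι 4 * t) (*-nonneg (ι-nonneg 4) (<⇒≤ t-pos))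
    (solve 2 (λ i t → i :* (con (ℤ.+ 23) :* t) := i :* (con (ℤ.+ 22) :* t) :+ i :* t) refl (ι 4) t)
  lower≤upper (even-order b@(suc (suc _))) = *-monoˡ-≤ (<⇒≤ (even-pos b)) (*-monoʳ-≤ (<⇒≤ (v-pos b))
    (≤-by 1# (<⇒≤ 0<1) (+-comm 1# _)))
  lower≤upper (odd-order a)                = *-monoˡ-≤ (<⇒≤ (odd-pos (suc a))) (*-monoʳ-≤ (<⇒≤ (v-pos (suc a ℕ.+ suc a)))
    (≤-by 1# (<⇒≤ 0<1) (+-comm 1# _)))

  upper<lower : ∀ {m} (o : Order m) → upperBound o < lowerBound (nextOrder o)
  upper<lower (even-order 0)             = *-pos (odd-pos 1) (*-pos (+-pos (ι-pos 1) (ι-pos 1)) (v-pos 2))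
  -- In units of t², twice the lower bound for order 5 is 5·35² = 6125 and twice the upper bound for
  -- order 4 is 184·32 = 5888, which leaves 237.
  upper<lower (even-order 1)             = *-cancelʳ-< (num-pos 1) (<-by (num 237 * (t * t)) (*-pos (num-pos 236) (*-pos t-pos t-pos))
    (modulo (num 20 * w 4 + num 175 * t) w₄-value (modulo (num 184 * t) t-value
      (solve 2 (λ w t → let o = con (ℤ.+ 0) ; ι₂ = one :+ (one :+ o) ; ι₄ = one :+ (one :+ ι₂) in
        oddᵖ ι₂ :* ((ι₄ :+ ι₄) :* (w :* w)) :* con (ℤ.+ 2) := ι₄ :* (con (ℤ.+ 23) :* t) :* con (ℤ.+ 2) :+ con (ℤ.+ 237) :* (t :* t)
          :+ (con (ℤ.+ 20) :* w :+ con (ℤ.+ 175) :* t) :* (con (ℤ.+ 4) :* w :- con (ℤ.+ 35) :* t)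
          :+ con (ℤ.+ 184) :* t :* (con (ℤ.+ 32) :* t :- one)) refl (w 4) t))))
  upper<lower (even-order (suc (suc q))) = even-to-odd q
  -- In units of t², the bounds for orders 4 and 3 are 88·32 = 2816 and 15·12² = 2160, which leaves
  -- 656.
  upper<lower (odd-order 0)              = <-by (num 656 * (t * t)) (*-pos (num-pos 655) (*-pos t-pos t-pos))
    (modulo (- (num 15 * (w 2 + num 12 * t))) w₂-value (modulo (- (num 88 * t)) t-value
      (solve 2 (λ w t → let o = con (ℤ.+ 0) ; ι₁ = one :+ o ; ι₂ = one :+ ι₁ ; ι₄ = one :+ (one :+ ι₂) in
        ι₄ :* (con (ℤ.+ 22) :* t) := oddᵖ ι₁ :* (oddᵖ ι₂ :* (w :* w)) :+ con (ℤ.+ 656) :* (t :* t)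
          :+ (:- (con (ℤ.+ 15) :* (w :+ con (ℤ.+ 12) :* t))) :* (w :- con (ℤ.+ 12) :* t)
          :+ (:- (con (ℤ.+ 88) :* t)) :* (con (ℤ.+ 32) :* t :- one)) refl (w 2) t)))
  upper<lower (odd-order (suc q))        = odd-to-even q

  upper<lower-trans : ∀ {i j} → i ℕ.<′ j → upperBound (order i) < lowerBound (order j)
  upper<lower-trans {i} ℕ.≤′-refl     = upper<lower (order i)
  upper<lower-trans (ℕ.≤′-step {n = j} i<j) = <-≤-trans (upper<lower-trans i<j)
    (≤-trans (lower≤upper (order j)) (<⇒≤ (upper<lower (order j))))

-- Bounds for the energy in terms of the cycle length.

module EnergyBounds {c ℓ₁ ℓ₂} (ℝ : RealField c ℓ₁ ℓ₂) where
  open RealField ℝ hiding (zero)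
  open OrderedField ℝ
  open Energy ℝ
  open ComplexNumbers ℝ
  open NegativeSpectrum ℝ
  open SquareRootSeries ℝ
  open CentralBinomialBounds ℝ
  open IntegerCoefficients ℝ-ring using (solve; _:=_; con; _:+_; _:*_; _:-_; :-_)
  open Moments ℂ-ring κ

  totalEnergy : ∀ {n} → (Fin n → ℂ) → Carrier
  totalEnergy z = ∑.sum λ j → ∣ re (z j) ∣

  momentSum : (ℕ → Carrier) → ℕ → Carrier
  momentSum M zero    = 0#
  momentSum M (suc J) = momentSum M J + w J * (M J - M (suc J))

  momentSum-cong : ∀ {M M′} J → (∀ k → k ℕ.≤ J → M k ≈ M′ k) → momentSum M J ≈ momentSum M′ J
  momentSum-cong zero    M≈M′ = refl
  momentSum-cong (suc J) M≈M′ = +-cong (momentSum-cong J λ k k≤J → M≈M′ k (ℕ.m≤n⇒m≤1+n k≤J))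
    (*-congˡ (+-cong (M≈M′ J (ℕ.n≤1+n J)) (-‿cong (M≈M′ (suc J) ℕ.≤-refl))))

  -- The sum telescopes, since wₖ(wₖ - wₖ₊₁) = 2(k + 1)wₖ₊₁² - 2k wₖ² by the recurrence of `w`.
  momentSum-w : ∀ a J → momentSum (λ k → a * w k) J ≈ a * ((ι J + ι J) * v J)
  momentSum-w a zero    = solve 2 (λ a v → let o = con (ℤ.+ 0) in o := a :* ((o :+ o) :* v)) refl a (v 0)
  momentSum-w a (suc J) = trans (+-congʳ (momentSum-w a J))
    (modulo (- (a * (w J + w (suc J)))) (w-rec J)
      (solve 4 (λ a j w w′ → let one = con (ℤ.+ 1) ; o = one :+ (j :+ j) ; s = one :+ j in
        a :* ((j :+ j) :* (w :* w)) :+ w :* (a :* w :- a :* w′) := a :* ((s :+ s) :* (w′ :* w′))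
          :+ (:- (a :* (w :+ w′))) :* ((one :+ o) :* w′ :- o :* w)) refl a (ι J) (w J) (w (suc J))))

  ∣x∣-zero : ∀ {x} → x ≈ 0# → ∣ x ∣ ≈ 0#
  ∣x∣-zero {x} x≈0 = square-zero (trans (∣x∣-square x) (trans (*-cong x≈0 x≈0) (zeroˡ 0#)))

  module _ {n m z} (N : NegativeEigenvalues n m z) where
    open NegativeEigenvalues N

    -- The factor `r j - Y j` is 1 - Y at an eigenvalue of modulus 1 and zero at a zero eigenvalue,
    -- so that a single expression fits both kinds and its sum depends on the moments `M` alone.
    below above : ℕ → Fin n → Carrier
    below J j = (r j - Y j) * partialSum (Y j) J
    above J j = below J j + w J * (r j * Y j ^ᵣ J)

    private
      x : Fin n → Carrier
      x j = re (z j)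

      0≤Y : ∀ j → 0# ≤ Y j
      0≤Y j = square-nonneg (y j)

      Y≈0 : ∀ j → z j C.≈ C.0# → Y j ≈ 0#
      Y≈0 j z≈0 = trans (*-congʳ (proj₂ z≈0)) (zeroˡ _)

      below-0 : ∀ J j → z j C.≈ C.0# → below J j ≈ 0#
      below-0 J j z≈0 = trans (*-congʳ (trans (+-cong (normSq-0 z≈0) (-‿cong (Y≈0 j z≈0))) (-‿inverseʳ 0#))) (zeroˡ _)

      ∣x∣² : ∀ j → r j ≈ 1# → ∣ x j ∣ * ∣ x j ∣ ≈ 1# - Y j
      ∣x∣² j r≈1 = trans (∣x∣-square (x j)) (trans (solve 2 (λ a b → a := a :+ b :- b) refl (x j * x j) (Y j)) (+-congʳ r≈1))

    below-∣x∣ : ∀ J j → below J j ≤ ∣ x j ∣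
    below-∣x∣ J j = root-cases j
      (λ z≈0 → ≤-trans (≤-reflexive (below-0 J j z≈0)) (0≤∣x∣ (x j)))
      (λ (r≈1 , _) → ≤-trans (≤-reflexive (*-congʳ (+-congʳ r≈1)))
        (lower (Y j) (0≤Y j) ∣ x j ∣ (0≤∣x∣ (x j)) (∣x∣² j r≈1) J))

    ∣x∣-above : ∀ J j → ∣ x j ∣ ≤ above J j
    ∣x∣-above J j = root-cases j
      (λ z≈0 → ≤-reflexive (trans (∣x∣-zero (proj₁ z≈0)) (sym (trans (+-cong (below-0 J j z≈0)
        (trans (*-congˡ (trans (*-congʳ (normSq-0 z≈0)) (zeroˡ _))) (zeroʳ _))) (+-identityˡ 0#)))))
      (λ (r≈1 , _) → ≤-trans (upper (Y j) (0≤Y j) ∣ x j ∣ (0≤∣x∣ (x j)) (∣x∣² j r≈1) J)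
        (≤-reflexive (sym (+-cong (*-congʳ (+-congʳ r≈1)) (*-congˡ (trans (*-congʳ r≈1) (*-identityˡ _)))))))

    above-∣x∣ : ∀ J j → above J j ≤ ∣ x j ∣ + w J
    above-∣x∣ J j = +-mono-≤ (below-∣x∣ J j) (≤-trans (*-monoˡ-≤ (w-nonneg J) rYᴶ≤1) (≤-reflexive (*-identityʳ _)))
      where
      Yᵏ≤1 : Y j ≤ 1# → ∀ k → Y j ^ᵣ k ≤ 1#
      Yᵏ≤1 Y≤1 zero    = ≤-refl
      Yᵏ≤1 Y≤1 (suc k) = ≤-trans (*-monoˡ-≤ (0≤Y j) (Yᵏ≤1 Y≤1 k)) (≤-trans (≤-reflexive (*-identityʳ _)) Y≤1)
      rYᴶ≤1 : r j * Y j ^ᵣ J ≤ 1#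
      rYᴶ≤1 = root-cases j
        (λ z≈0 → ≤-trans (≤-reflexive (trans (*-congʳ (normSq-0 z≈0)) (zeroˡ _))) (<⇒≤ 0<1))
        (λ (r≈1 , _) → ≤-trans (≤-reflexive (trans (*-congʳ r≈1) (*-identityˡ _)))
          (Yᵏ≤1 (≤-by (x j * x j) (square-nonneg (x j)) (trans (sym r≈1) (+-comm _ _))) J))

    sum-below : ∀ J → ∑.sum (below J) ≈ momentSum M J
    sum-below zero    = trans (∑.sum-cong-≋ {n} {below 0} {λ _ → 0#} λ j → zeroʳ _) (∑.sum-replicate-zero n)
    sum-below (suc J) = begin
      ∑.sum (below (suc J))
        ≈⟨ ∑.sum-cong-≋ pointwise ⟩
      ∑.sum (λ j → below J j + w J * (r j * Y j ^ᵣ J + - 1# * (r j * Y j ^ᵣ suc J)))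
        ≈⟨ ∑.∑-distrib-+ (below J) (λ j → w J * (r j * Y j ^ᵣ J + - 1# * (r j * Y j ^ᵣ suc J))) ⟩
      ∑.sum (below J) + ∑.sum (λ j → w J * (r j * Y j ^ᵣ J + - 1# * (r j * Y j ^ᵣ suc J)))
        ≈⟨ +-cong (sum-below J) (trans (sym (∑.*-distribˡ-sum (w J) (λ j → r j * Y j ^ᵣ J + - 1# * (r j * Y j ^ᵣ suc J))))
             (*-congˡ (trans (∑.∑-distrib-+ (λ j → r j * Y j ^ᵣ J) (λ j → - 1# * (r j * Y j ^ᵣ suc J)))
               (+-congˡ (trans (sym (∑.*-distribˡ-sum (- 1#) (λ j → r j * Y j ^ᵣ suc J)))
                 (solve 1 (λ a → (:- con (ℤ.+ 1)) :* a := :- a) refl (M (suc J)))))))) ⟩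
      momentSum M (suc J) ∎
      where
      open SetoidReasoning setoid
      pointwise : ∀ j → below (suc J) j ≈ below J j + w J * (r j * Y j ^ᵣ J + - 1# * (r j * Y j ^ᵣ suc J))
      pointwise j = modulo (w J * Y j ^ᵣ J) (rY j)
        (solve 5 (λ r y s w p → (r :- y) :* (s :+ w :* p)
            := (r :- y) :* s :+ w :* (r :* p :+ (:- con (ℤ.+ 1)) :* (r :* (y :* p))) :+ w :* p :* (r :* y :- y))
          refl (r j) (Y j) (partialSum (Y j) J) (w J) (Y j ^ᵣ J))

    sum-above : ∀ J → ∑.sum (above J) ≈ momentSum M J + w J * M J
    sum-above J = trans (∑.∑-distrib-+ (below J) (λ j → w J * (r j * Y j ^ᵣ J)))
      (+-cong (sum-below J) (sym (∑.*-distribˡ-sum (w J) (λ j → r j * Y j ^ᵣ J))))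

    M-value : ∀ K → EvenSumsVanish K → ∀ k → k ℕ.≤ K → M k ≈ ι m * w k
    M-value K vanish zero    _   = trans M-zero (sym (trans (*-congˡ w-zero) (*-identityʳ _)))
    M-value K vanish (suc k) k<K = modulo 1# (*-cancel-0 (#-sym (<⇒# (even-pos k)))
        (modulo 1# (M-recurrence K vanish k k<K) (modulo (odd k) (M-value K vanish k (ℕ.<⇒≤ k<K)) (modulo (- ι m) (w-rec k)
          (solve 7 (λ e o m M M′ w w′ → e :* (M′ :- m :* w′) := con (ℤ.+ 0) :+ con (ℤ.+ 1) :* (e :* M′ :- o :* M)
             :+ o :* (M :- m :* w) :+ (:- m) :* (e :* w′ :- o :* w)) refl (even k) (odd k) (ι m) (M k) (M (suc k)) (w k) (w (suc k)))))))
      (solve 2 (λ a b → a := b :+ con (ℤ.+ 1) :* (a :- b :- con (ℤ.+ 0))) refl (M (suc k)) (ι m * w (suc k)))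

    lower-bound : ∀ K → EvenSumsVanish K → ι m * ((ι K + ι K) * v K) ≤ totalEnergy z
    lower-bound K vanish = ≤-trans (≤-reflexive (sym (trans (sum-below K)
        (trans (momentSum-cong K (M-value K vanish)) (momentSum-w (ι m) K)))))
      (sum-mono-≤ (below K) (λ j → ∣ x j ∣) (below-∣x∣ K))

    upper-bound : ∀ K → EvenSumsVanish K → totalEnergy z ≤ ι m * (odd K * v K)
    upper-bound K vanish = ≤-trans (sum-mono-≤ (λ j → ∣ x j ∣) (above K) (∣x∣-above K))
      (≤-reflexive (trans (sum-above K) (trans (+-cong (trans (momentSum-cong K (M-value K vanish)) (momentSum-w (ι m) K))
        (*-congˡ (M-value K vanish K ℕ.≤-refl)))
        (solve 3 (λ m k w → m :* ((k :+ k) :* (w :* w)) :+ w :* (m :* w) := m :* ((con (ℤ.+ 1) :+ (k :+ k)) :* (w :* w))) refl (ι m) (ι K) (w K)))))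

    energy-nonneg : 0# ≤ totalEnergy z
    energy-nonneg = ≤-trans (≤-reflexive (sym (∑.sum-replicate-zero n)))
      (sum-mono-≤ {n} (λ _ → 0#) (λ j → ∣ x j ∣) (λ j → 0≤∣x∣ (x j)))

  imaginary : ∀ u → normSq u ≈ 1# → u C.* u C.≈ (C.- C.1#) → re u ≈ 0#
  imaginary u unit (u²≈-1 , _) = square-zero (*-cancel-0 (#-sym (<⇒# (num-pos 1)))
    (modulo 1# unit (modulo 1# u²≈-1 (solve 2 (λ a b → con (ℤ.+ 2) :* (a :* a) := con (ℤ.+ 0)
      :+ con (ℤ.+ 1) :* (a :* a :+ b :* b :- con (ℤ.+ 1)) :+ con (ℤ.+ 1) :* (a :* a :- b :* b :- :- con (ℤ.+ 1))) refl (re u) (im u)))))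

  energy-2 : ∀ {n z} → NegativeEigenvalues n 2 z → totalEnergy z ≈ 0#
  energy-2 {n} {z} N = trans (∑.sum-cong-≋ {n} {_} {λ _ → 0#} λ j → ∣x∣-zero (root-cases-≈ j proj₁
      (λ (r≈1 , z²≈-1) → imaginary (z j) r≈1 (ℂᵣ.trans (ℂᵣ.*-congˡ {z j} (ℂᵣ.sym (ℂᵣ.*-identityʳ (z j)))) z²≈-1))))
    (∑.sum-replicate-zero n)
    where open NegativeEigenvalues N

  module _ {n z} (N : NegativeEigenvalues n 4 z) where
    open NegativeEigenvalues N

    -- The square of z is a number of modulus 1 whose square is -1, hence is imaginary; so the two
    -- coordinates of z have equal squares, with sum 1.
    re²-4 : ∀ j → r j ≈ 1# → z j ^ 4 C.≈ (C.- C.1#) → num 2 * (re (z j) * re (z j)) ≈ 1#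
    re²-4 j r≈1 z⁴≈-1 = modulo 1# r≈1 (modulo 1# (imaginary (z j C.* z j)
        (trans (normSq-* (z j) (z j)) (trans (*-cong r≈1 r≈1) (*-identityˡ 1#)))
        (ℂᵣ.trans (ℂSolver.solve 1 (λ z → let one = ℂSolver.con (ℤ.+ 1) in
           z ℂSolver.:* z ℂSolver.:* (z ℂSolver.:* z) ℂSolver.:= z ℂSolver.:* (z ℂSolver.:* (z ℂSolver.:* (z ℂSolver.:* one)))) ℂᵣ.refl (z j)) z⁴≈-1))
      (solve 2 (λ a b → con (ℤ.+ 2) :* (a :* a) := con (ℤ.+ 1) :+ con (ℤ.+ 1) :* (a :* a :+ b :* b :- con (ℤ.+ 1))
        :+ con (ℤ.+ 1) :* (a :* a :- b :* b :- con (ℤ.+ 0))) refl (re (z j)) (im (z j))))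

    -- After squaring and doubling, it rests on 2·22² = 968 falling short of 32² = 1024 by 56.
    ∣re∣-4-lower : ∀ j → r j * (num 22 * t) ≤ ∣ re (z j) ∣
    ∣re∣-4-lower j = root-cases j
      (λ z≈0 → ≤-trans (≤-reflexive (trans (*-congʳ (normSq-0 z≈0)) (zeroˡ _))) (0≤∣x∣ (re (z j))))
      (λ (r≈1 , z⁴≈-1) → ≤-trans (≤-reflexive (trans (*-congʳ r≈1) (*-identityˡ _)))
        (square-cancel-≤ (0≤∣x∣ (re (z j))) (*-cancelʳ-≤ (num-pos 1) (≤-by (num 56 * (t * t))
          (*-nonneg (num-nonneg 56) (square-nonneg t))
          (modulo (num 2) (∣x∣-square (re (z j))) (modulo 1# (re²-4 j r≈1 z⁴≈-1) (modulo (- (num 32 * t + 1#)) t-value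
            (solve 3 (λ a x t → a :* a :* con (ℤ.+ 2) := con (ℤ.+ 22) :* t :* (con (ℤ.+ 22) :* t) :* con (ℤ.+ 2) :+ con (ℤ.+ 56) :* (t :* t)
              :+ con (ℤ.+ 2) :* (a :* a :- x :* x) :+ con (ℤ.+ 1) :* (con (ℤ.+ 2) :* (x :* x) :- con (ℤ.+ 1))
              :+ (:- (con (ℤ.+ 32) :* t :+ con (ℤ.+ 1))) :* (con (ℤ.+ 32) :* t :- con (ℤ.+ 1))) refl ∣ re (z j) ∣ (re (z j)) t))))))))

    -- After squaring and doubling, it rests on 2·23² = 1058 exceeding 32² = 1024 by 34.
    ∣re∣-4-upper : ∀ j → ∣ re (z j) ∣ ≤ r j * (num 23 * t)
    ∣re∣-4-upper j = root-cases j
      (λ z≈0 → ≤-reflexive (trans (∣x∣-zero (proj₁ z≈0)) (sym (trans (*-congʳ (normSq-0 z≈0)) (zeroˡ _)))))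
      (λ (r≈1 , z⁴≈-1) → ≤-trans
        (square-cancel-≤ (*-nonneg (num-nonneg 23) (<⇒≤ t-pos)) (*-cancelʳ-≤ (num-pos 1) (≤-by (num 34 * (t * t))
          (*-nonneg (num-nonneg 34) (square-nonneg t))
          (modulo (- num 2) (∣x∣-square (re (z j))) (modulo (- 1#) (re²-4 j r≈1 z⁴≈-1) (modulo (num 32 * t + 1#) t-value
            (solve 3 (λ a x t → con (ℤ.+ 23) :* t :* (con (ℤ.+ 23) :* t) :* con (ℤ.+ 2) := a :* a :* con (ℤ.+ 2) :+ con (ℤ.+ 34) :* (t :* t)
              :+ (:- con (ℤ.+ 2)) :* (a :* a :- x :* x) :+ (:- con (ℤ.+ 1)) :* (con (ℤ.+ 2) :* (x :* x) :- con (ℤ.+ 1))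
              :+ (con (ℤ.+ 32) :* t :+ con (ℤ.+ 1)) :* (con (ℤ.+ 32) :* t :- con (ℤ.+ 1))) refl ∣ re (z j) ∣ (re (z j)) t)))))))
        (≤-reflexive (sym (trans (*-congʳ r≈1) (*-identityˡ _)))))

    sum-r-scaled : ∀ a → ∑.sum (λ j → r j * a) ≈ ι 4 * a
    sum-r-scaled a = trans (sym (∑.*-distribʳ-sum a r)) (*-congʳ sum-r)

  energy-bounds : ∀ {n m z} (o : Order m) → NegativeEigenvalues n m z →
    lowerBound o ≤ totalEnergy z × totalEnergy z ≤ upperBound o
  energy-bounds (even-order 0) N = ≤-reflexive (sym (energy-2 N)) , ≤-reflexive (energy-2 N)
  energy-bounds {z = z} (even-order 1) N =
      ≤-trans (≤-reflexive (sym (sum-r-scaled N _))) (sum-mono-≤ (λ j → r j * (num 22 * t)) (λ j → ∣ re (z j) ∣) (∣re∣-4-lower N))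
    , ≤-trans (sum-mono-≤ (λ j → ∣ re (z j) ∣) (λ j → r j * (num 23 * t)) (∣re∣-4-upper N)) (≤-reflexive (sum-r-scaled N _))
    where open NegativeEigenvalues N
  energy-bounds (even-order b@(suc (suc _))) N =
      ≤-trans (≤-reflexive (*-congʳ even≈)) (lower-bound N b vanish)
    , ≤-trans (upper-bound N b vanish) (≤-reflexive (*-congʳ (sym even≈)))
    where
    open NegativeEigenvalues N
    b*2≡ : b ℕ.* 2 ≡ b ℕ.+ b
    b*2≡ = ≡.trans (ℕ.*-comm b 2) (≡.cong (b ℕ.+_) (ℕ.+-identityʳ b))
    even≈ : even b ≈ ι (2 ℕ.+ b ℕ.* 2)
    even≈ = +-congˡ (+-congˡ (trans (sym (ι-double b)) (reflexive (≡.cong ι (≡.sym b*2≡)))))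
    vanish = evenSums-even b (≡.subst (λ k → b ℕ.+ b ℕ.< 2 ℕ.+ k) (≡.sym b*2≡) (ℕ.n≤1+n _))
  energy-bounds (odd-order a) N =
      ≤-trans (≤-reflexive (*-congʳ odd≈)) (lower-bound N (h ℕ.+ h) vanish)
    , ≤-trans (upper-bound N (h ℕ.+ h) vanish) (≤-reflexive (*-congʳ (sym odd≈)))
    where
    open NegativeEigenvalues N
    h = suc a
    h*2≡ : h ℕ.* 2 ≡ h ℕ.+ h
    h*2≡ = ≡.trans (ℕ.*-comm h 2) (≡.cong (h ℕ.+_) (ℕ.+-identityʳ h))
    odd≈ : odd h ≈ ι (3 ℕ.+ a ℕ.* 2)
    odd≈ = +-congˡ (trans (sym (ι-double h)) (reflexive (≡.cong ι (≡.sym h*2≡))))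
    vanish = evenSums-odd h (≡.cong suc h*2≡) (h ℕ.+ h) (≡.subst (λ k → h ℕ.+ h ℕ.< suc k) (≡.sym h*2≡) ℕ.≤-refl)

-- Equal cycle lengths give equal energies.

module EqualLength {c ℓ₁ ℓ₂} (ℝ : RealField c ℓ₁ ℓ₂) where
  open RealField ℝ hiding (zero)
  open OrderedField ℝ
  open Energy ℝ
  open ComplexNumbers ℝ
  open NegativeSpectrum ℝ
  open SquareRootSeries ℝ
  open CentralBinomialBounds ℝ
  open EnergyBounds ℝ
  open Moments ℂ-ring κ
  open IntegerCoefficients ℝ-ring using (solve; _:=_; con; _:+_; _:*_; _:-_; :-_)

  module _ {n m z z′} (N : NegativeEigenvalues n m z) (N′ : NegativeEigenvalues n m z′) where
    private
      module N = NegativeEigenvalues N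
      module N′ = NegativeEigenvalues N′

    powerSums-agree : ∀ k → N.powerSum (suc k) C.≈ N′.powerSum (suc k)
    powerSums-agree = <-rec _ λ k ih → helper k (λ l l<k → ih l<k)
      where
      helper : ∀ k → (∀ l → l ℕ.< k → N.powerSum (suc l) C.≈ N′.powerSum (suc l)) → N.powerSum (suc k) C.≈ N′.powerSum (suc k)
      helper k ih with ℕ.<-cmp (suc k) m
      ... | tri< k<m _ _    = ℂᵣ.trans (N.powerSum-low (suc k) (λ ()) k<m) (ℂᵣ.sym (N′.powerSum-low (suc k) (λ ()) k<m))
      ... | tri≈ _ ≡.refl _ = ℂᵣ.trans N.powerSum-m (ℂᵣ.sym N′.powerSum-m)
      ... | tri> _ _ m<k with o , m+o≡ ← m<n⇒m+[1+o]≡n m<k =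
        ≡.subst (λ i → N.powerSum i C.≈ N′.powerSum i) o+m≡ (ℂᵣ.trans (N.powerSum-periodic o)
          (ℂᵣ.trans (ℂᵣ.*-congˡ {C.- C.1#} (ih o o<k)) (ℂᵣ.sym (N′.powerSum-periodic o))))
        where
        o+m≡ : suc o ℕ.+ m ≡ suc k
        o+m≡ = ≡.trans (ℕ.+-comm (suc o) m) m+o≡
        o<k : o ℕ.< k
        o<k = ℕ.s≤s⁻¹ (≡.subst (suc o ℕ.<_) m+o≡ (ℕ.m<n+m (suc o) (ℕ.n≢0⇒n>0 N.m≢0)))

    conj-powerSums-agree : ∀ k → ∑ᶜ.sum (λ j → conj (z j) ^ suc k) C.≈ ∑ᶜ.sum (λ j → conj (z′ j) ^ suc k)
    conj-powerSums-agree k = ℂᵣ.trans (conj-sum-^ (suc k) z) (ℂᵣ.trans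
      (proj₁ (powerSums-agree k) , -‿cong (proj₂ (powerSums-agree k))) (ℂᵣ.sym (conj-sum-^ (suc k) z′)))

    -- Expanding the powers of u - v leaves moments that collapse to power sums, or on the diagonal
    -- to the number of nonzero eigenvalues; for a = b = 0 the moment counts all `n` entries of
    -- either list.
    moments-agree : ∀ k a b → moment z (conj ∘ z) k a b C.≈ moment z′ (conj ∘ z′) k a b
    moments-agree (suc k) a b = ℂᵣ.trans (moment-suc z (conj ∘ z) k a b) (ℂᵣ.trans
      (ℂᵣ.+-cong (moments-agree k (suc a) b) (ℂᵣ.-‿cong (moments-agree k a (suc b))))
      (ℂᵣ.sym (moment-suc z′ (conj ∘ z′) k a b)))
    moments-agree zero a b with ℕ.<-cmp a b
    ... | tri≈ _ ≡.refl _ = diagonal a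
      where
      diagonal : ∀ a → moment z (conj ∘ z) 0 a a C.≈ moment z′ (conj ∘ z′) 0 a a
      diagonal zero    = ℂᵣ.refl
      diagonal (suc a) = ℂᵣ.trans (moment-diagonal z (conj ∘ z) N.rz N.rz̄ a) (ℂᵣ.trans
        (ℂᵣ.*-congˡ {collapsed (suc a) 0} (ℂᵣ.trans (N.sum-zz̄) (ℂᵣ.sym N′.sum-zz̄)))
        (ℂᵣ.sym (moment-diagonal z′ (conj ∘ z′) N′.rz N′.rz̄ a)))
    ... | tri< a<b _ _ with o , ≡.refl ← m<n⇒m+[1+o]≡n a<b =
      ℂᵣ.trans (moment-below z (conj ∘ z) N.rz N.rz̄ a o) (ℂᵣ.trans
        (ℂᵣ.*-congˡ {collapsed a (suc o)} (conj-powerSums-agree o)) (ℂᵣ.sym (moment-below z′ (conj ∘ z′) N′.rz N′.rz̄ a o)))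
    ... | tri> _ _ b<a with o , ≡.refl ← m<n⇒m+[1+o]≡n b<a =
      ℂᵣ.trans (moment-above z (conj ∘ z) N.rz N.rz̄ b o) (ℂᵣ.trans
        (ℂᵣ.*-congˡ {collapsed b (suc o)} (powerSums-agree o)) (ℂᵣ.sym (moment-above z′ (conj ∘ z′) N′.rz N′.rz̄ b o)))

    M-agree : ∀ k → N.M k ≈ N′.M k
    M-agree k = trans (sym (recover (N.M k))) (trans (*-congˡ (trans (sym (N.moment₁₁ k))
      (trans (proj₁ (moments-agree (k ℕ.+ k) 1 1)) (N′.moment₁₁ k)))) (recover (N′.M k)))
      where
      recover : ∀ a → - (ι 2 * ι 2) * (- (half * half) * a) ≈ a
      recover a = modulo (a * (ι 2 * half + 1#)) 2*half
        (solve 3 (λ i h a → (:- (i :* i)) :* ((:- (h :* h)) :* a) := a :+ a :* (i :* h :+ con (ℤ.+ 1)) :* (i :* h :- con (ℤ.+ 1))) refl (ι 2) half a)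

    -- The upper approximants have equal sums for both spectra, because these are functions of the
    -- moments. Each exceeds the true value by at most `w J`.
    energy-within : ∀ J → totalEnergy z ≤ totalEnergy z′ + ι n * w J
    energy-within J = ≤-trans (sum-mono-≤ (λ j → ∣ re (z j) ∣) (above N J) (∣x∣-above N J))
      (≤-trans (≤-reflexive (trans (sum-above N J) (trans
        (+-cong (momentSum-cong J (λ k _ → M-agree k)) (*-congˡ (M-agree J))) (sym (sum-above N′ J)))))
      (≤-trans (sum-mono-≤ (above N′ J) (λ j → ∣ re (z′ j) ∣ + w J) (above-∣x∣ N′ J))
        (≤-reflexive (trans (∑.∑-distrib-+ (λ j → ∣ re (z′ j) ∣) (λ _ → w J)) (+-congˡ (sum-const n (w J)))))))
      where
      sum-const : ∀ n a → ∑.sum {n} (λ _ → a) ≈ ι n * a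
      sum-const zero    a = sym (zeroˡ a)
      sum-const (suc n) a = trans (+-congˡ (sum-const n a)) (solve 2 (λ i a → a :+ i :* a := (con (ℤ.+ 1) :+ i) :* a) refl (ι n) a)

    -- A gap δ > 0 would give δ ≤ n `w J` for all J, hence 1 ≤ (n/δ)² `v J`. An Archimedean choice
    -- of J above (n/δ)² contradicts `odd*v≤1`; squaring avoids any estimate of `w J` itself.
    energy-agree : totalEnergy z ≤ totalEnergy z′
    energy-agree E′<E with δ⁻¹ , 0<δ⁻¹ , δδ⁻¹≈1 ← reciprocal (0<y-x E′<E)
                     with J , a²<J ← archimedean (ι n * δ⁻¹ * (ι n * δ⁻¹))
      = <-irrefl refl (≤-<-trans 1≤a²v (≤-<-trans (*-monoʳ-≤ (<⇒≤ (v-pos J)) (<⇒≤ a²<J)) Jv<1))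
      where
      δ = totalEnergy z - totalEnergy z′
      a = ι n * δ⁻¹
      δ≤nw : δ ≤ ι n * w J
      δ≤nw = ≤-by (totalEnergy z′ + ι n * w J - totalEnergy z) (0≤y-x (energy-within J))
        (solve 3 (λ e e′ t → t := e :- e′ :+ (e′ :+ t :- e)) refl (totalEnergy z) (totalEnergy z′) (ι n * w J))
      1≤aw : 1# ≤ a * w J
      1≤aw = ≤-trans (≤-reflexive (sym δδ⁻¹≈1)) (≤-trans (*-monoʳ-≤ (<⇒≤ 0<δ⁻¹) δ≤nw)
        (≤-reflexive (solve 3 (λ n w d → n :* w :* d := n :* d :* w) refl (ι n) (w J) δ⁻¹)))
      1≤a²v : 1# ≤ a * a * v J
      1≤a²v = ≤-trans 1≤aw (≤-trans (≤-reflexive (sym (*-identityʳ _)))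
        (≤-trans (*-monoˡ-≤ (≤-trans (<⇒≤ 0<1) 1≤aw) 1≤aw)
          (≤-reflexive (solve 2 (λ a w → a :* w :* (a :* w) := a :* a :* (w :* w)) refl a (w J)))))
      Jv<1 : ι J * v J < 1#
      Jv<1 = <-≤-trans (<-by ((1# + ι J) * v J) (*-pos (ι-pos J) (v-pos J))
        (solve 2 (λ j v → (con (ℤ.+ 1) :+ (j :+ j)) :* v := j :* v :+ (con (ℤ.+ 1) :+ j) :* v) refl (ι J) (v J))) (odd*v≤1 J)

-- Negative cycles are unicyclic.

next-last : ∀ k → next (fromℕ k) ≡ zero
next-last k = toℕ-injective (toℕ-next-last (fromℕ k) (toℕ-fromℕ k))

next-inject₁ : ∀ {k} (i : Fin k) → next (inject₁ i) ≡ suc i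
next-inject₁ {k} i = toℕ-injective (≡.trans
  (toℕ-next-< (inject₁ i) (≡.subst (ℕ._< k) (≡.sym (toℕ-inject₁ i)) (toℕ<n i))) (≡.cong suc (toℕ-inject₁ i)))

-- Stepping climbs from `i` to the last index and wraps around to zero, from where ordinary
-- induction covers everything.
next-reaches-all : ∀ {p k} (P : Fin (suc k) → Set p) → (∀ i → P i → P (next i)) → ∀ i → P i → ∀ j → P j
next-reaches-all {k = k} P step i Pi = <-weakInduction P P-zero λ j Pj → ≡.subst P (next-inject₁ j) (step _ Pj)
  where
  P-zero : P zero
  P-zero = ≡.subst P (next-last k) (step _ (>-weakInduction (λ j → P j → P (fromℕ k)) id
    (λ j toLast Pj → toLast (≡.subst P (next-inject₁ j) (step _ Pj))) i Pi))

-- Each arc of another cycle `d` lies on the given cycle, so `d` can only advance along it; being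
-- closed under the successor, it passes through every vertex.
negativeCycle-unique : ∀ {n} {C : Sidigraph n} (neg : IsNegativeCycle C) → ∀ d → SameCycle (IsNegativeCycle.cycle neg) d
negativeCycle-unique {C = C} neg d u w = mk⇔ to from
  where
  open IsNegativeCycle neg
  module c = Cycle cycle
  module d = Cycle d

  from : d.Traverses u w → c.Traverses u w
  from (i , ≡.refl , ≡.refl) = allArcs (d.isArc i)

  d-covers : ∀ a → ∃[ i ] d.vertex i ≡ c.vertex a
  d-covers with a , c≡d , _ ← allArcs (d.isArc zero) =
    next-reaches-all (λ a → ∃[ i ] d.vertex i ≡ c.vertex a) step a (zero , ≡.sym c≡d)
    where
    step : ∀ a → (∃[ i ] d.vertex i ≡ c.vertex a) → ∃[ i ] d.vertex i ≡ c.vertex (next a)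
    step a (i , d≡c) with b , c≡d , next≡ ← allArcs (d.isArc i)
                     with ≡.refl ← c.vertex-inj (≡.trans c≡d d≡c) = next i , ≡.sym next≡

  to : c.Traverses u w → d.Traverses u w
  to (a , ≡.refl , ≡.refl) with i , d≡c ← d-covers a
                           with b , c≡d , next≡ ← allArcs (d.isArc i)
                           with ≡.refl ← c.vertex-inj (≡.trans c≡d d≡c) = i , d≡c , ≡.sym next≡

-- Comparison of energies.

module _ {c ℓ₁ ℓ₂} (ℝ : RealField c ℓ₁ ℓ₂) where
  open RealField ℝ hiding (zero)
  open OrderedField ℝ
  open Energy ℝ
  open ComplexNumbers ℝ
  open NegativeSpectrum ℝ
  open CentralBinomialBounds ℝ
  open EnergyBounds ℝ
  open EqualLength ℝ
  open CharacteristicPolynomial ℂ-ring using (charPoly-unicyclic)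

  negativeEigenvalues : ∀ {n} {S : Sidigraph n} (c : Cycle S) → (∀ d → SameCycle c d) → Cycle.sign c ≡ Sign.- →
    (s : Spectrum S) → NegativeEigenvalues n (Cycle.length c) (Spectrum.eigenvalue s)
  negativeEigenvalues {n} {S} c unique negative s = record
    { m≢0     = λ ()
    ; m≤n     = injective⇒≤ (Cycle.vertex-inj c)
    ; factors = λ x → ℂᵣ.trans (ℂᵣ.sym (charPoly x)) (Spectrum.splits s x)
    }
    where
    m = Cycle.length c
    charPoly : ∀ x → ℂMat.charPoly (ℂMat.adjacency S) x C.≈ (x ^ n C.+ x ^ (n ∸ m))
    charPoly x = ℂᵣ.trans (charPoly-unicyclic S c unique x) (ℂᵣ.+-congˡ {x ^ n} (ℂᵣ.trans
      (ℂᵣ.reflexive (≡.cong (λ σ → (C.- ℂMat.entry (just σ)) C.* x ^ (n ∸ m)) negative))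
      (ℂSolver.solve 1 (λ t → (ℂSolver.:- ℂSolver.:- ℂSolver.con (ℤ.+ 1)) ℂSolver.:* t ℂSolver.:= t) ℂᵣ.refl (x ^ (n ∸ m)))))

  negativeCycle-eigenvalues : ∀ {n} {C : Sidigraph n} → IsNegativeCycle C →
    (t : Spectrum C) → NegativeEigenvalues n n (Spectrum.eigenvalue t)
  negativeCycle-eigenvalues neg t = ≡.subst (λ m → NegativeEigenvalues _ m (Spectrum.eigenvalue t)) spanning
    (negativeEigenvalues cycle (negativeCycle-unique neg) negative t)
    where open IsNegativeCycle neg

  -- The bounds depend on the cycle length and not on the number of vertices. The two vertex numbers
  -- are therefore independent, and the same inequality serves both maximality and monotonicity.
  energy-increasing : ∀ {n k m l z z′} → 2 ℕ.≤ m → m ℕ.< l →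
    NegativeEigenvalues n m z → NegativeEigenvalues k l z′ → totalEnergy z < totalEnergy z′
  energy-increasing {m = suc (suc i)} {suc (suc j)} (ℕ.s≤s (ℕ.s≤s _)) (ℕ.s≤s (ℕ.s≤s i<j)) N N′ =
    ≤-<-trans (proj₂ (energy-bounds (order i) N))
      (<-≤-trans (upper<lower-trans (ℕ.≤⇒≤′ i<j)) (proj₁ (energy-bounds (order j) N′)))

  maximal : ∀ {n} {S C : Sidigraph n} → Unicyclic S → NonCycleBalanced S → IsNegativeCycle C →
    (s : Spectrum S) (t : Spectrum C) → energy s ≤ energy t
  maximal {n} U@(c , unique) unbalanced neg s t = compare (ℕ.s≤s (ℕ.s≤s ℕ.z≤n)) (ℕ.m≤n⇒m<n∨m≡n (NegativeEigenvalues.m≤n N)) N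
    where
    N = negativeEigenvalues c unique (unicyclic-negative U unbalanced) s
    N′ = negativeCycle-eigenvalues neg t
    -- The cycle length is generalised to a variable so that its equality with `n` can be matched.
    compare : ∀ {m} → 2 ℕ.≤ m → m ℕ.< n ⊎ m ≡ n → NegativeEigenvalues n m (Spectrum.eigenvalue s) → energy s ≤ energy t
    compare 2≤m (inj₁ m<n)    N = <⇒≤ (energy-increasing 2≤m m<n N N′)
    compare 2≤m (inj₂ ≡.refl) N = energy-agree N N′

theorem3p1 : ∀ {c ℓ₁ ℓ₂} (ℝ : RealField c ℓ₁ ℓ₂) →
    let open RealField ℝ
        open Energy ℝ
    in
      (∀ n → 2 ℕ.≤ n →
       (S C : Sidigraph n) → Unicyclic S → NonCycleBalanced S → IsNegativeCycle C →
       (s : Spectrum S) (t : Spectrum C) → energy s ≤ energy t)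
    × (∀ m n → 2 ℕ.≤ m → m ℕ.< n →
       (B : Sidigraph m) (C : Sidigraph n) → IsNegativeCycle B → IsNegativeCycle C →
       (s : Spectrum B) (t : Spectrum C) → energy s < energy t)
    × (∀ n → 2 ℕ.≤ n →
       (S : Sidigraph n) (C : Sidigraph 2) → Unicyclic S → NonCycleBalanced S → IsNegativeCycle C →
       (s : Spectrum S) (t : Spectrum C) → energy t ≤ energy s)
theorem3p1 ℝ =
    (λ n _ S C U unbalanced neg s t → maximal ℝ U unbalanced neg s t)
  , (λ m n 2≤m m<n B C negB negC s t → energy-increasing ℝ 2≤m m<n
      (negativeCycle-eigenvalues ℝ negB s) (negativeCycle-eigenvalues ℝ negC t))
  , (λ n _ S C (c , unique) unbalanced neg s t → ≤-trans
      (≤-reflexive (energy-2 (negativeCycle-eigenvalues ℝ neg t)))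
      (energy-nonneg (negativeEigenvalues ℝ c unique (unicyclic-negative (c , unique) unbalanced) s)))
  where
  open OrderedField ℝ
  open EnergyBounds ℝ
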